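{- For each integer $k \ge 4$ with $k\neq 5$ there is a positive constant $c_k$ such that the following holds. Let $k,\ell$ be fixed integers with $4 \leq k$, $k \neq 5$, $2 \leq \ell$ and $\ell \neq k$, and let $n$ be an integer with $k\le 2^n$ and $\ell \le 2^n$. Then, as $n\to\infty$, \[ \binom{n}{\ell}^{ -1} \frac{2^{\ell-\lceil\log_2(2 \ell)\rceil}}{z_{\ell, \ell}} (1 - o(1)) \leq \mathbf{d}(Q_n, C_{2 \ell}, C_{2k}) \leq c_k\, n^{ -\frac{1}{16}} . \]
   Context: $Q_n$ denotes the $n$-dimensional hypercube: its vertices are the binary vectors of length $n$, two vectors being adjacent iff they differ in exactly one coordinate (the flip coordinate of the edge). $C_m$ is the cycle on $m$ vertices. For graphs $G$ and $T$, a copy of $T$ in $G$ is a subgraph of $G$ isomorphic to $T$, and $N(G,T)$ is the number of copies of $T$ in $G$. A graph is $H$-free if it has no subgraph isomorphic to $H$. For subgraphs $T,H$ of $G$, $\mathrm{ex}(G,T,H)=\max\{N(G',T): G'\subseteq G,\ G' \text{ is } H\text{ -free}\}$ and $\mathbf{d}(G,T,H)=\mathrm{ex}(G,T,H)/N(G,T)$. For integers $k,\ell$, $z_{k,\ell}$ denotes the number of copies of $C_{2\ell}$ in $Q_k$ whose edges together use all $k$ coordinates as flip coordinates. The term $o(1)$ denotes a nonnegative quantity tending to $0$ as $n\to\infty$ with $k,\ell$ fixed. -}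

module Defs where

open import Data.Bool using (Bool; true; false; _∧_; not)
open import Data.Nat using (ℕ; zero; suc; _+_; _*_; _∸_; _^_; _⊔_)
open import Data.Nat.Combinatorics using (_C_)
open import Data.Nat.Logarithm using (⌈log₂_⌉)
open import Data.Fin using (Fin)
import Data.Fin as Fin
open import Data.Vec using (Vec; lookup; _[_]≔_)
import Data.Vec as Vec
open import Data.Vec.Properties using (≡-dec)
import Data.Bool.Properties as BoolP
open import Data.List using (List; []; _∷_; [_]; map; concatMap; filterᵇ; length; allFin; foldr; _++_)
open import Data.Bool.ListAction using (all; any)
open import Data.Product using (_×_; _,_; proj₁; proj₂)
open import Relation.Nullary.Decidable using (⌊_⌋)
open import Data.Integer using (+_)
open import Data.Rational using (ℚ; 0ℚ; 1ℚ) renaming (_/_ to _/ℚ_; _*_ to _*ℚ_)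

Vert : ℕ → Set
Vert n = Vec Bool n

allVerts : (n : ℕ) → List (Vert n)
allVerts zero    = [ Vec.[] ]
allVerts (suc n) = concatMap (λ v → (false Vec.∷ v) ∷ (true Vec.∷ v) ∷ []) (allVerts n)

_==ᵛ_ : {n : ℕ} → Vert n → Vert n → Bool
u ==ᵛ v = ⌊ ≡-dec BoolP._≟_ u v ⌋

_==ᶠ_ : {n : ℕ} → Fin n → Fin n → Bool
i ==ᶠ j = ⌊ i Fin.≟ j ⌋

-- An edge of Q_n is represented canonically by (v , i) with v_i = false:
-- it joins v and v with coordinate i set to true; i is its flip coordinate.
Edge : ℕ → Set
Edge n = Vert n × Fin n

cubeEdges : (n : ℕ) → List (Edge n)
cubeEdges n =
  concatMap (λ v → map (λ i → v , i) (filterᵇ (λ i → not (lookup v i)) (allFin n)))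
            (allVerts n)

_==ᵉ_ : {n : ℕ} → Edge n → Edge n → Bool
(u , i) ==ᵉ (v , j) = (u ==ᵛ v) ∧ (i ==ᶠ j)

_∈ᵉ_ : {n : ℕ} → Edge n → List (Edge n) → Bool
e ∈ᵉ S = any (e ==ᵉ_) S

joins : {n : ℕ} → Edge n → Vert n × Vert n → Bool
joins (v , i) (a , b) =
  ((a ==ᵛ v) ∧ (b ==ᵛ (v [ i ]≔ true))) Data.Bool.∨ ((b ==ᵛ v) ∧ (a ==ᵛ (v [ i ]≔ true)))

subsets : {A : Set} → List A → List (List A)
subsets []       = [ [] ]
subsets (x ∷ xs) = let r = subsets xs in r ++ map (x ∷_) r

tuples : {A : Set} → List A → ℕ → List (List A)
tuples xs zero    = [ [] ]
tuples xs (suc m) = concatMap (λ x → map (x ∷_) (tuples xs m)) xs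

cycPairs : {A : Set} → List A → List (A × A)
cycPairs []       = []
cycPairs (x ∷ xs) = go (x ∷ xs)
  where
  go : _ → _
  go []            = []
  go (a ∷ [])      = (a , x) ∷ []
  go (a ∷ b ∷ r)   = (a , b) ∷ go (b ∷ r)

distinctᵛ : {n : ℕ} → List (Vert n) → Bool
distinctᵛ []       = true
distinctᵛ (x ∷ xs) = not (any (x ==ᵛ_) xs) ∧ distinctᵛ xs

maxList : List ℕ → ℕ
maxList = foldr _⊔_ 0

isCycleEdges : {n : ℕ} → List (Edge n) → List (Vert n) → Bool
isCycleEdges S w =
  distinctᵛ w
  ∧ all (λ p → any (λ e → joins e p) S) (cycPairs w)
  ∧ all (λ e → any (λ p → joins e p) (cycPairs w)) S

-- A subgraph of Q_n is identified with its edge set G (a sublist of cubeEdges n).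
-- Copies of C_m in G: edge sets S ⊆ G of subgraphs isomorphic to C_m
-- (a subgraph isomorphic to a cycle has no isolated vertices, so it is
-- determined by its edge set).
copies : (n m : ℕ) → List (Edge n) → List (List (Edge n))
copies n m G =
  filterᵇ (λ S → any (λ w → isCycleEdges S w) (tuples (allVerts n) m))
          (subsets G)

N : (n m : ℕ) → List (Edge n) → ℕ
N n m G = length (copies n m G)

FreeB : (n m : ℕ) → List (Edge n) → Bool
FreeB n m G = Data.Nat._≡ᵇ_ (N n m G) 0

ex : (n m h : ℕ) → ℕ
ex n m h = maxList (map (N n m) (filterᵇ (FreeB n h) (subsets (cubeEdges n))))

z : (k ℓ : ℕ) → ℕ
z k ℓ = length (filterᵇ (λ S → all (λ i → any (λ e → proj₂ e ==ᶠ i) S) (allFin k))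
                        (copies k (2 * ℓ) (cubeEdges k)))

-- a / b as a rational; convention a / 0 = 0 (only used where b > 0).
frac : ℕ → ℕ → ℚ
frac a zero    = 0ℚ
frac a (suc b) = (+ a) /ℚ (suc b)

powℚ : ℚ → ℕ → ℚ
powℚ q zero    = 1ℚ
powℚ q (suc m) = q *ℚ powℚ q m

d : (n m h : ℕ) → ℚ
d n m h = frac (ex n m h) (N n m (cubeEdges n))

lowerTerm : (n ℓ : ℕ) → ℚ
lowerTerm n ℓ = frac (2 ^ (ℓ ∸ ⌈log₂ (2 * ℓ) ⌉)) ((n C ℓ) * z ℓ ℓ)

{-# OPTIONS --safe #-}

-- Upper bound. The cube is edge-transitive, so a fraction δ of its edges carries O(δ) of its
-- C_2ℓ's, and it suffices to show that a C_2k-free G has O(n^(-1/12)) of the edges. Otherwise,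
-- by convexity, some vertex b has many triples xyz such that the three edges going down from
-- b + xyz lie in G. By Cauchy-Schwarz two directions z, z' have a dense common link L on the
-- pairs xy, and dependent random choice in L gives p and a large set U of L-neighbours of p in
-- which any two elements have many common neighbours. A path in L that alternates between U
-- and its common neighbours and ends in p lifts to a walk {s₀,s₁,z}, {s₁,z}, {s₁,s₂,z}, … above b.
-- It closes up through p to a C_2k for even k. For odd k ≥ 7 it closes up through a further
-- neighbour of p and a detour through z', which changes the parity.
--
-- Lower bound. Split the cube into subcubes of dimension m = ⌈log₂ 2ℓ⌉ and place a C_2ℓ in each:
-- the only cycles are the 2^(n-m) placed ones. A C_2ℓ uses at most ℓ directions, so the cube has
-- 2^(n-ℓ) (n C ℓ) z_ℓℓ of them, up to those in a subcube of dimension ℓ - 1, which are fewer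
-- by a factor of order n.
module Submission where

open import Defs
open import Data.Bool using (Bool; true; false; _∧_; _∨_; not; T; _xor_)
open import Data.Bool.ListAction using (any; all)
open import Data.Bool.Properties using (not-involutive; xor-assoc; xor-same; xor-identityʳ)
open import Data.Empty using (⊥; ⊥-elim)
open import Data.Fin as Fin using (Fin; zero; suc; _↑ˡ_)
open import Data.Fin.Permutation using (Permutation′; transpose; _⟨$⟩ʳ_; _⟨$⟩ˡ_; inverseˡ; inverseʳ)
open import Data.List as List using (List; []; _∷_; map; concatMap; filterᵇ; length; _++_; allFin; drop; [_]; cartesianProduct)
open import Data.List.Membership.Propositional using (_∈_; _∉_; find; lose)
open import Data.List.Membership.Propositional.Properties using (∈-++⁺ˡ; ∈-++⁺ʳ; ∈-++⁻; ∈-∃++; ∈-map⁺; ∈-map⁻; ∈-allFin; ∈-cartesianProduct⁺)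
open import Data.List.Properties using (length-++; length-tabulate; length-map; map-∘; map-id; map-cong)
open import Data.List.Relation.Binary.Sublist.Propositional using (_⊆_; []; _∷_; _∷ʳ_; ⊆-trans; ⊆-refl)
open import Data.List.Relation.Unary.All as All using ([]; _∷_)
open import Data.List.Relation.Unary.All.Properties using (All¬⇒¬Any; ¬Any⇒All¬)
open import Data.List.Relation.Unary.AllPairs using ([]; _∷_)
open import Data.List.Relation.Unary.Any using (here; there; any?)
open import Data.List.Relation.Unary.Unique.DecPropositional using (unique?)
open import Data.List.Relation.Unary.Unique.Propositional using (Unique)
open import Data.Nat using (ℕ; zero; suc; _+_; _*_; _≤_; z≤n; s≤s; _^_; _<_; _<ᵇ_; _≤?_; NonZero; _⊔_; _≡ᵇ_; _∸_; ⌈_/2⌉; ⌊_/2⌋; >-nonZero; _/_; _%_)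
open import Data.Nat.Combinatorics using (_C_; nCk+nC[k+1]≡[n+1]C[k+1]; k>n⇒nCk≡0)
open import Data.Nat.DivMod using (m≡m%n+[m/n]*n; m%n<n)
open import Data.Nat.Logarithm using (⌈log₂_⌉; ⌈log₂⌉-mono-≤; ⌈log₂⌈n/2⌉⌉≡⌈log₂n⌉∸1; ⌈log₂2*n⌉≡1+⌈log₂n⌉; ⌈log₂2^n⌉≡n)
open import Data.Nat.Properties
open import Data.Nat.Solver using (module +-*-Solver)
open import Data.Nat.Tactic.RingSolver using (solve-∀)
open import Data.Product using (∃; ∃-syntax; _×_; _,_; proj₁; proj₂)
open import Data.Rational as ℚ using (ℚ; 0ℚ; 1ℚ; mkℚ; toℚᵘ; _-_) renaming (_<_ to _<ℚ_; _≤_ to _≤ℚ_; _*_ to _*ℚ_; _/_ to _/ℚ_)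
open import Data.Rational.Unnormalised as ℚᵘ using (mkℚᵘ; *≤*)
open import Data.Sum using (_⊎_; inj₁; inj₂)
open import Data.Unit using (⊤; tt)
open import Data.Vec as Vec using (Vec; lookup; _[_]≔_; []; _∷_; tabulate; head; tail)
open import Data.Vec.Properties using (≡-dec; lookup∘tabulate; tabulate∘lookup; tabulate-cong; ++-injective)
open import Relation.Binary.PropositionalEquality
open import Relation.Nullary using (¬_; Dec; yes; no; ¬?)
open import Relation.Nullary.Decidable using (⌊_⌋; from-yes; decidable-stable)
import Data.Bool.Properties as BoolP
import Data.Integer.Properties as ℤ
import Data.List.Membership.DecPropositional as DecMembership
import Data.List.Relation.Unary.Unique.Propositional.Properties as Uniqueₚ
import Data.Rational.Properties as ℚ
import Data.Rational.Unnormalised.Properties as ℚᵘ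
open +-*-Solver using (solve; _:=_; _:+_; _:*_; _:^_; con)

-- The code runs the argument as a chain of upper bounds rather than by extracting dense
-- configurations. If no `U p q` has more than k elements, then each common link has O(n^(3/2))
-- pairs, each b has O(n^(11/4)) triples, and t = |G| / 2^n satisfies t^12 = O(n^11): the cube comes
-- from convexity, the two squares from Cauchy-Schwarz and dependent random choice. Real roots never
-- occur; inequalities are kept between powers, with integer square roots where a bound on a square
-- has to become a bound on the number. The constant c_k may not depend on ℓ, but the passage from
-- edges to cycles loses a factor of order ℓ. The gap between the exponents 1/12 and 1/16 absorbs
-- this factor, and every constant in k, as soon as n is large; c_k = 1 suffices. Parity is the
-- obstacle to closing the walk: a link cycle that alternates between `U` and common neighbours is
-- even and lifts to C_2k for even k only. Exchanging z for z' and back lengthens the cycle by six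
-- vertices, so it shifts k by 3 and reaches 7, 9, and so on; only k = 5 is left out.

private variable
  A B : Set
  n : ℕ

-- Booleans, list membership and counting by injections

∧-true : ∀ {a b} → a ∧ b ≡ true → a ≡ true × b ≡ true
∧-true {true} e = refl , e

∨-true : ∀ {a b} → a ∨ b ≡ true → a ≡ true ⊎ b ≡ true
∨-true {true} _ = inj₁ refl
∨-true {false} e = inj₂ e

∨-trueˡ : ∀ {a} b → a ≡ true → a ∨ b ≡ true
∨-trueˡ _ refl = refl

∨-trueʳ : ∀ a {b} → b ≡ true → a ∨ b ≡ true
∨-trueʳ true _ = refl
∨-trueʳ false e = e

∧-intro : ∀ {a b} → a ≡ true → b ≡ true → a ∧ b ≡ true
∧-intro refl refl = refl

not-true : ∀ {a} → not a ≡ true → a ≡ false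
not-true {false} _ = refl

true≢false : {b : Bool} → b ≡ true → b ≡ false → ⊥
true≢false refl ()

≢true⇒false : {b : Bool} → ¬ b ≡ true → b ≡ false
≢true⇒false {true} h = ⊥-elim (h refl)
≢true⇒false {false} h = refl

⌊⌋-true : {P : Set} (d : Dec P) → ⌊ d ⌋ ≡ true → P
⌊⌋-true (yes p) _ = p

true-⌊⌋ : {P : Set} (d : Dec P) → P → ⌊ d ⌋ ≡ true
true-⌊⌋ (yes p) _ = refl
true-⌊⌋ (no ¬p) p = ⊥-elim (¬p p)

any-true : (p : A → Bool) (xs : List A) → any p xs ≡ true → ∃ λ x → x ∈ xs × p x ≡ true
any-true p (x ∷ xs) e with ∨-true {p x} e
... | inj₁ h = x , here refl , h
... | inj₂ h with any-true p xs h
... | y , y∈ , py = y , there y∈ , py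

true-any : (p : A → Bool) {xs : List A} {x : A} → x ∈ xs → p x ≡ true → any p xs ≡ true
true-any p {x ∷ xs} (here refl) e = ∨-trueˡ _ e
true-any p {x ∷ xs} (there x∈) e = ∨-trueʳ (p x) (true-any p x∈ e)

all-true : (p : A → Bool) {xs : List A} {x : A} → all p xs ≡ true → x ∈ xs → p x ≡ true
all-true p {y ∷ xs} e (here refl) = proj₁ (∧-true e)
all-true p {y ∷ xs} e (there x∈) = all-true p (proj₂ (∧-true {p y} e)) x∈

true-all : (p : A → Bool) (xs : List A) → (∀ {x} → x ∈ xs → p x ≡ true) → all p xs ≡ true
true-all p [] h = refl
true-all p (x ∷ xs) h = ∧-intro (h (here refl)) (true-all p xs (λ x∈ → h (there x∈)))

∈-filterᵇ⁺ : (p : A → Bool) {xs : List A} {x : A} → x ∈ xs → p x ≡ true → x ∈ filterᵇ p xs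
∈-filterᵇ⁺ p {y ∷ xs} (here refl) e rewrite e = here refl
∈-filterᵇ⁺ p {y ∷ xs} (there x∈) e with p y
... | true = there (∈-filterᵇ⁺ p x∈ e)
... | false = ∈-filterᵇ⁺ p x∈ e

∈-filterᵇ⁻ : (p : A → Bool) (xs : List A) {x : A} → x ∈ filterᵇ p xs → x ∈ xs × p x ≡ true
∈-filterᵇ⁻ p (y ∷ xs) x∈ with p y in e
∈-filterᵇ⁻ p (y ∷ xs) (here refl) | true = here refl , e
∈-filterᵇ⁻ p (y ∷ xs) (there x∈) | true = there (proj₁ (∈-filterᵇ⁻ p xs x∈)) , proj₂ (∈-filterᵇ⁻ p xs x∈)
∈-filterᵇ⁻ p (y ∷ xs) x∈ | false = there (proj₁ (∈-filterᵇ⁻ p xs x∈)) , proj₂ (∈-filterᵇ⁻ p xs x∈)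

∈-concatMap⁺ : (f : A → List B) {xs : List A} {x : A} {y : B} → x ∈ xs → y ∈ f x → y ∈ concatMap f xs
∈-concatMap⁺ f (here refl) y∈ = ∈-++⁺ˡ y∈
∈-concatMap⁺ f {z ∷ _} (there x∈) y∈ = ∈-++⁺ʳ (f z) (∈-concatMap⁺ f x∈ y∈)

∈-concatMap⁻ : (f : A → List B) (xs : List A) {y : B} → y ∈ concatMap f xs → ∃ λ x → x ∈ xs × y ∈ f x
∈-concatMap⁻ f (x ∷ xs) y∈ with ∈-++⁻ (f x) y∈
... | inj₁ h = x , here refl , h
... | inj₂ h with ∈-concatMap⁻ f xs h
... | x' , x'∈ , h' = x' , there x'∈ , h'

filterᵇ-⊆ : (p : A → Bool) (xs : List A) → filterᵇ p xs ⊆ xs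
filterᵇ-⊆ p [] = []
filterᵇ-⊆ p (x ∷ xs) with p x
... | true = refl ∷ filterᵇ-⊆ p xs
... | false = x ∷ʳ filterᵇ-⊆ p xs

⊆-∈ : {xs ys : List A} {x : A} → xs ⊆ ys → x ∈ xs → x ∈ ys
⊆-∈ (_ ∷ʳ s) x∈ = there (⊆-∈ s x∈)
⊆-∈ (refl ∷ s) (here e) = here e
⊆-∈ (refl ∷ s) (there x∈) = there (⊆-∈ s x∈)

∷-unique : {x : A} {xs : List A} → x ∉ xs → Unique xs → Unique (x ∷ xs)
∷-unique h u = ¬Any⇒All¬ _ h ∷ u

unique-head : {x : A} {xs : List A} → Unique (x ∷ xs) → x ∉ xs
unique-head (a ∷ u) = All¬⇒¬Any a

unique-tail : {x : A} {xs : List A} → Unique (x ∷ xs) → Unique xs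
unique-tail (_ ∷ u) = u

unique-⊆ : {xs ys : List A} → xs ⊆ ys → Unique ys → Unique xs
unique-⊆ [] u = []
unique-⊆ (y ∷ʳ s) (_ ∷ u) = unique-⊆ s u
unique-⊆ (refl ∷ s) u = ∷-unique (λ h → unique-head u (⊆-∈ s h)) (unique-⊆ s (unique-tail u))

unique-filterᵇ : (p : A → Bool) (xs : List A) → Unique xs → Unique (filterᵇ p xs)
unique-filterᵇ p xs u = unique-⊆ (filterᵇ-⊆ p xs) u

-- Sublists of a duplicate-free list inherit its order, so their members determine them. Edge sets
-- can thus be compared as sets although `copies` counts lists.
⊆-ext : {xs ys zs : List A} → Unique zs → xs ⊆ zs → ys ⊆ zs →
        (∀ {x} → x ∈ xs → x ∈ ys) → (∀ {x} → x ∈ ys → x ∈ xs) → xs ≡ ys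
⊆-ext u [] [] f g = refl
⊆-ext (_ ∷ u) (_ ∷ʳ s) (_ ∷ʳ t) f g = ⊆-ext u s t f g
⊆-ext u (_ ∷ʳ s) (refl ∷ t) f g = ⊥-elim (unique-head u (⊆-∈ s (g (here refl))))
⊆-ext u (refl ∷ s) (_ ∷ʳ t) f g = ⊥-elim (unique-head u (⊆-∈ t (f (here refl))))
⊆-ext u (refl ∷ s) (refl ∷ t) f g = cong (_ ∷_) (⊆-ext (unique-tail u) s t f' g')
  where
  f' : ∀ {x} → x ∈ _ → x ∈ _
  f' x∈ with f (there x∈)
  ... | here refl = ⊥-elim (unique-head u (⊆-∈ s x∈))
  ... | there h = h
  g' : ∀ {x} → x ∈ _ → x ∈ _
  g' x∈ with g (there x∈)
  ... | here refl = ⊥-elim (unique-head u (⊆-∈ t x∈))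
  ... | there h = h

unique-++ : {xs ys : List A} → Unique xs → Unique ys → (∀ {x} → x ∈ xs → x ∉ ys) → Unique (xs ++ ys)
unique-++ u v d = Uniqueₚ.++⁺ u v (λ (a , b) → d a b)

unique-map : {f : A → B} {xs : List A} → (∀ {x y} → f x ≡ f y → x ≡ y) → Unique xs → Unique (map f xs)
unique-map h u = Uniqueₚ.map⁺ h u

unique-map⁻ : {f : A → B} {xs : List A} → Unique (map f xs) → Unique xs
unique-map⁻ {xs = []} u = []
unique-map⁻ {f = f} {xs = x ∷ xs} u = ∷-unique (λ h → unique-head u (∈-map⁺ f h)) (unique-map⁻ (unique-tail u))

unique-concatMap : (f : A → List B) {xs : List A} → Unique xs → (∀ x → Unique (f x)) →
  (∀ {x x' y} → y ∈ f x → y ∈ f x' → x ≡ x') → Unique (concatMap f xs)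
unique-concatMap f {[]} u v d = []
unique-concatMap f {x ∷ xs} u v d = unique-++ (v x) (unique-concatMap f (unique-tail u) v d) h
  where
  h : ∀ {y} → y ∈ f x → y ∉ concatMap f xs
  h y∈ y∈' with ∈-concatMap⁻ f xs y∈'
  ... | x' , x'∈ , y∈″ with d y∈ y∈″
  ... | refl = unique-head u x'∈

∈-subsets⁺ : {S xs : List A} → S ⊆ xs → S ∈ subsets xs
∈-subsets⁺ [] = here refl
∈-subsets⁺ (y ∷ʳ s) = ∈-++⁺ˡ (∈-subsets⁺ s)
∈-subsets⁺ {xs = x ∷ xs} (refl ∷ s) = ∈-++⁺ʳ (subsets xs) (∈-map⁺ (x ∷_) (∈-subsets⁺ s))

∈-subsets⁻ : {S : List A} (xs : List A) → S ∈ subsets xs → S ⊆ xs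
∈-subsets⁻ [] (here refl) = []
∈-subsets⁻ (x ∷ xs) h with ∈-++⁻ (subsets xs) h
... | inj₁ h' = x ∷ʳ ∈-subsets⁻ xs h'
... | inj₂ h' with ∈-map⁻ (x ∷_) h'
... | S' , S'∈ , refl = refl ∷ ∈-subsets⁻ xs S'∈

unique-subsets : {xs : List A} → Unique xs → Unique (subsets xs)
unique-subsets {xs = []} u = [] ∷ []
unique-subsets {xs = x ∷ xs} u = unique-++ ih (unique-map (λ { refl → refl }) ih) disj
  where
  ih = unique-subsets (unique-tail u)
  disj : ∀ {S} → S ∈ subsets xs → S ∉ map (x ∷_) (subsets xs)
  disj S∈ h with ∈-map⁻ (x ∷_) h
  ... | S' , S'∈ , refl = unique-head u (⊆-∈ (∈-subsets⁻ xs S∈) (here refl))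

∈-tuples⁺ : {xs : List A} (w : List A) → (∀ x → x ∈ xs) → w ∈ tuples xs (length w)
∈-tuples⁺ [] h = here refl
∈-tuples⁺ {xs = xs} (a ∷ w) h = ∈-concatMap⁺ (λ x → map (x ∷_) (tuples xs (length w))) (h a) (∈-map⁺ (a ∷_) (∈-tuples⁺ w h))

∈-tuples⁻ : {xs : List A} (m : ℕ) {w : List A} → w ∈ tuples xs m → length w ≡ m
∈-tuples⁻ zero (here refl) = refl
∈-tuples⁻ {xs = xs} (suc m) h with ∈-concatMap⁻ (λ x → map (x ∷_) (tuples xs m)) xs h
... | x , _ , h' with ∈-map⁻ (x ∷_) h'
... | w' , w'∈ , refl = cong suc (∈-tuples⁻ m w'∈)

-- Most counting steps below are injections in this form. Partners are given by a relation, so they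
-- may depend on the membership proof; the induction deletes the partner of the head from `ys`.
count-≤ : {R : A → B → Set} {xs : List A} {ys : List B} → Unique xs →
  (∀ {x} → x ∈ xs → ∃ λ y → y ∈ ys × R x y) →
  (∀ {x x' y} → x ∈ xs → x' ∈ xs → R x y → R x' y → x ≡ x') → length xs ≤ length ys
count-≤ {xs = []} u f inj = z≤n
count-≤ {R = R} {xs = x ∷ xs} {ys} u f inj with f (here refl)
... | y , y∈ , r with ∈-∃++ y∈
... | as , bs , refl = ≤-trans (s≤s (count-≤ {R = R} {ys = as ++ bs} (unique-tail u) f' (λ a b → inj (there a) (there b)))) (≤-reflexive eq)
  where
  eq : suc (length (as ++ bs)) ≡ length (as ++ y ∷ bs)
  eq rewrite length-++ as {bs} | length-++ as {y ∷ bs} = sym (+-suc (length as) (length bs))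
  f' : ∀ {x'} → x' ∈ xs → ∃ λ y' → y' ∈ as ++ bs × R x' y'
  f' x'∈ with f (there x'∈)
  ... | y' , y'∈ , r' with ∈-++⁻ as y'∈
  ... | inj₁ h = y' , ∈-++⁺ˡ h , r'
  ... | inj₂ (there h) = y' , ∈-++⁺ʳ as h , r'
  ... | inj₂ (here refl) with inj (here refl) (there x'∈) r r'
  ... | refl = ⊥-elim (unique-head u x'∈)

-- Cycles in the hypercube

flip : Fin n → Vert n → Vert n
flip zero (b ∷ v) = not b ∷ v
flip (suc i) (b ∷ v) = b ∷ flip i v

flip-flip : (i : Fin n) (v : Vert n) → flip i (flip i v) ≡ v
flip-flip zero (b ∷ v) = cong (_∷ v) (not-involutive b)
flip-flip (suc i) (b ∷ v) = cong (b ∷_) (flip-flip i v)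

flip-comm : (i j : Fin n) (v : Vert n) → flip i (flip j v) ≡ flip j (flip i v)
flip-comm zero zero v = refl
flip-comm zero (suc j) (b ∷ v) = refl
flip-comm (suc i) zero (b ∷ v) = refl
flip-comm (suc i) (suc j) (b ∷ v) = cong (b ∷_) (flip-comm i j v)

lookup-flip : (i : Fin n) (v : Vert n) → lookup (flip i v) i ≡ not (lookup v i)
lookup-flip zero (b ∷ v) = refl
lookup-flip (suc i) (b ∷ v) = lookup-flip i v

lookup-flip-≢ : (i j : Fin n) (v : Vert n) → j ≢ i → lookup (flip i v) j ≡ lookup v j
lookup-flip-≢ zero zero v h = ⊥-elim (h refl)
lookup-flip-≢ zero (suc j) (b ∷ v) h = refl
lookup-flip-≢ (suc i) zero (b ∷ v) h = refl
lookup-flip-≢ (suc i) (suc j) (b ∷ v) h = lookup-flip-≢ i j v (λ e → h (cong suc e))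

flip-direction : (i j : Fin n) (v : Vert n) → flip i v ≡ flip j v → i ≡ j
flip-direction zero zero v e = refl
flip-direction zero (suc j) (true ∷ v) ()
flip-direction zero (suc j) (false ∷ v) ()
flip-direction (suc i) zero (true ∷ v) ()
flip-direction (suc i) zero (false ∷ v) ()
flip-direction (suc i) (suc j) (b ∷ v) e = cong suc (flip-direction i j v (cong Vec.tail e))

-- Clearing coordinate i selects the end by which an edge of Q_n is stored, so either end may be
-- used to name it.
edgeAt : Vert n → Fin n → Edge n
edgeAt v i = v [ i ]≔ false , i

edgeAt-flip : (v : Vert n) (i : Fin n) → edgeAt (flip i v) i ≡ edgeAt v i
edgeAt-flip v i = cong (_, i) (down-flip i v)
  where
  down-flip : ∀ {n} (i : Fin n) v → flip i v [ i ]≔ false ≡ v [ i ]≔ false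
  down-flip zero (b ∷ v) = refl
  down-flip (suc i) (b ∷ v) = cong (b ∷_) (down-flip i v)

down≡ : (v : Vert n) (i : Fin n) → lookup v i ≡ false → v [ i ]≔ false ≡ v
down≡ (_ ∷ v) zero refl = refl
down≡ (b ∷ v) (suc i) e = cong (b ∷_) (down≡ v i e)

up≡ : (v : Vert n) (i : Fin n) → lookup v i ≡ false → v [ i ]≔ true ≡ flip i v
up≡ (_ ∷ v) zero refl = refl
up≡ (b ∷ v) (suc i) e = cong (b ∷_) (up≡ v i e)

lookup-down : (v : Vert n) (i : Fin n) → lookup (v [ i ]≔ false) i ≡ false
lookup-down (_ ∷ v) zero = refl
lookup-down (_ ∷ v) (suc i) = lookup-down v i

edgeAt-ends : {u v : Vert n} {i j : Fin n} → edgeAt u i ≡ edgeAt v j → i ≡ j × (u ≡ v ⊎ u ≡ flip i v)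
edgeAt-ends {u = u} {v} {i} e with cong proj₂ e
... | refl = refl , ends i u v (cong proj₁ e)
  where
  ends : ∀ {n} (i : Fin n) u v → u [ i ]≔ false ≡ v [ i ]≔ false → u ≡ v ⊎ u ≡ flip i v
  ends zero (true ∷ u) (true ∷ v) e = inj₁ (cong (true ∷_) (cong Vec.tail e))
  ends zero (true ∷ u) (false ∷ v) e = inj₂ (cong (true ∷_) (cong Vec.tail e))
  ends zero (false ∷ u) (true ∷ v) e = inj₂ (cong (false ∷_) (cong Vec.tail e))
  ends zero (false ∷ u) (false ∷ v) e = inj₁ (cong (false ∷_) (cong Vec.tail e))
  ends (suc i) (a ∷ u) (b ∷ v) e with cong Vec.head e | ends i u v (cong Vec.tail e)
  ... | refl | inj₁ h = inj₁ (cong (a ∷_) h)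
  ... | refl | inj₂ h = inj₂ (cong (a ∷_) h)

==ᵛ⇒≡ : {u v : Vert n} → (u ==ᵛ v) ≡ true → u ≡ v
==ᵛ⇒≡ {u = u} {v} = ⌊⌋-true (≡-dec BoolP._≟_ u v)

==ᵛ-refl : (u : Vert n) → (u ==ᵛ u) ≡ true
==ᵛ-refl u = true-⌊⌋ (≡-dec BoolP._≟_ u u) refl

==ᶠ⇒≡ : {i j : Fin n} → (i ==ᶠ j) ≡ true → i ≡ j
==ᶠ⇒≡ {i = i} {j} = ⌊⌋-true (i Fin.≟ j)

==ᶠ-refl : (i : Fin n) → (i ==ᶠ i) ≡ true
==ᶠ-refl i = true-⌊⌋ (i Fin.≟ i) refl

==ᵉ⇒≡ : {e f : Edge n} → (e ==ᵉ f) ≡ true → e ≡ f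
==ᵉ⇒≡ {e = u , i} {v , j} h with ∧-true h
... | a , b = cong₂ _,_ (==ᵛ⇒≡ a) (==ᶠ⇒≡ b)

∈ᵉ⇒∈ : {e : Edge n} (S : List (Edge n)) → (e ∈ᵉ S) ≡ true → e ∈ S
∈ᵉ⇒∈ {e = e} S h with any-true (e ==ᵉ_) S h
... | f , f∈ , q with ==ᵉ⇒≡ {e = e} {f} q
... | refl = f∈

∈⇒∈ᵉ : {e : Edge n} {S : List (Edge n)} → e ∈ S → (e ∈ᵉ S) ≡ true
∈⇒∈ᵉ {e = u , i} h = true-any _ h (∧-intro (==ᵛ-refl u) (==ᶠ-refl i))

∈-allVerts : (v : Vert n) → v ∈ allVerts n
∈-allVerts [] = here refl
∈-allVerts (false ∷ v) = ∈-concatMap⁺ (λ v → (false ∷ v) ∷ (true ∷ v) ∷ []) (∈-allVerts v) (here refl)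
∈-allVerts (true ∷ v) = ∈-concatMap⁺ (λ v → (false ∷ v) ∷ (true ∷ v) ∷ []) (∈-allVerts v) (there (here refl))

unique-allVerts : (n : ℕ) → Unique (allVerts n)
unique-allVerts zero = [] ∷ []
unique-allVerts (suc n) = unique-concatMap _ (unique-allVerts n)
  (λ v → ((λ ()) ∷ []) ∷ [] ∷ [])
  (λ p q → trans (sym (tail≡ p)) (tail≡ q))
  where
  tail≡ : ∀ {n} {v : Vert n} {y} → y ∈ (false ∷ v) ∷ (true ∷ v) ∷ [] → Vec.tail y ≡ v
  tail≡ (here refl) = refl
  tail≡ (there (here refl)) = refl

∈-cubeEdges⁺ : (v : Vert n) (i : Fin n) → lookup v i ≡ false → (v , i) ∈ cubeEdges n
∈-cubeEdges⁺ v i e = ∈-concatMap⁺ _ (∈-allVerts v)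
  (∈-map⁺ (v ,_) (∈-filterᵇ⁺ _ (∈-allFin i) (cong not e)))

∈-cubeEdges⁻ : {v : Vert n} {i : Fin n} → (v , i) ∈ cubeEdges n → lookup v i ≡ false
∈-cubeEdges⁻ {n} h with ∈-concatMap⁻ (λ v → map (λ i → v , i) (filterᵇ (λ i → not (lookup v i)) (allFin n))) (allVerts n) h
... | v , _ , h' with ∈-map⁻ (v ,_) h'
... | i , i∈ , refl = not-true (proj₂ (∈-filterᵇ⁻ _ (allFin n) i∈))

edgeAt∈cubeEdges : (v : Vert n) (i : Fin n) → edgeAt v i ∈ cubeEdges n
edgeAt∈cubeEdges v i = ∈-cubeEdges⁺ _ i (lookup-down v i)

unique-cubeEdges : (n : ℕ) → Unique (cubeEdges n)
unique-cubeEdges n = unique-concatMap _ (unique-allVerts n)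
  (λ v → unique-map (λ { refl → refl }) (unique-⊆ (filterᵇ-⊆ _ (allFin n)) (Uniqueₚ.allFin⁺ n)))
  (λ p q → trans (sym (base p)) (base q))
  where
  base : ∀ {v : Vert n} {xs y} → y ∈ map (v ,_) xs → proj₁ y ≡ v
  base p with ∈-map⁻ _ p
  ... | _ , _ , refl = refl

joins⇒ : {v a b : Vert n} {i : Fin n} → lookup v i ≡ false → joins (v , i) (a , b) ≡ true →
         b ≡ flip i a × (v , i) ≡ edgeAt a i
joins⇒ {v = v} {a} {b} {i} lf h with ∨-true h
... | inj₁ h' with ∧-true h'
... | p , q with ==ᵛ⇒≡ {u = a} p
... | refl = trans (==ᵛ⇒≡ q) (up≡ v i lf) , cong (_, i) (sym (down≡ v i lf))
joins⇒ {v = v} {a} {b} {i} lf h | inj₂ h' with ∧-true h'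
... | p , q with ==ᵛ⇒≡ {u = b} p | trans (==ᵛ⇒≡ {u = a} q) (up≡ v i lf)
... | refl | refl = sym (flip-flip i v) , trans (cong (_, i) (sym (down≡ v i lf))) (sym (edgeAt-flip v i))

joins-edgeAt : (a : Vert n) (i : Fin n) → joins (edgeAt a i) (a , flip i a) ≡ true
joins-edgeAt a i with lookup a i in e
... | false rewrite down≡ a i e | up≡ a i e = ∨-trueˡ _ (∧-intro (==ᵛ-refl a) (==ᵛ-refl _))
... | true = ∨-trueʳ ((a ==ᵛ (a [ i ]≔ false)) ∧ (flip i a ==ᵛ (a [ i ]≔ false [ i ]≔ true)))
  (∧-intro (trans (cong (flip i a ==ᵛ_) (sym q)) (==ᵛ-refl _)) (trans (cong (a ==ᵛ_) r) (==ᵛ-refl a)))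
  where
  e' : lookup (flip i a) i ≡ false
  e' = trans (lookup-flip i a) (cong not e)
  q : flip i a ≡ a [ i ]≔ false
  q = trans (sym (down≡ _ i e')) (cong proj₁ (edgeAt-flip a i))
  r : a [ i ]≔ false [ i ]≔ true ≡ a
  r = trans (up≡ _ i (lookup-down a i)) (trans (cong (flip i) (sym q)) (flip-flip i a))

-- The local recursion of `cycPairs` with the closing element as an argument, the form that an
-- induction along the list needs.
consec : List A → A → List (A × A)
consec [] x = []
consec (a ∷ []) x = (a , x) ∷ []
consec (a ∷ b ∷ r) x = (a , b) ∷ consec (b ∷ r) x

cycPairs-consec : (x : A) (xs : List A) → cycPairs (x ∷ xs) ≡ consec (x ∷ xs) x
cycPairs-consec x [] = refl
cycPairs-consec x (a ∷ r) = cong ((x , a) ∷_) (rest a r)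
  where
  rest : ∀ a r → drop 1 (cycPairs (x ∷ a ∷ r)) ≡ consec (a ∷ r) x
  rest a [] = refl
  rest a (b ∷ r) = cong ((a , b) ∷_) (rest b r)

consec-map : (f : A → B) (xs : List A) (x : A) →
  consec (map f xs) (f x) ≡ map (λ p → f (proj₁ p) , f (proj₂ p)) (consec xs x)
consec-map f [] x = refl
consec-map f (a ∷ []) x = refl
consec-map f (a ∷ b ∷ r) x = cong (_ ∷_) (consec-map f (b ∷ r) x)

cycPairs-map : (f : A → B) (xs : List A) →
  cycPairs (map f xs) ≡ map (λ p → f (proj₁ p) , f (proj₂ p)) (cycPairs xs)
cycPairs-map f [] = refl
cycPairs-map f (x ∷ xs) rewrite cycPairs-consec (f x) (map f xs) | cycPairs-consec x xs = consec-map f (x ∷ xs) x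

length-cycPairs : (xs : List A) → length (cycPairs xs) ≡ length xs
length-cycPairs [] = refl
length-cycPairs (x ∷ xs) rewrite cycPairs-consec x xs = go x xs
  where
  go : ∀ a r → length (consec (a ∷ r) x) ≡ suc (length r)
  go a [] = refl
  go a (b ∷ r) = cong suc (go b r)

Step : List (Edge n) → Vert n → Vert n → Set
Step S u v = ∃ λ i → v ≡ flip i u × edgeAt u i ∈ S

Step-sym : {S : List (Edge n)} {u v : Vert n} → Step S u v → Step S v u
Step-sym {u = u} (i , refl , h) = i , sym (flip-flip i u) , subst (_∈ _) (sym (edgeAt-flip u i)) h

-- `steps` and `covered` together make S exactly the edge set of the closed walk w. Both carry the
-- flip direction, which the Boolean test `joins` leaves implicit.
record IsCycle (S : List (Edge n)) (w : List (Vert n)) : Set where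
  constructor isCycle
  field
    unique  : Unique w
    steps   : ∀ {a b} → (a , b) ∈ cycPairs w → Step S a b
    covered : ∀ {e} → e ∈ S → ∃[ a ] ∃[ b ] ∃[ i ] ((a , b) ∈ cycPairs w × b ≡ flip i a × e ≡ edgeAt a i)

distinctᵛ⇒ : (w : List (Vert n)) → distinctᵛ w ≡ true → Unique w
distinctᵛ⇒ [] h = []
distinctᵛ⇒ (x ∷ w) h with ∧-true h
... | p , q = ∷-unique (λ x∈ → true≢false (true-any _ x∈ (==ᵛ-refl x)) (not-true p)) (distinctᵛ⇒ w q)

⇒distinctᵛ : (w : List (Vert n)) → Unique w → distinctᵛ w ≡ true
⇒distinctᵛ [] u = refl
⇒distinctᵛ (x ∷ w) u = ∧-intro (cong not (≢true⇒false h)) (⇒distinctᵛ w (unique-tail u))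
  where
  h : ¬ any (x ==ᵛ_) w ≡ true
  h e with any-true (x ==ᵛ_) w e
  ... | y , y∈ , q with ==ᵛ⇒≡ {u = x} q
  ... | refl = unique-head u y∈

module _ {n : ℕ} {S : List (Edge n)} {w : List (Vert n)} (S⊆ : S ⊆ cubeEdges n) where

  isCycleEdges⇒ : isCycleEdges S w ≡ true → IsCycle S w
  isCycleEdges⇒ h with ∧-true {distinctᵛ w} h
  ... | p , h' with ∧-true {all _ (cycPairs w)} h'
  ... | q , r = isCycle (distinctᵛ⇒ w p) st cv
    where
    st : ∀ {a b} → (a , b) ∈ cycPairs w → Step S a b
    st ab∈ with any-true _ S (all-true _ q ab∈)
    ... | (v , i) , e∈ , j with joins⇒ {v = v} (∈-cubeEdges⁻ (⊆-∈ S⊆ e∈)) j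
    ... | x , y = i , x , subst (_∈ S) y e∈
    cv : ∀ {e} → e ∈ S → ∃[ a ] ∃[ b ] ∃[ i ] ((a , b) ∈ cycPairs w × b ≡ flip i a × e ≡ edgeAt a i)
    cv {v , i} e∈ with any-true _ (cycPairs w) (all-true _ r e∈)
    ... | (a , b) , ab∈ , j with joins⇒ {v = v} (∈-cubeEdges⁻ (⊆-∈ S⊆ e∈)) j
    ... | x , y = a , b , i , ab∈ , x , y

⇒isCycleEdges : {S : List (Edge n)} {w : List (Vert n)} → IsCycle S w → isCycleEdges S w ≡ true
⇒isCycleEdges {S = S} {w} c = ∧-intro (⇒distinctᵛ w unique) (∧-intro (true-all _ (cycPairs w) st) (true-all _ S cv))
  where
  open IsCycle c
  st : ∀ {p} → p ∈ cycPairs w → any (λ e → joins e p) S ≡ true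
  st {a , b} h with steps h
  ... | i , refl , e∈ = true-any _ e∈ (joins-edgeAt a i)
  cv : ∀ {e} → e ∈ S → any (λ p → joins e p) (cycPairs w) ≡ true
  cv e∈ with covered e∈
  ... | a , b , i , ab∈ , refl , refl = true-any _ ab∈ (joins-edgeAt a i)

copies⁺ : ∀ {m} {G S : List (Edge n)} {w : List (Vert n)} → S ⊆ G → IsCycle S w → length w ≡ m → S ∈ copies n m G
copies⁺ {n} {S = S} {w} S⊆ c refl = ∈-filterᵇ⁺ _ (∈-subsets⁺ S⊆) (true-any (isCycleEdges S) (∈-tuples⁺ w ∈-allVerts) (⇒isCycleEdges c))

copies⁻ : ∀ {m} {G S : List (Edge n)} → G ⊆ cubeEdges n → S ∈ copies n m G → S ⊆ G × ∃[ w ] (length w ≡ m × IsCycle S w)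
copies⁻ {n} {m} {G} {S} G⊆ h with ∈-filterᵇ⁻ _ (subsets G) h
... | S∈ , q with any-true _ (tuples (allVerts n) m) q | ∈-subsets⁻ G S∈
... | w , w∈ , c | S⊆ = S⊆ , w , ∈-tuples⁻ m w∈ , isCycleEdges⇒ (⊆-trans S⊆ G⊆) c

unique-copies : (n m : ℕ) (G : List (Edge n)) → G ⊆ cubeEdges n → Unique (copies n m G)
unique-copies n m G G⊆ = unique-filterᵇ _ (subsets G) (unique-subsets (unique-⊆ G⊆ (unique-cubeEdges n)))

-- The edges are filtered out of G rather than listed along w, because `copies` only sees sublists
-- of G, in the order of G.
cycleEdges : List (Vert n) → List (Edge n) → List (Edge n)
cycleEdges w G = filterᵇ (λ e → any (joins e) (cycPairs w)) G

cycleEdges-isCycle : {G : List (Edge n)} {w : List (Vert n)} → G ⊆ cubeEdges n → Unique w →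
  (∀ {a b} → (a , b) ∈ cycPairs w → Step G a b) → IsCycle (cycleEdges w G) w
cycleEdges-isCycle {G = G} {w} G⊆ u st = isCycle u st' cv
  where
  st' : ∀ {a b} → (a , b) ∈ cycPairs w → Step (cycleEdges w G) a b
  st' {a} h with st h
  ... | i , refl , e∈ = i , refl , ∈-filterᵇ⁺ _ e∈ (true-any _ h (joins-edgeAt a i))
  cv : ∀ {e} → e ∈ cycleEdges w G → ∃[ a ] ∃[ b ] ∃[ i ] ((a , b) ∈ cycPairs w × b ≡ flip i a × e ≡ edgeAt a i)
  cv {v , i} e∈ with ∈-filterᵇ⁻ _ G e∈
  ... | e∈' , q with any-true _ (cycPairs w) q
  ... | (a , b) , ab∈ , j with joins⇒ {v = v} (∈-cubeEdges⁻ (⊆-∈ G⊆ e∈')) j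
  ... | x , y = a , b , i , ab∈ , x , y

-- Finite sums

∑ : List A → (A → ℕ) → ℕ
∑ [] f = 0
∑ (x ∷ xs) f = f x + ∑ xs f

⟦_⟧ : Bool → ℕ
⟦ true ⟧ = 1
⟦ false ⟧ = 0

⟦⟧≤1 : ∀ b → ⟦ b ⟧ ≤ 1
⟦⟧≤1 true = ≤-refl
⟦⟧≤1 false = z≤n

⟦∧⟧ : ∀ a b → ⟦ a ∧ b ⟧ ≡ ⟦ a ⟧ * ⟦ b ⟧
⟦∧⟧ true b = sym (*-identityˡ ⟦ b ⟧)
⟦∧⟧ false b = refl

∑-cong : (xs : List A) {f g : A → ℕ} → (∀ x → f x ≡ g x) → ∑ xs f ≡ ∑ xs g
∑-cong [] h = refl
∑-cong (x ∷ xs) h = cong₂ _+_ (h x) (∑-cong xs h)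

∑-mono : (xs : List A) {f g : A → ℕ} → (∀ x → f x ≤ g x) → ∑ xs f ≤ ∑ xs g
∑-mono [] h = z≤n
∑-mono (x ∷ xs) h = +-mono-≤ (h x) (∑-mono xs h)

∑-mono-∈ : (xs : List A) {f g : A → ℕ} → (∀ {x} → x ∈ xs → f x ≤ g x) → ∑ xs f ≤ ∑ xs g
∑-mono-∈ [] h = z≤n
∑-mono-∈ (x ∷ xs) h = +-mono-≤ (h (here refl)) (∑-mono-∈ xs (λ y∈ → h (there y∈)))

∑-+ : (xs : List A) (f g : A → ℕ) → ∑ xs (λ x → f x + g x) ≡ ∑ xs f + ∑ xs g
∑-+ [] f g = refl
∑-+ (x ∷ xs) f g rewrite ∑-+ xs f g = lemma (f x) (g x) (∑ xs f) (∑ xs g)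
  where
  lemma : ∀ a b c d → a + b + (c + d) ≡ a + c + (b + d)
  lemma = solve-∀

∑-*ˡ : (xs : List A) (c : ℕ) (f : A → ℕ) → ∑ xs (λ x → c * f x) ≡ c * ∑ xs f
∑-*ˡ [] c f = sym (*-zeroʳ c)
∑-*ˡ (x ∷ xs) c f rewrite ∑-*ˡ xs c f = sym (*-distribˡ-+ c (f x) (∑ xs f))

∑-*ʳ : (xs : List A) (c : ℕ) (f : A → ℕ) → ∑ xs (λ x → f x * c) ≡ ∑ xs f * c
∑-*ʳ [] c f = refl
∑-*ʳ (x ∷ xs) c f rewrite ∑-*ʳ xs c f = sym (*-distribʳ-+ c (f x) (∑ xs f))

∑-const : (xs : List A) (c : ℕ) → ∑ xs (λ _ → c) ≡ length xs * c
∑-const [] c = refl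
∑-const (x ∷ xs) c = cong (c +_) (∑-const xs c)

∑-swap : (xs : List A) (ys : List B) (f : A → B → ℕ) →
  ∑ xs (λ x → ∑ ys (f x)) ≡ ∑ ys (λ y → ∑ xs (λ x → f x y))
∑-swap [] ys f = sym (trans (∑-const ys 0) (*-zeroʳ (length ys)))
∑-swap (x ∷ xs) ys f rewrite ∑-swap xs ys f = sym (∑-+ ys (f x) (λ y → ∑ xs (λ x → f x y)))

∑-product : (xs : List A) (ys : List B) (f : A → ℕ) (g : B → ℕ) →
  ∑ xs f * ∑ ys g ≡ ∑ xs (λ x → ∑ ys (λ y → f x * g y))
∑-product xs ys f g = sym (trans (∑-cong xs (λ x → ∑-*ˡ ys (f x) g)) (∑-*ʳ xs (∑ ys g) f))

∑-member : {xs : List A} {x : A} (f : A → ℕ) → x ∈ xs → f x ≤ ∑ xs f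
∑-member f (here refl) = m≤m+n _ _
∑-member {xs = y ∷ _} f (there h) = m≤n⇒m≤o+n (f y) (∑-member f h)

length-filterᵇ : (p : A → Bool) (xs : List A) → length (filterᵇ p xs) ≡ ∑ xs (λ x → ⟦ p x ⟧)
length-filterᵇ p [] = refl
length-filterᵇ p (x ∷ xs) with p x
... | true = cong suc (length-filterᵇ p xs)
... | false = length-filterᵇ p xs

∑-filterᵇ : (p : A → Bool) (xs : List A) (f : A → ℕ) → ∑ (filterᵇ p xs) f ≡ ∑ xs (λ x → ⟦ p x ⟧ * f x)
∑-filterᵇ p [] f = refl
∑-filterᵇ p (x ∷ xs) f with p x
... | true = cong₂ _+_ (sym (+-identityʳ (f x))) (∑-filterᵇ p xs f)
... | false = ∑-filterᵇ p xs f

∑-map : (g : A → B) (xs : List A) (f : B → ℕ) → ∑ (map g xs) f ≡ ∑ xs (λ x → f (g x))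
∑-map g [] f = refl
∑-map g (x ∷ xs) f = cong (f (g x) +_) (∑-map g xs f)

∑-++ : (xs ys : List A) (f : A → ℕ) → ∑ (xs ++ ys) f ≡ ∑ xs f + ∑ ys f
∑-++ [] ys f = refl
∑-++ (x ∷ xs) ys f rewrite ∑-++ xs ys f = sym (+-assoc (f x) _ _)

∑-concatMap : (g : A → List B) (xs : List A) (f : B → ℕ) → ∑ (concatMap g xs) f ≡ ∑ xs (λ x → ∑ (g x) f)
∑-concatMap g [] f = refl
∑-concatMap g (x ∷ xs) f = trans (∑-++ (g x) (concatMap g xs) f) (cong (∑ (g x) f +_) (∑-concatMap g xs f))

-- The difference of the two sides is k², where k is the distance of a and b; naming k replaces the
-- subtraction.
2ab≤a²+b² : ∀ a b → 2 * (a * b) ≤ a * a + b * b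
2ab≤a²+b² a b with ≤-total a b
... | inj₁ h with m≤n⇒∃[o]m+o≡n h
... | k , refl = subst (2 * (a * (a + k)) ≤_) (lemma a k) (m≤m+n _ (k * k))
  where
  lemma : ∀ a k → 2 * (a * (a + k)) + k * k ≡ a * a + (a + k) * (a + k)
  lemma = solve-∀
2ab≤a²+b² a b | inj₂ h with m≤n⇒∃[o]m+o≡n h
... | k , refl = subst (2 * ((b + k) * b) ≤_) (lemma b k) (m≤m+n _ (k * k))
  where
  lemma : ∀ a k → 2 * ((a + k) * a) + k * k ≡ (a + k) * (a + k) + a * a
  lemma = solve-∀

-- The inequality 2ab ≤ a² + b² is summed over all pairs of entries.
cauchy-schwarz : (xs : List A) (f : A → ℕ) → ∑ xs f * ∑ xs f ≤ length xs * ∑ xs (λ x → f x * f x)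
cauchy-schwarz xs f = *-cancelˡ-≤ 2 (begin
  2 * (∑ xs f * ∑ xs f)                              ≡⟨ cong (2 *_) (∑-product xs xs f f) ⟩
  2 * ∑ xs (λ x → ∑ xs (λ y → f x * f y))            ≡⟨ ∑-*ˡ xs 2 _ ⟨
  ∑ xs (λ x → 2 * ∑ xs (λ y → f x * f y))            ≡⟨ ∑-cong xs (λ x → ∑-*ˡ xs 2 _) ⟨
  ∑ xs (λ x → ∑ xs (λ y → 2 * (f x * f y)))          ≤⟨ ∑-mono xs (λ x → ∑-mono xs (λ y → 2ab≤a²+b² (f x) (f y))) ⟩
  ∑ xs (λ x → ∑ xs (λ y → f x * f x + f y * f y))    ≡⟨ ∑-cong xs (λ x → trans (∑-+ xs _ _) (cong (_+ Q) (∑-const xs _))) ⟩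
  ∑ xs (λ x → length xs * (f x * f x) + Q)           ≡⟨ trans (∑-+ xs _ _) (cong₂ _+_ (∑-*ˡ xs (length xs) _) (∑-const xs Q)) ⟩
  length xs * Q + length xs * Q                      ≡⟨ lemma (length xs * Q) ⟩
  2 * (length xs * Q)                                ∎)
  where
  open ≤-Reasoning
  Q = ∑ xs (λ x → f x * f x)
  lemma : ∀ a → a + a ≡ 2 * a
  lemma = solve-∀

-- The tangent line of d³ at t, with both sides moved so that no subtraction occurs.
cube-tangent : ∀ d t → 3 * (t * t * d) ≤ d * d * d + 2 * (t * t * t)
cube-tangent d t with ≤-total t d
... | inj₁ h with m≤n⇒∃[o]m+o≡n h
... | k , refl = subst (3 * (t * t * (t + k)) ≤_) (lemma t k) (m≤m+n _ (3 * (t * k * k) + k * k * k))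
  where
  lemma : ∀ t k → 3 * (t * t * (t + k)) + (3 * (t * k * k) + k * k * k) ≡ (t + k) * (t + k) * (t + k) + 2 * (t * t * t)
  lemma = solve-∀
cube-tangent d t | inj₂ h with m≤n⇒∃[o]m+o≡n h
... | k , refl = subst (3 * ((d + k) * (d + k) * d) ≤_) (lemma d k) (m≤m+n _ (3 * (d * k * k) + 2 * (k * k * k)))
  where
  lemma : ∀ d k → 3 * ((d + k) * (d + k) * d) + (3 * (d * k * k) + 2 * (k * k * k)) ≡ d * d * d + 2 * ((d + k) * (d + k) * (d + k))
  lemma = solve-∀

∑-allVerts-suc : (n : ℕ) (f : Vert (suc n) → ℕ) →
  ∑ (allVerts (suc n)) f ≡ ∑ (allVerts n) (λ v → f (false ∷ v) + f (true ∷ v))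
∑-allVerts-suc n f = trans (∑-concatMap _ (allVerts n) f)
  (∑-cong (allVerts n) (λ v → cong (f (false ∷ v) +_) (+-identityʳ _)))

∑-flip : {n : ℕ} (i : Fin n) (f : Vert n → ℕ) → ∑ (allVerts n) f ≡ ∑ (allVerts n) (λ v → f (flip i v))
∑-flip {suc n} zero f rewrite ∑-allVerts-suc n f | ∑-allVerts-suc n (λ v → f (flip zero v)) =
  ∑-cong (allVerts n) (λ v → +-comm (f (false ∷ v)) _)
∑-flip {suc n} (suc i) f rewrite ∑-allVerts-suc n f | ∑-allVerts-suc n (λ v → f (flip (suc i) v)) =
  ∑-flip i (λ v → f (false ∷ v) + f (true ∷ v))

length-allVerts : (n : ℕ) → length (allVerts n) ≡ 2 ^ n
length-allVerts n = trans (sym (trans (∑-const (allVerts n) 1) (*-identityʳ _))) (go n)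
  where
  go : ∀ n → ∑ (allVerts n) (λ _ → 1) ≡ 2 ^ n
  go zero = refl
  go (suc n) = trans (∑-allVerts-suc n _) (trans (∑-*ˡ (allVerts n) 2 (λ _ → 1)) (cong (2 *_) (go n)))

length-allFin : (n : ℕ) → length (allFin n) ≡ n
length-allFin n = length-tabulate (λ i → i)

∑F : (n : ℕ) → (Fin n → ℕ) → ℕ
∑F n = ∑ (allFin n)

∑F-const : (n c : ℕ) → ∑F n (λ _ → c) ≡ n * c
∑F-const n c = trans (∑-const (allFin n) c) (cong (_* c) (length-allFin n))

∑F-≤-const : (n : ℕ) {c : ℕ} {f : Fin n → ℕ} → (∀ i → f i ≤ c) → ∑F n f ≤ n * c
∑F-≤-const n {c} h = ≤-trans (∑-mono (allFin n) h) (≤-reflexive (∑F-const n c))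

∑F-cauchy : (n : ℕ) (f : Fin n → ℕ) → ∑F n f * ∑F n f ≤ n * ∑F n (λ i → f i * f i)
∑F-cauchy n f = subst (λ l → ∑F n f * ∑F n f ≤ l * ∑F n (λ i → f i * f i)) (length-allFin n) (cauchy-schwarz (allFin n) f)

∑F-≟ : (n : ℕ) (i : Fin n) → ∑F n (λ j → ⟦ i ==ᶠ j ⟧) ≤ 1
∑F-≟ n i = go (allFin n) (Uniqueₚ.allFin⁺ n)
  where
  none : ∀ xs → i ∉ xs → ∑ xs (λ j → ⟦ i ==ᶠ j ⟧) ≤ 0
  none [] h = z≤n
  none (x ∷ xs) h rewrite ≢true⇒false {i ==ᶠ x} (λ e → h (here (==ᶠ⇒≡ e))) = none xs (λ z → h (there z))
  go : ∀ xs → Unique xs → ∑ xs (λ j → ⟦ i ==ᶠ j ⟧) ≤ 1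
  go [] u = z≤n
  go (x ∷ xs) u with i ==ᶠ x in e
  ... | false = go xs (unique-tail u)
  ... | true with ==ᶠ⇒≡ e
  ... | refl = s≤s (none xs (unique-head u))

-- The counting inequalities below bound squares. Maximality of r turns such a bound into one on the
-- number itself, uniform over all choices; r² ≤ x is what the final elimination uses.
isqrt : ∀ x → ∃ λ r → r * r ≤ x × (∀ y → y * y ≤ x → y ≤ r)
isqrt zero = 0 , z≤n , λ { zero _ → z≤n }
isqrt (suc x) with isqrt x
... | r , r² , max with suc r * suc r ≤? suc x
... | no h = r , m≤n⇒m≤1+n r² , λ y y² → ≮⇒≥ (λ lt → h (≤-trans (*-mono-≤ lt lt) y²))
... | yes h = suc r , h , λ y y² → ≮⇒≥ (λ lt → 1+n≰n (max (suc r) (≤-pred (≤-trans (*-mono-< lt lt) y²))))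

-- Triples, links and dependent random choice

∑³ : (n : ℕ) → (Fin n → Fin n → Fin n → ℕ) → ℕ
∑³ n f = ∑F n (λ x → ∑F n (λ y → ∑F n (f x y)))

∑³-+ : (n : ℕ) (f g : Fin n → Fin n → Fin n → ℕ) → ∑³ n (λ x y z → f x y z + g x y z) ≡ ∑³ n f + ∑³ n g
∑³-+ n f g = trans (∑-cong F (λ x → trans (∑-cong F (λ y → ∑-+ F _ _)) (∑-+ F _ _))) (∑-+ F _ _)
  where F = allFin n

∑³-mono : (n : ℕ) {f g : Fin n → Fin n → Fin n → ℕ} → (∀ x y z → f x y z ≤ g x y z) → ∑³ n f ≤ ∑³ n g
∑³-mono n h = ∑-mono F (λ x → ∑-mono F (λ y → ∑-mono F (h x y)))
  where F = allFin n

∑-∑³-swap : {A : Set} (xs : List A) (n : ℕ) (f : A → Fin n → Fin n → Fin n → ℕ) →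
  ∑ xs (λ a → ∑³ n (f a)) ≡ ∑³ n (λ x y z → ∑ xs (λ a → f a x y z))
∑-∑³-swap xs n f = trans (∑-swap xs F _) (∑-cong F (λ x → trans (∑-swap xs F _) (∑-cong F (λ y → ∑-swap xs F _))))
  where F = allFin n

distinct₃ : {n : ℕ} → Fin n → Fin n → Fin n → Bool
distinct₃ x y z = not (x ==ᶠ y) ∧ not (y ==ᶠ z) ∧ not (x ==ᶠ z)

module _ {n : ℕ} (D : Vert n → Fin n → Bool) where

  starAt : Vert n → Fin n → Fin n → Fin n → Bool
  starAt v x y z = distinct₃ x y z ∧ (D v x ∧ D v y ∧ D v z)

  -- Indexed by the bottom vertex b, with top b + xyz: stars over the same b share vertices of the
  -- form b + xy and can be strung together to walks.
  starAbove : Vert n → Fin n → Fin n → Fin n → Bool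
  starAbove b x y z = starAt (flip x (flip y (flip z b))) x y z

  downDegree : Vert n → ℕ
  downDegree v = ∑F n (λ i → ⟦ D v i ⟧)

  starCount : Vert n → ℕ
  starCount b = ∑³ n (λ x y z → ⟦ starAbove b x y z ⟧)

  private
    F = allFin n

  -- For a fixed triple the map from b to b + xyz permutes the vertices, so stars may be counted by
  -- their bottom instead of their top.
  ∑-starAt : ∑ (allVerts n) (λ v → ∑³ n (λ x y z → ⟦ starAt v x y z ⟧)) ≡ ∑ (allVerts n) starCount
  ∑-starAt = begin
    ∑ V (λ v → ∑³ n (λ x y z → ⟦ starAt v x y z ⟧))    ≡⟨ ∑-∑³-swap V n _ ⟩
    ∑³ n (λ x y z → ∑ V (λ v → ⟦ starAt v x y z ⟧))    ≡⟨ ∑-cong F (λ x → ∑-cong F (λ y → ∑-cong F (λ z → shift x y z))) ⟩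
    ∑³ n (λ x y z → ∑ V (λ v → ⟦ starAbove v x y z ⟧)) ≡⟨ ∑-∑³-swap V n _ ⟨
    ∑ V starCount                                      ∎
    where
    open ≡-Reasoning
    V = allVerts n
    shift : ∀ x y z → ∑ V (λ v → ⟦ starAt v x y z ⟧) ≡ ∑ V (λ v → ⟦ starAbove v x y z ⟧)
    shift x y z = trans (∑-flip x _) (trans (∑-flip y (λ v → ⟦ starAt (flip x v) x y z ⟧)) (∑-flip z (λ v → ⟦ starAt (flip x (flip y v)) x y z ⟧)))

  coincidences : ∑³ n (λ x y z → ⟦ x ==ᶠ y ⟧ + (⟦ y ==ᶠ z ⟧ + ⟦ x ==ᶠ z ⟧)) ≤ 3 * (n * n)
  coincidences = begin
    ∑³ n (λ x y z → ⟦ x ==ᶠ y ⟧ + (⟦ y ==ᶠ z ⟧ + ⟦ x ==ᶠ z ⟧))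
      ≡⟨ trans (∑³-+ n _ _) (cong (∑³ n (λ x y z → ⟦ x ==ᶠ y ⟧) +_) (∑³-+ n _ _)) ⟩
    ∑³ n (λ x y z → ⟦ x ==ᶠ y ⟧) + (∑³ n (λ x y z → ⟦ y ==ᶠ z ⟧) + ∑³ n (λ x y z → ⟦ x ==ᶠ z ⟧))
      ≤⟨ +-mono-≤ xy (+-mono-≤ yz xz) ⟩
    n * n + (n * n + n * n)
      ≡⟨ lemma (n * n) ⟩
    3 * (n * n) ∎
    where
    open ≤-Reasoning
    lemma : ∀ a → a + (a + a) ≡ 3 * a
    lemma = solve-∀
    1*n : n * 1 ≡ n
    1*n = *-identityʳ n
    xy : ∑³ n (λ x y z → ⟦ x ==ᶠ y ⟧) ≤ n * n
    xy = ∑F-≤-const n λ x → begin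
      ∑F n (λ y → ∑F n (λ z → ⟦ x ==ᶠ y ⟧)) ≡⟨ ∑-cong F (λ y → ∑F-const n _) ⟩
      ∑F n (λ y → n * ⟦ x ==ᶠ y ⟧)          ≡⟨ ∑-*ˡ F n _ ⟩
      n * ∑F n (λ y → ⟦ x ==ᶠ y ⟧)          ≤⟨ *-monoʳ-≤ n (∑F-≟ n x) ⟩
      n * 1                                 ≡⟨ 1*n ⟩
      n                                     ∎
    yz : ∑³ n (λ x y z → ⟦ y ==ᶠ z ⟧) ≤ n * n
    yz = ∑F-≤-const n λ x → ≤-trans (∑F-≤-const n (λ y → ∑F-≟ n y)) (≤-reflexive 1*n)
    xz : ∑³ n (λ x y z → ⟦ x ==ᶠ z ⟧) ≤ n * n
    xz = ∑F-≤-const n λ x → ≤-trans (∑F-≤-const n (λ y → ∑F-≟ n x)) (≤-reflexive 1*n)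

  -- The cube expands into ordered triples of down directions at v. Those without repetition are
  -- stars, the others are charged to the three coincidence terms.
  cube-degree : ∀ v → downDegree v * downDegree v * downDegree v ≤
                      ∑³ n (λ x y z → ⟦ starAt v x y z ⟧) + 3 * (n * n)
  cube-degree v = begin
    Σd * Σd * Σd ≡⟨ cong (_* Σd) (∑-product F F _ _) ⟩
    ∑F n (λ x → ∑F n (λ y → ⟦ D v x ⟧ * ⟦ D v y ⟧)) * Σd ≡⟨ ∑-product F F _ _ ⟩
    ∑F n (λ x → ∑F n (λ z → ∑F n (λ y → ⟦ D v x ⟧ * ⟦ D v y ⟧) * ⟦ D v z ⟧))
      ≡⟨ ∑-cong F (λ x → trans (∑-*ˡ F (∑F n (λ y → ⟦ D v x ⟧ * ⟦ D v y ⟧)) δ) (∑-product F F (λ y → ⟦ D v x ⟧ * ⟦ D v y ⟧) δ)) ⟩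
    ∑³ n (λ x y z → ⟦ D v x ⟧ * ⟦ D v y ⟧ * ⟦ D v z ⟧)
      ≤⟨ ∑³-mono n (λ x y z → split (x ==ᶠ y) (y ==ᶠ z) (x ==ᶠ z) (D v x) (D v y) (D v z)) ⟩
    ∑³ n (λ x y z → ⟦ starAt v x y z ⟧ + (⟦ x ==ᶠ y ⟧ + (⟦ y ==ᶠ z ⟧ + ⟦ x ==ᶠ z ⟧))) ≡⟨ ∑³-+ n _ _ ⟩
    ∑³ n (λ x y z → ⟦ starAt v x y z ⟧) + ∑³ n (λ x y z → ⟦ x ==ᶠ y ⟧ + (⟦ y ==ᶠ z ⟧ + ⟦ x ==ᶠ z ⟧))
      ≤⟨ +-monoʳ-≤ _ coincidences ⟩
    ∑³ n (λ x y z → ⟦ starAt v x y z ⟧) + 3 * (n * n) ∎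
    where
    open ≤-Reasoning
    Σd = downDegree v
    δ : Fin n → ℕ
    δ i = ⟦ D v i ⟧
    split : ∀ a b c p q r → ⟦ p ⟧ * ⟦ q ⟧ * ⟦ r ⟧ ≤
      ⟦ (not a ∧ not b ∧ not c) ∧ (p ∧ q ∧ r) ⟧ + (⟦ a ⟧ + (⟦ b ⟧ + ⟦ c ⟧))
    split a b c false q r = z≤n
    split a b c true false r = z≤n
    split a b c true true false = z≤n
    split true b c true true true = s≤s z≤n
    split false true c true true true = s≤s z≤n
    split false false true true true true = s≤s z≤n
    split false false false true true true = s≤s z≤n

  -- Jensen's inequality for the cube: the tangent at t is summed over all vertices, where t is at
  -- most the mean down degree. The term 2t³ stays on both sides until it is cancelled.
  degree-bound : ∀ {t h} → t * 2 ^ n ≤ ∑ (allVerts n) downDegree → (∀ b → starCount b ≤ h) →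
                 t * t * t ≤ h + 3 * (n * n)
  degree-bound {t} {h} avg hb = *-cancelʳ-≤ (t * t * t) (h + 3 * (n * n)) (2 ^ n) {{m^n≢0 2 n}}
    (+-cancelʳ-≤ (2 * (t * t * t) * 2 ^ n) _ _ (begin
      t * t * t * 2 ^ n + 2 * (t * t * t) * 2 ^ n   ≡⟨ lemma t (2 ^ n) ⟩
      3 * (t * t) * (t * 2 ^ n)                       ≤⟨ *-monoʳ-≤ (3 * (t * t)) avg ⟩
      3 * (t * t) * ∑ V downDegree                    ≡⟨ ∑-*ˡ V (3 * (t * t)) downDegree ⟨
      ∑ V (λ v → 3 * (t * t) * downDegree v)          ≤⟨ ∑-mono V point ⟩
      ∑ V (λ v → (stars v + 3 * (n * n)) + 2 * (t * t * t)) ≡⟨ trans (∑-+ V _ _) (cong₂ _+_ (∑-+ V stars _) (vconst _)) ⟩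
      (∑ V stars + ∑ V (λ _ → 3 * (n * n))) + 2 ^ n * (2 * (t * t * t))
        ≤⟨ +-monoˡ-≤ _ (+-mono-≤ (≤-trans (≤-reflexive ∑-starAt) (≤-trans (∑-mono V hb) (≤-reflexive (vconst h)))) (≤-reflexive (vconst _))) ⟩
      (2 ^ n * h + 2 ^ n * (3 * (n * n))) + 2 ^ n * (2 * (t * t * t)) ≡⟨ lemma₂ (2 ^ n) h (3 * (n * n)) (2 * (t * t * t)) ⟩
      (h + 3 * (n * n)) * 2 ^ n + 2 * (t * t * t) * 2 ^ n ∎))
    where
    open ≤-Reasoning
    V = allVerts n
    stars : Vert n → ℕ
    stars v = ∑³ n (λ x y z → ⟦ starAt v x y z ⟧)
    vconst : ∀ c → ∑ V (λ _ → c) ≡ 2 ^ n * c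
    vconst c = trans (∑-const V c) (cong (_* c) (length-allVerts n))
    lemma : ∀ t p → t * t * t * p + 2 * (t * t * t) * p ≡ 3 * (t * t) * (t * p)
    lemma = solve-∀
    lemma₂ : ∀ p a b c → (p * a + p * b) + p * c ≡ (a + b) * p + c * p
    lemma₂ = solve-∀
    point : ∀ v → 3 * (t * t) * downDegree v ≤ (stars v + 3 * (n * n)) + 2 * (t * t * t)
    point v = begin
      3 * (t * t) * downDegree v   ≡⟨ *-assoc 3 (t * t) (downDegree v) ⟩
      3 * (t * t * downDegree v)   ≤⟨ cube-tangent (downDegree v) t ⟩
      downDegree v * downDegree v * downDegree v + 2 * (t * t * t) ≤⟨ +-monoˡ-≤ _ (cube-degree v) ⟩
      (stars v + 3 * (n * n)) + 2 * (t * t * t) ∎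

module _ {n : ℕ} (H : Fin n → Fin n → Fin n → Bool) where

  private
    F = allFin n

  linkCount : Fin n → Fin n → ℕ
  linkCount z z' = ∑F n (λ x → ∑F n (λ y → ⟦ H x y z ⟧ * ⟦ H x y z' ⟧))

  -- Cauchy-Schwarz over x and over y bounds h² by n² times the sum of the squared degrees of the
  -- pairs xy. Expanding each square into pairs z, z' turns that sum into the total of all link
  -- counts; the n diagonal terms contribute at most n² each.
  link-bound : ∀ {l} → (∀ z z' → z ≢ z' → linkCount z z' ≤ l) →
    ∑³ n (λ x y z → ⟦ H x y z ⟧) * ∑³ n (λ x y z → ⟦ H x y z ⟧) ≤ n * n * (n * n * l + n * n * n)
  link-bound {l} hl = begin
    h * h                                                 ≤⟨ ∑F-cauchy n _ ⟩
    n * ∑F n (λ x → deg₁ x * deg₁ x)                      ≤⟨ *-monoʳ-≤ n (∑-mono F (λ x → ∑F-cauchy n (deg₂ x))) ⟩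
    n * ∑F n (λ x → n * ∑F n (λ y → deg₂ x y * deg₂ x y)) ≡⟨ cong (n *_) (∑-*ˡ F n _) ⟩
    n * (n * ∑F n (λ x → ∑F n (λ y → deg₂ x y * deg₂ x y))) ≡⟨ *-assoc n n _ ⟨
    n * n * ∑F n (λ x → ∑F n (λ y → deg₂ x y * deg₂ x y)) ≡⟨ cong (n * n *_) rearrange ⟩
    n * n * ∑F n (λ z → ∑F n (λ z' → linkCount z z'))     ≤⟨ *-monoʳ-≤ (n * n) (∑-mono F (λ z → ∑-mono F (point z))) ⟩
    n * n * ∑F n (λ z → ∑F n (λ z' → l + n * n * ⟦ z ==ᶠ z' ⟧)) ≤⟨ *-monoʳ-≤ (n * n) (∑F-≤-const n inner) ⟩
    n * n * (n * (n * l + n * n))                         ≡⟨ cong (n * n *_) (lemma n l) ⟩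
    n * n * (n * n * l + n * n * n)                       ∎
    where
    open ≤-Reasoning
    h = ∑³ n (λ x y z → ⟦ H x y z ⟧)
    deg₂ : Fin n → Fin n → ℕ
    deg₂ x y = ∑F n (λ z → ⟦ H x y z ⟧)
    deg₁ : Fin n → ℕ
    deg₁ x = ∑F n (deg₂ x)
    lemma : ∀ n l → n * (n * l + n * n) ≡ n * n * l + n * n * n
    lemma = solve-∀
    rearrange : ∑F n (λ x → ∑F n (λ y → deg₂ x y * deg₂ x y)) ≡ ∑F n (λ z → ∑F n (λ z' → linkCount z z'))
    rearrange = begin-equality
      ∑F n (λ x → ∑F n (λ y → deg₂ x y * deg₂ x y))
        ≡⟨ ∑-cong F (λ x → ∑-cong F (λ y → ∑-product F F _ _)) ⟩
      ∑F n (λ x → ∑F n (λ y → ∑F n (λ z → ∑F n (λ z' → ⟦ H x y z ⟧ * ⟦ H x y z' ⟧))))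
        ≡⟨ ∑-cong F (λ x → trans (∑-swap F F _) (∑-cong F (λ z → ∑-swap F F _))) ⟩
      ∑F n (λ x → ∑F n (λ z → ∑F n (λ z' → ∑F n (λ y → ⟦ H x y z ⟧ * ⟦ H x y z' ⟧))))
        ≡⟨ trans (∑-swap F F _) (∑-cong F (λ z → ∑-swap F F _)) ⟩
      ∑F n (λ z → ∑F n (λ z' → linkCount z z')) ∎
    inner : ∀ z → ∑F n (λ z' → l + n * n * ⟦ z ==ᶠ z' ⟧) ≤ n * l + n * n
    inner z = begin
      ∑F n (λ z' → l + n * n * ⟦ z ==ᶠ z' ⟧) ≡⟨ trans (∑-+ F _ _) (cong₂ _+_ (∑F-const n l) (∑-*ˡ F (n * n) _)) ⟩
      n * l + n * n * ∑F n (λ z' → ⟦ z ==ᶠ z' ⟧) ≤⟨ +-monoʳ-≤ (n * l) (*-monoʳ-≤ (n * n) (∑F-≟ n z)) ⟩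
      n * l + n * n * 1 ≡⟨ cong (n * l +_) (*-identityʳ (n * n)) ⟩
      n * l + n * n ∎
    point : ∀ z z' → linkCount z z' ≤ l + n * n * ⟦ z ==ᶠ z' ⟧
    point z z' with z ==ᶠ z' in e
    ... | false = ≤-trans (hl z z' (λ { refl → true≢false (==ᶠ-refl z) e })) (m≤m+n l _)
    ... | true = m≤n⇒m≤o+n l (begin
      linkCount z z' ≤⟨ ∑F-≤-const n (λ x → ∑F-≤-const n (λ y → *-mono-≤ (⟦⟧≤1 (H x y z)) (⟦⟧≤1 (H x y z')))) ⟩
      n * (n * 1)    ≡⟨ *-assoc n n 1 ⟨
      n * n * 1      ∎)

-- Dependent random choice: U p q is what remains of the common neighbourhood of p and q
-- after deleting every vertex that lies in a pair of small codegree.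
module _ {n : ℕ} (L : Fin n → Fin n → Bool) (K : ℕ) where

  private
    F = allFin n

  codegree : Fin n → Fin n → ℕ
  codegree u u' = ∑F n (λ p → ⟦ L u p ⟧ * ⟦ L u' p ⟧)

  sparse : Fin n → Fin n → Bool
  sparse u u' = not (u ==ᶠ u') ∧ (codegree u u' <ᵇ K)

  U : Fin n → Fin n → Fin n → Bool
  U p q u = (L u p ∧ L u q) ∧ all (λ u' → not ((L u' p ∧ L u' q) ∧ sparse u u')) F

  -- The squared degrees in L add up to the sizes of the common neighbourhoods of all p, q. A sparse
  -- pair survives for at most K² of the n² choices of p, q, and there are at most n² such pairs, so
  -- deletion costs at most K² on average. With a single source p the pair would survive for up to K
  -- of only n choices, and the average cost could reach nK.
  U-bound : ∀ {m} → (∀ p q → ∑F n (λ u → ⟦ U p q u ⟧) ≤ m) →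
    ∑F n (λ u → ∑F n (λ p → ⟦ L u p ⟧)) * ∑F n (λ u → ∑F n (λ p → ⟦ L u p ⟧)) ≤ n * (n * n * (m + K * K))
  U-bound {m} hm = begin
    l * l ≤⟨ ∑F-cauchy n _ ⟩
    n * ∑F n (λ u → deg u * deg u) ≡⟨ cong (n *_) (∑-cong F (λ u → ∑-product F F _ _)) ⟩
    n * ∑F n (λ u → ∑F n (λ p → ∑F n (λ q → ⟦ L u p ⟧ * ⟦ L u q ⟧)))
      ≤⟨ *-monoʳ-≤ n (∑³-mono n (λ u p q → point p q u)) ⟩
    n * ∑³ n (λ u p q → ⟦ U p q u ⟧ + ∑F n (λ u' → ⟦ L u p ⟧ * ⟦ L u' p ⟧ * (⟦ L u q ⟧ * ⟦ L u' q ⟧) * ⟦ sparse u u' ⟧))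
      ≡⟨ cong (n *_) (∑³-+ n _ _) ⟩
    n * (∑³ n (λ u p q → ⟦ U p q u ⟧) + ∑³ n (λ u p q → ∑F n (λ u' → ⟦ L u p ⟧ * ⟦ L u' p ⟧ * (⟦ L u q ⟧ * ⟦ L u' q ⟧) * ⟦ sparse u u' ⟧)))
      ≤⟨ *-monoʳ-≤ n (+-mono-≤ remaining deleted) ⟩
    n * (n * (n * m) + n * (n * (K * K))) ≡⟨ cong (n *_) (lemma n m (K * K)) ⟩
    n * (n * n * (m + K * K)) ∎
    where
    open ≤-Reasoning
    deg : Fin n → ℕ
    deg u = ∑F n (λ p → ⟦ L u p ⟧)
    l = ∑F n deg
    lemma : ∀ n m k → n * (n * m) + n * (n * k) ≡ n * n * (m + k)
    lemma = solve-∀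
    remaining : ∑³ n (λ u p q → ⟦ U p q u ⟧) ≤ n * (n * m)
    remaining = begin
      ∑³ n (λ u p q → ⟦ U p q u ⟧) ≡⟨ trans (∑-swap F F _) (∑-cong F (λ p → ∑-swap F F _)) ⟩
      ∑³ n (λ p q u → ⟦ U p q u ⟧) ≤⟨ ∑F-≤-const n (λ p → ∑F-≤-const n (hm p)) ⟩
      n * (n * m) ∎
    deleted : ∑³ n (λ u p q → ∑F n (λ u' → ⟦ L u p ⟧ * ⟦ L u' p ⟧ * (⟦ L u q ⟧ * ⟦ L u' q ⟧) * ⟦ sparse u u' ⟧)) ≤ n * (n * (K * K))
    deleted = ∑F-≤-const n λ u → begin
      ∑F n (λ p → ∑F n (λ q → ∑F n (λ u' → f u u' p q * s u u'))) ≡⟨ ∑-cong F (λ p → ∑-swap F F _) ⟩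
      ∑F n (λ p → ∑F n (λ u' → ∑F n (λ q → f u u' p q * s u u'))) ≡⟨ ∑-swap F F _ ⟩
      ∑F n (λ u' → ∑F n (λ p → ∑F n (λ q → f u u' p q * s u u'))) ≤⟨ ∑F-≤-const n (few u) ⟩
      n * (K * K) ∎
      where
      f : Fin n → Fin n → Fin n → Fin n → ℕ
      f u u' p q = ⟦ L u p ⟧ * ⟦ L u' p ⟧ * (⟦ L u q ⟧ * ⟦ L u' q ⟧)
      s : Fin n → Fin n → ℕ
      s u u' = ⟦ sparse u u' ⟧
      few : ∀ u u' → ∑F n (λ p → ∑F n (λ q → f u u' p q * s u u')) ≤ K * K
      few u u' = begin
        ∑F n (λ p → ∑F n (λ q → f u u' p q * s u u')) ≡⟨ trans (∑-cong F (λ p → ∑-*ʳ F _ _)) (∑-*ʳ F _ _) ⟩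
        ∑F n (λ p → ∑F n (λ q → f u u' p q)) * s u u' ≡⟨ cong (_* s u u') (∑-product F F _ _) ⟨
        codegree u u' * codegree u u' * s u u' ≤⟨ small ⟩
        K * K ∎
        where
        small : codegree u u' * codegree u u' * s u u' ≤ K * K
        small with sparse u u' in e
        ... | false = ≤-trans (≤-reflexive (*-zeroʳ (codegree u u' * codegree u u'))) z≤n
        ... | true = ≤-trans (≤-reflexive (*-identityʳ _)) (*-mono-≤ c≤K c≤K)
          where
          c≤K : codegree u u' ≤ K
          c≤K = <⇒≤ (<ᵇ⇒< _ _ (subst T (sym (proj₂ (∧-true {not (u ==ᶠ u')} e))) _))
    -- A common neighbour of p and q outside `U` has a sparse partner u', and the summand of u' is
    -- 1.
    point : ∀ p q u → ⟦ L u p ⟧ * ⟦ L u q ⟧ ≤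
      ⟦ U p q u ⟧ + ∑F n (λ u' → ⟦ L u p ⟧ * ⟦ L u' p ⟧ * (⟦ L u q ⟧ * ⟦ L u' q ⟧) * ⟦ sparse u u' ⟧)
    point p q u with L u p | L u q
    ... | false | _ = z≤n
    ... | true | false = z≤n
    ... | true | true with all (λ u' → not ((L u' p ∧ L u' q) ∧ sparse u u')) F in e
    ...   | true = s≤s z≤n
    ...   | false with exists-false F e
      where
      exists-false : ∀ xs → all (λ u' → not ((L u' p ∧ L u' q) ∧ sparse u u')) xs ≡ false →
        ∃ λ u' → u' ∈ xs × (L u' p ∧ L u' q) ∧ sparse u u' ≡ true
      exists-false (x ∷ xs) e with (L x p ∧ L x q) ∧ sparse u x in e'
      ... | true = x , here refl , e'
      ... | false with exists-false xs e
      ... | u' , u'∈ , h = u' , there u'∈ , h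
    ... | u' , u'∈ , h with ∧-true {L u' p ∧ L u' q} h
    ... | h₁ , h₂ with ∧-true {L u' p} h₁
    ... | a , b = ≤-trans (≤-reflexive (sym val)) (∑-member (λ u' → 1 * ⟦ L u' p ⟧ * (1 * ⟦ L u' q ⟧) * ⟦ sparse u u' ⟧) u'∈)
      where
      val : 1 * ⟦ L u' p ⟧ * (1 * ⟦ L u' q ⟧) * ⟦ sparse u u' ⟧ ≡ 1
      val rewrite a | b | h₂ = refl

-- Closed walks above b

Chain : (A → A → Set) → List A → A → Set
Chain R [] x = ⊤
Chain R (a ∷ []) x = R a x
Chain R (a ∷ b ∷ r) x = R a b × Chain R (b ∷ r) x

Chain⇒consec : {R : A → A → Set} (l : List A) {x a b : A} → Chain R l x → (a , b) ∈ consec l x → R a b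
Chain⇒consec (a ∷ []) c (here refl) = c
Chain⇒consec (a ∷ b ∷ r) (c , cs) (here refl) = c
Chain⇒consec (a ∷ b ∷ r) (c , cs) (there h) = Chain⇒consec (b ∷ r) cs h

Chain⇒cycPairs : {R : A → A → Set} (x : A) (l : List A) {a b : A} → Chain R (x ∷ l) x → (a , b) ∈ cycPairs (x ∷ l) → R a b
Chain⇒cycPairs x l c h = Chain⇒consec (x ∷ l) c (subst (_ ∈_) (cycPairs-consec x l) h)

disagree : (i : Fin n) {u v : Vert n} → lookup u i ≡ true → lookup v i ≡ false → u ≢ v
disagree i p q refl = true≢false p q

flipBy : {m : ℕ} → Vec Bool m → Vec (Fin n) m → Vert n → Vert n
flipBy [] [] b = b
flipBy (true ∷ s) (c ∷ cs) b = flip c (flipBy s cs b)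
flipBy (false ∷ s) (c ∷ cs) b = flipBy s cs b

lookup-flipBy : {m : ℕ} (s : Vec Bool m) (cs : Vec (Fin n) m) (b : Vert n) {i : Fin n} →
  i ∉ Vec.toList cs → lookup (flipBy s cs b) i ≡ lookup b i
lookup-flipBy [] [] b h = refl
lookup-flipBy (true ∷ s) (c ∷ cs) b h =
  trans (lookup-flip-≢ c _ _ (λ e → h (here e))) (lookup-flipBy s cs b (λ z → h (there z)))
lookup-flipBy (false ∷ s) (c ∷ cs) b h = lookup-flipBy s cs b (λ z → h (there z))

not-≢ : ∀ b → b ≢ not b
not-≢ true ()
not-≢ false ()

-- Distinctness of finitely many explicit vertices above b reduces to that of their Boolean codes,
-- which is decided by evaluation.
flipBy-injective : {m : ℕ} {s t : Vec Bool m} (cs : Vec (Fin n) m) (b : Vert n) → Unique (Vec.toList cs) →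
  flipBy s cs b ≡ flipBy t cs b → s ≡ t
flipBy-injective {s = []} {[]} [] b u e = refl
flipBy-injective {s = true ∷ s} {true ∷ t} (c ∷ cs) b u e =
  cong (true ∷_) (flipBy-injective cs b (unique-tail u)
    (trans (sym (flip-flip c _)) (trans (cong (flip c) e) (flip-flip c _))))
flipBy-injective {s = false ∷ s} {false ∷ t} (c ∷ cs) b u e = cong (false ∷_) (flipBy-injective cs b (unique-tail u) e)
flipBy-injective {s = true ∷ s} {false ∷ t} (c ∷ cs) b u e = ⊥-elim (not-≢ (lookup b c) (trans
  (sym (lookup-flipBy t cs b (unique-head u))) (trans (cong (λ v → lookup v c) (sym e))
  (trans (lookup-flip c _) (cong not (lookup-flipBy s cs b (unique-head u)))))))
flipBy-injective {s = false ∷ s} {true ∷ t} (c ∷ cs) b u e = ⊥-elim (not-≢ (lookup b c) (trans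
  (sym (lookup-flipBy s cs b (unique-head u))) (trans (cong (λ v → lookup v c) e)
  (trans (lookup-flip c _) (cong not (lookup-flipBy t cs b (unique-head u)))))))

downEdge : List (Edge n) → Vert n → Fin n → Bool
downEdge G v i = lookup v i ∧ (edgeAt v i ∈ᵉ G)

module CycleInStars {n : ℕ} (G : List (Edge n)) (b : Vert n) where

  two : Fin n → Fin n → Vert n
  two y z = flip y (flip z b)

  three : Fin n → Fin n → Fin n → Vert n
  three x y z = flip x (two y z)

  record Star (x y z : Fin n) : Set where
    constructor star
    field
      x≢y : x ≢ y
      y≢z : y ≢ z
      x≢z : x ≢ z
      bx : lookup b x ≡ false
      by : lookup b y ≡ false
      bz : lookup b z ≡ false
      eˣ : edgeAt (three x y z) x ∈ G
      eʸ : edgeAt (three x y z) y ∈ G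
      eᶻ : edgeAt (three x y z) z ∈ G
  open Star

  Star-swap : ∀ {x y z} → Star x y z → Star y x z
  Star-swap {x} {y} {z} s = star (λ e → x≢y s (sym e)) (x≢z s) (y≢z s) (by s) (bx s) (bz s)
    (tr y (eʸ s)) (tr x (eˣ s)) (tr z (eᶻ s))
    where
    tr : ∀ i → edgeAt (three x y z) i ∈ G → edgeAt (three y x z) i ∈ G
    tr i = subst (λ v → edgeAt v i ∈ G) (flip-comm x y _)

  step-yz : ∀ {x y z} → Star x y z → Step G (three x y z) (two y z)
  step-yz {x} s = x , sym (flip-flip x _) , eˣ s

  step-xz : ∀ {x y z} → Star x y z → Step G (three x y z) (two x z)
  step-xz {x} {y} {z} s = y , trans (cong (flip x) (sym (flip-flip y _))) (flip-comm x y _) , eʸ s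

  step-xy : ∀ {x y z} → Star x y z → Step G (three x y z) (two x y)
  step-xy {x} {y} {z} s = z , trans (cong (λ v → flip x (flip y v)) (sym (flip-flip z b)))
    (trans (cong (flip x) (flip-comm y z _)) (flip-comm x z _)) , eᶻ s

  -- An edge going down in direction x from b + xyz needs a 1 at x there, so b has a 0 at x;
  -- likewise for y and z. These zeros later separate the vertices of a walk.
  starAbove⇒Star : ∀ {x y z} → starAbove (downEdge G) b x y z ≡ true → Star x y z
  starAbove⇒Star {x} {y} {z} h with ∧-true {distinct₃ x y z} h
  ... | d₃ , e with ∧-true {not (x ==ᶠ y)} d₃ | ∧-true {downEdge G (three x y z) x} e
  ... | a , d₂ | ex' , e' with ∧-true {not (y ==ᶠ z)} d₂ | ∧-true {downEdge G (three x y z) y} e'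
  ... | a₂ , a₃ | ey' , ez' with ∧-true {lookup (three x y z) x} ex' | ∧-true {lookup (three x y z) y} ey' | ∧-true {lookup (three x y z) z} ez'
  ... | lx , gx | ly , gy | lz , gz = star x≢y' y≢z' x≢z'
      (not-true (trans (sym (trans (lookup-flip x _) (cong not (trans (lookup-flip-≢ y x _ x≢y') (lookup-flip-≢ z x _ x≢z'))))) lx))
      (not-true (trans (sym (trans (lookup-flip-≢ x y _ (λ e → x≢y' (sym e))) (trans (lookup-flip y _) (cong not (lookup-flip-≢ z y _ y≢z'))))) ly))
      (not-true (trans (sym (trans (lookup-flip-≢ x z _ (λ e → x≢z' (sym e))) (trans (lookup-flip-≢ y z _ (λ e → y≢z' (sym e))) (lookup-flip z _)))) lz))
      (∈ᵉ⇒∈ G gx) (∈ᵉ⇒∈ G gy) (∈ᵉ⇒∈ G gz)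
    where
    apart : ∀ {i j : Fin n} → not (i ==ᶠ j) ≡ true → i ≢ j
    apart {i} q refl = true≢false (==ᶠ-refl i) (not-true q)
    x≢y' = apart a
    y≢z' = apart a₂
    x≢z' = apart a₃

  -- The walk {s₀,s₁,z}, {s₁,z}, {s₁,s₂,z}, {s₂,z}, … above b along s₀, s₁, …, p.
  walk : Fin n → List (Fin n) → Fin n → List (Vert n)
  walk z [] p = []
  walk z (s ∷ []) p = three s p z ∷ two p z ∷ []
  walk z (s ∷ s' ∷ r) p = three s s' z ∷ two s' z ∷ walk z (s' ∷ r) p

  length-walk : ∀ z l p → length (walk z l p) ≡ 2 * length l
  length-walk z [] p = refl
  length-walk z (s ∷ []) p = refl
  length-walk z (s ∷ s' ∷ r) p rewrite length-walk z (s' ∷ r) p = lemma (length r)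
    where
    lemma : ∀ a → suc (suc (2 * suc a)) ≡ 2 * suc (suc a)
    lemma = solve-∀

  walk-chain : ∀ z s r p c → Chain (λ s s' → Star s s' z) (s ∷ r) p → Step G (two p z) c →
    Chain (Step G) (two s z ∷ walk z (s ∷ r) p) c
  walk-chain z s [] p c st e = Step-sym (step-xz st) , step-yz st , e
  walk-chain z s (s' ∷ r) p c (st , ch) e = Step-sym (step-xz st) , step-yz st , walk-chain z s' r p c ch e

  two-off : ∀ {i y z} → i ≢ y → i ≢ z → lookup b i ≡ false → lookup (two y z) i ≡ false
  two-off {i} {y} {z} p q e = trans (lookup-flip-≢ y i _ p) (trans (lookup-flip-≢ z i _ q) e)

  two-onˡ : ∀ {y z} → y ≢ z → lookup b y ≡ false → lookup (two y z) y ≡ true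
  two-onˡ {y} {z} q e = trans (lookup-flip y _) (cong not (trans (lookup-flip-≢ z y _ q) e))

  two-onʳ : ∀ {y z} → z ≢ y → lookup b z ≡ false → lookup (two y z) z ≡ true
  two-onʳ {y} {z} q e = trans (lookup-flip-≢ y z _ q) (trans (lookup-flip z _) (cong not e))

  three-off : ∀ {i x y z} → i ≢ x → i ≢ y → i ≢ z → lookup b i ≡ false → lookup (three x y z) i ≡ false
  three-off {i} {x} o p q e = trans (lookup-flip-≢ x i _ o) (two-off p q e)

  three-onˡ : ∀ {x y z} → x ≢ y → x ≢ z → lookup b x ≡ false → lookup (three x y z) x ≡ true
  three-onˡ {x} p q e = trans (lookup-flip x _) (cong not (two-off p q e))

  three-onᵐ : ∀ {x y z} → y ≢ x → y ≢ z → lookup b y ≡ false → lookup (three x y z) y ≡ true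
  three-onᵐ {x} {y} p q e = trans (lookup-flip-≢ x y _ p) (two-onˡ q e)

  three-onʳ : ∀ {x y z} → z ≢ x → z ≢ y → lookup b z ≡ false → lookup (three x y z) z ≡ true
  three-onʳ {x} {y} {z} p q e = trans (lookup-flip-≢ x z _ p) (two-onʳ q e)

  -- Together with `walk-on` this supplies the coordinates by which vertices are told apart:
  -- whatever the walk avoids stays 0 along it, and z stays 1.
  walk-off : ∀ {z i} l p → i ∉ l → i ≢ p → i ≢ z → lookup b i ≡ false → ∀ {v} → v ∈ walk z l p → lookup v i ≡ false
  walk-off (s ∷ []) p h hp hz e (here refl) = three-off (λ q → h (here q)) hp hz e
  walk-off (s ∷ []) p h hp hz e (there (here refl)) = two-off hp hz e
  walk-off (s ∷ s' ∷ r) p h hp hz e (here refl) = three-off (λ q → h (here q)) (λ q → h (there (here q))) hz e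
  walk-off (s ∷ s' ∷ r) p h hp hz e (there (here refl)) = two-off (λ q → h (there (here q))) hz e
  walk-off (s ∷ s' ∷ r) p h hp hz e (there (there v∈)) = walk-off (s' ∷ r) p (λ q → h (there q)) hp hz e v∈

  walk-on : ∀ {z} l p → z ∉ l → z ≢ p → lookup b z ≡ false → ∀ {v} → v ∈ walk z l p → lookup v z ≡ true
  walk-on (s ∷ []) p h hp e (here refl) = three-onʳ (λ q → h (here q)) hp e
  walk-on (s ∷ []) p h hp e (there (here refl)) = two-onʳ hp e
  walk-on (s ∷ s' ∷ r) p h hp e (here refl) = three-onʳ (λ q → h (here q)) (λ q → h (there (here q))) e
  walk-on (s ∷ s' ∷ r) p h hp e (there (here refl)) = two-onʳ (λ q → h (there (here q))) e
  walk-on (s ∷ s' ∷ r) p h hp e (there (there v∈)) = walk-on (s' ∷ r) p (λ q → h (there q)) hp e v∈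

  -- Only the first two vertices, {s,z} and {s,s',z}, contain s, and s' tells them apart; everything
  -- after them has left s for good.
  unique-walk : ∀ z s r p → Chain (λ s s' → Star s s' z) (s ∷ r) p → Unique (s ∷ r) → p ∉ s ∷ r →
    Unique (two s z ∷ walk z (s ∷ r) p)
  unique-walk z s [] p st u h = ∷-unique n₁ (∷-unique n₂ (∷-unique (λ ()) []))
    where
    n₂ : three s p z ∉ two p z ∷ []
    n₂ (here e) = disagree s (three-onˡ (x≢y st) (x≢z st) (bx st)) (two-off (x≢y st) (x≢z st) (bx st)) e
    n₁ : two s z ∉ three s p z ∷ two p z ∷ []
    n₁ (here e) = disagree p (three-onᵐ (λ q → x≢y st (sym q)) (y≢z st) (by st)) (two-off (λ q → x≢y st (sym q)) (y≢z st) (by st)) (sym e)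
    n₁ (there (here e)) = disagree s (two-onˡ (x≢z st) (bx st)) (two-off (x≢y st) (x≢z st) (bx st)) e
  unique-walk z s (s' ∷ r) p (st , ch) u h = ∷-unique n₁ (∷-unique n₂ (unique-walk z s' r p ch (unique-tail u) (λ q → h (there q))))
    where
    rest-off : ∀ {v} → v ∈ two s' z ∷ walk z (s' ∷ r) p → lookup v s ≡ false
    rest-off (here refl) = two-off (x≢y st) (x≢z st) (bx st)
    rest-off (there v∈) = walk-off (s' ∷ r) p (unique-head u) (λ e → h (here (sym e))) (x≢z st) (bx st) v∈
    n₂ : three s s' z ∉ two s' z ∷ walk z (s' ∷ r) p
    n₂ v∈ = true≢false (three-onˡ (x≢y st) (x≢z st) (bx st)) (rest-off v∈)
    n₁ : two s z ∉ three s s' z ∷ two s' z ∷ walk z (s' ∷ r) p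
    n₁ (here e) = disagree s' (three-onᵐ (λ q → x≢y st (sym q)) (y≢z st) (by st)) (two-off (λ q → x≢y st (sym q)) (y≢z st) (by st)) (sym e)
    n₁ (there v∈) = true≢false (two-onˡ (x≢z st) (bx st)) (rest-off v∈)

  Chain-z∉ : ∀ {z} l p → Chain (λ s s' → Star s s' z) l p → z ∉ l
  Chain-z∉ (s ∷ []) p st (here e) = x≢z st (sym e)
  Chain-z∉ (s ∷ s' ∷ r) p (st , ch) (here e) = x≢z st (sym e)
  Chain-z∉ (s ∷ s' ∷ r) p (st , ch) (there h) = Chain-z∉ (s' ∷ r) p ch h

  module _ (z s s' : Fin n) (r : List (Fin n)) (p : Fin n)
           (st : Star s s' z) (ch : Chain (λ s s' → Star s s' z) (s' ∷ r) p)
           (u : Unique (s ∷ s' ∷ r)) (p∉ : p ∉ s ∷ s' ∷ r) where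

    -- The pair p, s closes the path to a cycle in the link, and each vertex of that cycle accounts
    -- for two vertices here: a link cycle of length k gives a C_2k.
    evenCycle : List (Vert n)
    evenCycle = three p s z ∷ two s z ∷ walk z (s ∷ s' ∷ r) p

    evenCycle-chain : Star p s z → Chain (Step G) evenCycle (three p s z)
    evenCycle-chain c = step-yz c , walk-chain z s (s' ∷ r) p _ (st , ch) (Step-sym (step-xz c))

    unique-evenCycle : Star p s z → Unique evenCycle
    unique-evenCycle c = ∷-unique n₁ (unique-walk z s (s' ∷ r) p (st , ch) u p∉)
      where
      s-on : lookup (three p s z) s ≡ true
      s-on = three-onᵐ (λ q → x≢y c (sym q)) (x≢z st) (bx st)
      n₁ : three p s z ∉ two s z ∷ walk z (s ∷ s' ∷ r) p
      n₁ (here e) = disagree p (three-onˡ (x≢y c) (x≢z c) (bx c)) (two-off (x≢y c) (x≢z c) (bx c)) e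
      n₁ (there (here e)) = disagree s' (three-onᵐ (λ q → x≢y st (sym q)) (y≢z st) (by st))
        (three-off (λ q → p∉ (there (here (sym q)))) (λ q → x≢y st (sym q)) (y≢z st) (by st)) (sym e)
      n₁ (there (there (here e))) = disagree s s-on (two-off (x≢y st) (x≢z st) (bx st)) e
      n₁ (there (there (there v∈))) = true≢false s-on
        (walk-off (s' ∷ r) p (unique-head u) (λ q → p∉ (here (sym q))) (x≢z st) (bx st) v∈)

    module _ (z' x : Fin n) (x∉ : x ∉ s ∷ s' ∷ r) (z≢z' : z ≢ z')
             (sz' : Star s s' z') (pz' : Star p s z') (xz : Star p x z) (xz' : Star p x z') where

      private
        coords : Vec (Fin n) 6
        coords = p ∷ x ∷ s ∷ s' ∷ z ∷ z' ∷ []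

        -- Row by row the vertices of `detour`: which of p, x, s, s', z, z' are flipped.
        codes : List (Vec Bool 6)
        codes =
          (true ∷ true ∷ false ∷ false ∷ true ∷ false ∷ []) ∷
          (true ∷ true ∷ false ∷ false ∷ false ∷ false ∷ []) ∷
          (true ∷ true ∷ false ∷ false ∷ false ∷ true ∷ []) ∷
          (true ∷ false ∷ false ∷ false ∷ false ∷ true ∷ []) ∷
          (true ∷ false ∷ true ∷ false ∷ false ∷ true ∷ []) ∷
          (false ∷ false ∷ true ∷ false ∷ false ∷ true ∷ []) ∷
          (false ∷ false ∷ true ∷ true ∷ false ∷ true ∷ []) ∷
          (false ∷ false ∷ true ∷ true ∷ false ∷ false ∷ []) ∷ []

        unique-coords : Unique (Vec.toList coords)
        unique-coords =
          ((x≢y xz) ∷ (λ q → p∉ (here q)) ∷ (λ q → p∉ (there (here q))) ∷ x≢z xz ∷ x≢z xz' ∷ []) ∷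
          ((λ q → x∉ (here q)) ∷ (λ q → x∉ (there (here q))) ∷ y≢z xz ∷ y≢z xz' ∷ []) ∷
          (x≢y st ∷ x≢z st ∷ x≢z sz' ∷ []) ∷
          (y≢z st ∷ y≢z sz' ∷ []) ∷
          (z≢z' ∷ []) ∷ [] ∷ []

      -- After {p,z}, the end of the walk, z is exchanged for z' through {p,x}, the closing pair p,
      -- s is crossed above z', and z' is exchanged back through {s,s'}. These eight vertices
      -- replace the two closing vertices of the even cycle.
      detour : List (Vert n)
      detour = three p x z ∷ two p x ∷ three p x z' ∷ two p z' ∷ three p s z' ∷ two s z' ∷ three s s' z' ∷ two s s' ∷ []

      oddCycle : List (Vert n)
      oddCycle = detour ++ walk z (s ∷ s' ∷ r) p

      oddCycle-chain : Chain (Step G) oddCycle (three p x z)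
      oddCycle-chain =
        step-xy xz , Step-sym (step-xy xz') , step-xz xz' , Step-sym (step-xz pz') , step-yz pz' ,
        Step-sym (step-xz sz') , step-xy sz' , Step-sym (step-xy st) , step-yz st ,
        walk-chain z s' r p _ ch (Step-sym (step-xz xz))

      unique-oddCycle : Unique oddCycle
      unique-oddCycle = unique-++
        (unique-map {f = λ c → flipBy c coords b} (flipBy-injective coords b unique-coords) (from-yes (unique? (≡-dec BoolP._≟_) codes)))
        (unique-tail (unique-walk z s (s' ∷ r) p (st , ch) u p∉)) disjoint
        where
        z∉ = Chain-z∉ (s ∷ s' ∷ r) p (st , ch)
        z-on : ∀ {v} → v ∈ walk z (s ∷ s' ∷ r) p → lookup v z ≡ true
        z-on = walk-on (s ∷ s' ∷ r) p z∉ (λ q → x≢z xz (sym q)) (bz st)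
        z≢p : z ≢ p
        z≢p q = x≢z xz (sym q)
        z≢x : z ≢ x
        z≢x q = y≢z xz (sym q)
        z≢s : z ≢ s
        z≢s q = z∉ (here q)
        z≢s' : z ≢ s'
        z≢s' q = z∉ (there (here q))
        -- Every walk vertex contains z and none contains x. The first detour vertex contains x, the
        -- other seven lack z.
        disjoint : ∀ {v} → v ∈ detour → v ∉ walk z (s ∷ s' ∷ r) p
        disjoint (here refl) w∈ = true≢false (three-onᵐ (λ q → x≢y xz (sym q)) (y≢z xz) (by xz))
          (walk-off (s ∷ s' ∷ r) p x∉ (λ q → x≢y xz (sym q)) (y≢z xz) (by xz) w∈)
        disjoint (there (here refl)) w∈ = true≢false (z-on w∈) (two-off z≢p z≢x (bz st))
        disjoint (there (there (here refl))) w∈ = true≢false (z-on w∈) (three-off z≢p z≢x z≢z' (bz st))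
        disjoint (there (there (there (here refl)))) w∈ = true≢false (z-on w∈) (two-off z≢p z≢z' (bz st))
        disjoint (there (there (there (there (here refl))))) w∈ = true≢false (z-on w∈) (three-off z≢p z≢s z≢z' (bz st))
        disjoint (there (there (there (there (there (here refl)))))) w∈ = true≢false (z-on w∈) (two-off z≢s z≢z' (bz st))
        disjoint (there (there (there (there (there (there (here refl))))))) w∈ = true≢false (z-on w∈) (three-off z≢s z≢s' z≢z' (bz st))
        disjoint (there (there (there (there (there (there (there (here refl)))))))) w∈ = true≢false (z-on w∈) (two-off z≢s z≢s' (bz st))

unique-filter-allFin : (p : Fin n → Bool) → Unique (filterᵇ p (allFin n))
unique-filter-allFin {n} p = unique-⊆ (filterᵇ-⊆ p (allFin n)) (Uniqueₚ.allFin⁺ n)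

exists-outside : {ys av : List (Fin n)} → Unique ys → length av < length ys → ∃ λ y → y ∈ ys × y ∉ av
exists-outside {n} {ys} {av} u lt with any? (λ y → ¬? (y ∈? av)) ys
  where open DecMembership (Fin._≟_ {n}) using (_∈?_)
... | yes h = find h
... | no h = ⊥-elim (<⇒≱ lt (count-≤ {R = _≡_} u
    (λ {y} y∈ → y , decidable-stable (y ∈? av) (λ y∉ → h (lose y∈ y∉)) , refl) (λ { _ _ refl refl → refl })))
  where open DecMembership (Fin._≟_ {n}) using (_∈?_)

split-at : (m : ℕ) (us : List A) → m ≤ length us → ∃[ xs ] ∃[ ys ] (us ≡ xs ++ ys × length xs ≡ m)
split-at zero us h = [] , us , refl , refl
split-at (suc m) (u ∷ us) (s≤s h) with split-at m us h
... | xs , ys , refl , refl = u ∷ xs , ys , refl , refl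

unique-++ˡ : (xs : List A) {ys : List A} → Unique (xs ++ ys) → Unique xs
unique-++ˡ [] u = []
unique-++ˡ (x ∷ xs) u = ∷-unique (λ h → unique-head u (∈-++⁺ˡ h)) (unique-++ˡ xs (unique-tail u))

module Interleave {n : ℕ} (R : Fin n → Fin n → Set) (irrefl : ∀ {u v} → R u v → u ≢ v)
  (us : List (Fin n)) (p : Fin n) (u-p : ∀ {u} → u ∈ us → R u p) (K : ℕ)
  (middle : ∀ {u u'} → u ∈ us → u' ∈ us → u ≢ u' → ∀ av → length av < K → ∃ λ y → y ∉ av × R u y × R y u')
  where

  -- A fresh common neighbour goes between consecutive members. `av` collects p, the chosen members
  -- and the middles used so far; it gains one entry whenever `xs` loses one, so the budget K is
  -- kept. The last clause carries distinctness through the induction: a later middle lies outside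
  -- `av`.
  interleave : ∀ x xs av → (∀ {e} → e ∈ x ∷ xs → e ∈ us) → Unique (x ∷ xs) →
    (∀ {e} → e ∈ x ∷ xs → e ∈ av) → p ∈ av → length av + length xs ≤ K →
    ∃[ r ] (length r ≡ 2 * length xs × Chain R (x ∷ r) p × Unique (x ∷ r) × p ∉ x ∷ r ×
            (∀ {e} → e ∈ r → e ∈ xs ⊎ e ∉ av))
  interleave x [] av ⊆us u ⊆av p∈ lt = [] , refl , u-p (⊆us (here refl)) , u ,
    (λ { (here q) → irrefl (u-p (⊆us (here refl))) (sym q) }) , λ ()
  interleave x (x' ∷ xs) av ⊆us u ⊆av p∈ lt
    with middle (⊆us (here refl)) (⊆us (there (here refl))) (λ q → unique-head u (here q)) av
           (≤-trans (≤-trans (≤-reflexive (+-comm 1 (length av))) (+-monoʳ-≤ (length av) (s≤s z≤n))) lt)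
  ... | y , y∉ , Rxy , Ryx' with interleave x' xs (y ∷ av) (λ h → ⊆us (there h)) (unique-tail u)
           (λ h → there (⊆av (there h))) (there p∈) (≤-trans (≤-reflexive (sym (+-suc (length av) (length xs)))) lt)
  ... | r , len , ch , ur , p∉ , orig = y ∷ x' ∷ r , len' , (Rxy , Ryx' , ch) ,
      ∷-unique x∉ (∷-unique y∉' ur) , p∉' , orig'
    where
    len' : suc (suc (length r)) ≡ 2 * suc (length xs)
    len' = trans (cong (λ a → suc (suc a)) len) (lemma (length xs))
      where
      lemma : ∀ a → suc (suc (2 * a)) ≡ 2 * suc a
      lemma = solve-∀
    y∉' : y ∉ x' ∷ r
    y∉' (here refl) = y∉ (⊆av (there (here refl)))
    y∉' (there h) with orig h
    ... | inj₁ h' = y∉ (⊆av (there (there h')))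
    ... | inj₂ h' = h' (here refl)
    x∉ : x ∉ y ∷ x' ∷ r
    x∉ (here refl) = y∉ (⊆av (here refl))
    x∉ (there (here refl)) = unique-head u (here refl)
    x∉ (there (there h)) with orig h
    ... | inj₁ h' = unique-head u (there h')
    ... | inj₂ h' = h' (there (⊆av (here refl)))
    p∉' : p ∉ x ∷ y ∷ x' ∷ r
    p∉' (here refl) = irrefl (u-p (⊆us (here refl))) refl
    p∉' (there (here refl)) = y∉ p∈
    p∉' (there (there h)) = p∉ h
    orig' : ∀ {e} → e ∈ y ∷ x' ∷ r → e ∈ x' ∷ xs ⊎ e ∉ av
    orig' (here refl) = inj₂ y∉
    orig' (there (here refl)) = inj₁ (here refl)
    orig' (there (there h)) with orig h
    ... | inj₁ h' = inj₁ (there h')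
    ... | inj₂ h' = inj₂ (λ q → h' (there q))

-- Here 2 + m is the number of members of `U` on the path. The even closure gives k = 2(2 + m), the
-- odd one 3 more, and 5 is the only k ≥ 4 of neither form.
cycle-length-split : ∀ j → 4 + j ≢ 5 → ∃ λ m → 4 + j ≡ 2 * (2 + m) ⊎ 4 + j ≡ 2 * (2 + m) + 3
cycle-length-split 0 h = 0 , inj₁ refl
cycle-length-split 1 h = ⊥-elim (h refl)
cycle-length-split 2 h = 1 , inj₁ refl
cycle-length-split 3 h = 0 , inj₂ refl
cycle-length-split (suc (suc j@(suc (suc _)))) h with cycle-length-split j (λ ())
... | m , inj₁ e = suc m , inj₁ (trans (cong (2 +_) e) (lemma m))
  where
  lemma : ∀ m → 2 + 2 * (2 + m) ≡ 2 * (3 + m)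
  lemma = solve-∀
... | m , inj₂ e = suc m , inj₂ (trans (cong (2 +_) e) (lemma m))
  where
  lemma : ∀ m → 2 + (2 * (2 + m) + 3) ≡ 2 * (3 + m) + 3
  lemma = solve-∀

cycle⇒N≢0 : {G : List (Edge n)} {m : ℕ} → G ⊆ cubeEdges n → N n m G ≡ 0 →
  ∀ w₀ W → Unique (w₀ ∷ W) → Chain (Step G) (w₀ ∷ W) w₀ → length (w₀ ∷ W) ≡ m → ⊥
cycle⇒N≢0 {n} {G} {m} G⊆ none w₀ W u ch len = absurd (copies n m G) none
    (copies⁺ (filterᵇ-⊆ _ G) (cycleEdges-isCycle G⊆ u (Chain⇒cycPairs w₀ W ch)) len)
  where
  absurd : ∀ {x : A} xs → length xs ≡ 0 → x ∈ xs → ⊥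
  absurd [] _ ()

module _ {n : ℕ} (L : Fin n → Fin n → Bool) (K : ℕ) (p q : Fin n) where

  U-list : List (Fin n)
  U-list = filterᵇ (U L K p q) (allFin n)

  U∈ : ∀ {u} → u ∈ U-list → U L K p q u ≡ true
  U∈ h = proj₂ (∈-filterᵇ⁻ (U L K p q) (allFin n) h)

  U-list-adjacent₂ : ∀ {u} → u ∈ U-list → L u p ∧ L u q ≡ true
  U-list-adjacent₂ {u} h = proj₁ (∧-true {L u p ∧ L u q} (U∈ h))

  U-list-adjacent : ∀ {u} → u ∈ U-list → L u p ≡ true
  U-list-adjacent {u} h = proj₁ (∧-true {L u p} (U-list-adjacent₂ h))

  U-list-rich : ∀ {u u'} → u ∈ U-list → u' ∈ U-list → u ≢ u' → K ≤ codegree L K u u'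
  U-list-rich {u} {u'} h h' u≢u' = ≮⇒≥ λ lt → true≢false
    (∧-intro (U-list-adjacent₂ h') (∧-intro {not (u ==ᶠ u')} (cong not (≢true⇒false (λ e → u≢u' (==ᶠ⇒≡ e)))) (<ᵇ-true lt)))
    (not-true (all-true (λ v → not ((L v p ∧ L v q) ∧ sparse L K u v)) (proj₂ (∧-true {L u p ∧ L u q} (U∈ h))) (∈-allFin u')))
    where
    <ᵇ-true : ∀ {a b} → a < b → (a <ᵇ b) ≡ true
    <ᵇ-true {a} {b} lt with a <ᵇ b | <⇒<ᵇ lt
    ... | true | _ = refl

  U-list-middle : ∀ {u u'} → u ∈ U-list → u' ∈ U-list → u ≢ u' → ∀ av → length av < K →
    ∃ λ y → y ∉ av × L u y ≡ true × L u' y ≡ true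
  U-list-middle {u} {u'} h h' u≢u' av lt with exists-outside {av = av} (unique-filter-allFin (λ y → L u y ∧ L u' y))
    (≤-trans lt (≤-trans (U-list-rich h h' u≢u') (≤-reflexive (sym (trans (length-filterᵇ _ (allFin n)) (∑-cong (allFin n) (λ y → ⟦∧⟧ (L u y) (L u' y))))))))
  ... | y , y∈ , y∉ with ∧-true {L u y} (proj₂ (∈-filterᵇ⁻ (λ y → L u y ∧ L u' y) (allFin n) y∈))
  ... | a , c = y , y∉ , a , c

module CycleFree {n : ℕ} {G : List (Edge n)} (G⊆ : G ⊆ cubeEdges n) (j : ℕ) (j≢ : 4 + j ≢ 5)
  (none : N n (2 * (4 + j)) G ≡ 0) where

  k K : ℕ
  k = 4 + j
  -- Room for p, the spare vertex x, 2 + m members of `U` and 1 + m middles, where 2(2 + m) ≤ k.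
  K = 2 + k

  module _ (b : Vert n) (z z' : Fin n) (z≢z' : z ≢ z') where
    open CycleInStars G b

    Star₂ : Fin n → Fin n → Set
    Star₂ s s' = Star s s' z × Star s s' z'

    Star₂-swap : ∀ {s s'} → Star₂ s s' → Star₂ s' s
    Star₂-swap (a , b) = Star-swap a , Star-swap b

    module _ (p : Fin n) (us : List (Fin n)) (unique-us : Unique us) (u-p : ∀ {u} → u ∈ us → Star₂ u p)
      (middle : ∀ {u u'} → u ∈ us → u' ∈ us → u ≢ u' → ∀ av → length av < K → ∃ λ y → y ∉ av × Star₂ u y × Star₂ y u') where

      open Interleave Star₂ (λ r → Star.x≢y (proj₁ r)) us p u-p K middle

      weaken : ∀ l → Chain Star₂ l p → Chain (λ s s' → Star s s' z) l p
      weaken [] c = c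
      weaken (a ∷ []) c = proj₁ c
      weaken (a ∷ b ∷ l) (c , cs) = proj₁ c , weaken (b ∷ l) cs

      q₂ : ℕ
      q₂ = proj₁ (cycle-length-split j j≢)

      2+q₂≤k : 2 + q₂ ≤ k
      2+q₂≤k with cycle-length-split j j≢
      ... | m , inj₁ e = ≤-trans (m≤m+n (2 + m) _) (≤-reflexive (sym e))
      ... | m , inj₂ e = ≤-trans (≤-trans (m≤m+n (2 + m) _) (m≤m+n (2 * (2 + m)) 3)) (≤-reflexive (sym e))

      2[2+q₂]≤k : 2 * (2 + q₂) ≤ k
      2[2+q₂]≤k with cycle-length-split j j≢
      ... | m , inj₁ e = ≤-reflexive (sym e)
      ... | m , inj₂ e = ≤-trans (m≤m+n (2 * (2 + m)) 3) (≤-reflexive (sym e))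

      -- The first element x is set aside for the detour and 2 + `q₂` further ones go on the path,
      -- for which more than k elements suffice. `vs` is a copy of `us` that can be matched on while
      -- `us` stays a module parameter.
      impossible : ∀ vs → us ≡ vs → k < length vs → ⊥
      impossible (x ∷ vs) eq (s≤s lt) with split-at (2 + q₂) vs (≤-trans 2+q₂≤k lt)
      ... | s ∷ x₁ ∷ xs , ys , refl , len with interleave s (x₁ ∷ xs) (p ∷ x ∷ s ∷ x₁ ∷ xs)
              (λ h → subst (_ ∈_) (sym eq) (there (∈-++⁺ˡ h)))
              (unique-++ˡ (s ∷ x₁ ∷ xs) (unique-tail uniq)) (λ h → there (there h)) (here refl) room
        where
        uniq : Unique (x ∷ s ∷ x₁ ∷ xs ++ ys)
        uniq = subst Unique eq unique-us
        lemma : ∀ a → 2 + (2 + a) + (1 + a) ≤ 2 + 2 * (2 + a)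
        lemma a = subst (2 + (2 + a) + (1 + a) ≤_) (lemma₂ a) (m≤m+n _ 1)
          where
          lemma₂ : ∀ a → 2 + (2 + a) + (1 + a) + 1 ≡ 2 + 2 * (2 + a)
          lemma₂ = solve-∀
        room : 2 + length (s ∷ x₁ ∷ xs) + length (x₁ ∷ xs) ≤ K
        room = ≤-trans (lemma (length xs)) (≤-trans (≤-reflexive (cong (λ a → 2 + 2 * a) len)) (+-monoʳ-≤ 2 2[2+q₂]≤k))
      ... | [] , () , _
      ... | s' ∷ r , lenr , ch@(st , ch') , u , p∉ , orig = finish (cycle-length-split j j≢) refl
        where
        x∈us : x ∈ us
        x∈us = subst (x ∈_) (sym eq) (here refl)
        s∈us : s ∈ us
        s∈us = subst (s ∈_) (sym eq) (there (here refl))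
        x∉vs : x ∉ s ∷ x₁ ∷ xs ++ ys
        x∉vs = unique-head (subst Unique eq unique-us)
        x∉ : x ∉ s ∷ s' ∷ r
        x∉ (here refl) = x∉vs (here refl)
        x∉ (there h) with orig h
        ... | inj₁ h' = x∉vs (there (∈-++⁺ˡ h'))
        ... | inj₂ h' = h' (there (here refl))
        lw : length (walk z (s ∷ s' ∷ r) p) ≡ 2 + 4 * suc (length xs)
        lw = trans (length-walk z (s ∷ s' ∷ r) p) (trans (cong (λ a → 2 * suc a) lenr) (lemma (length xs)))
          where
          lemma : ∀ a → 2 * suc (2 * suc a) ≡ 2 + 4 * suc a
          lemma = solve-∀
        ps : Star₂ p s
        ps = Star₂-swap (u-p s∈us)
        px : Star₂ p x
        px = Star₂-swap (u-p x∈us)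
        chz = weaken (s' ∷ r) ch'
        len' : ∀ {m'} → q₂ ≡ m' → length xs ≡ m'
        len' refl = suc-injective (suc-injective len)
        finish : (c : ∃ λ m → k ≡ 2 * (2 + m) ⊎ k ≡ 2 * (2 + m) + 3) → q₂ ≡ proj₁ c → ⊥
        finish (m' , inj₁ e) q = cycle⇒N≢0 G⊆ none _ _
          (unique-evenCycle z s s' r p (proj₁ st) chz u p∉ (proj₁ ps))
          (evenCycle-chain z s s' r p (proj₁ st) chz u p∉ (proj₁ ps))
          (trans (cong (2 +_) lw) (trans (lemma (length xs)) (trans (cong (λ a → 2 * (2 * (2 + a))) (len' q)) (cong (2 *_) (sym e)))))
          where
          lemma : ∀ a → 2 + (2 + 4 * suc a) ≡ 2 * (2 * (2 + a))
          lemma = solve-∀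
        finish (m' , inj₂ e) q = cycle⇒N≢0 G⊆ none _ _
          (unique-oddCycle z s s' r p (proj₁ st) chz u p∉ z' x x∉ z≢z' (proj₂ st) (proj₂ ps) (proj₁ px) (proj₂ px))
          (oddCycle-chain z s s' r p (proj₁ st) chz u p∉ z' x x∉ z≢z' (proj₂ st) (proj₂ ps) (proj₁ px) (proj₂ px))
          (trans (cong (8 +_) lw) (trans (lemma (length xs)) (trans (cong (λ a → 2 * (2 * (2 + a) + 3)) (len' q)) (cong (2 *_) (sym e)))))
          where
          lemma : ∀ a → 8 + (2 + 4 * suc a) ≡ 2 * (2 * (2 + a) + 3)
          lemma = solve-∀

  -- The walk needs the stars with z, the detour also those with z'.
  link : Vert n → Fin n → Fin n → Fin n → Fin n → Bool
  link b z z' x y = starAbove (downEdge G) b x y z ∧ starAbove (downEdge G) b x y z'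

  link⇒Star₂ : ∀ b z z' z≢z' {x y} → link b z z' x y ≡ true → Star₂ b z z' z≢z' x y
  link⇒Star₂ b z z' _ {x} {y} h with ∧-true {starAbove (downEdge G) b x y z} h
  ... | a , c = starAbove⇒Star a , starAbove⇒Star c
    where open CycleInStars G b

  U-small : ∀ b z z' → z ≢ z' → ∀ p q → ∑F n (λ u → ⟦ U (link b z z') K p q u ⟧) ≤ k
  U-small b z z' z≢z' p q = ≮⇒≥ λ lt → impossible b z z' z≢z' p (U-list L K p q) (unique-filter-allFin (U L K p q))
      (λ h → link⇒Star₂ b z z' z≢z' (U-list-adjacent L K p q h))
      (λ h h' u≢u' av lt → middle (U-list-middle L K p q h h' u≢u' av lt))
      (U-list L K p q) refl (≤-trans lt (≤-reflexive (sym (length-filterᵇ _ (allFin n)))))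
    where
    L = link b z z'
    middle : ∀ {u u' av} → (∃ λ y → y ∉ av × L u y ≡ true × L u' y ≡ true) →
             ∃ λ y → y ∉ av × Star₂ b z z' z≢z' u y × Star₂ b z z' z≢z' y u'
    middle (y , y∉ , a , c) = y , y∉ , link⇒Star₂ b z z' z≢z' a , Star₂-swap b z z' z≢z' (link⇒Star₂ b z z' z≢z' c)

-- Density of a graph without C_2k

∑-cubeEdges : (n : ℕ) (f : Edge n → ℕ) →
  ∑ (cubeEdges n) f ≡ ∑ (allVerts n) (λ v → ∑F n (λ i → ⟦ not (lookup v i) ⟧ * f (v , i)))
∑-cubeEdges n f = trans (∑-concatMap _ (allVerts n) f) (∑-cong (allVerts n)
  (λ v → trans (∑-map (v ,_) (filterᵇ (λ i → not (lookup v i)) (allFin n)) f) (∑-filterᵇ (λ i → not (lookup v i)) (allFin n) (λ i → f (v , i)))))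

⊆-count : {G S xs : List (Edge n)} → S ⊆ xs → (∀ {e} → e ∈ S → e ∈ G) → length S ≤ ∑ xs (λ e → ⟦ e ∈ᵉ G ⟧)
⊆-count [] h = z≤n
⊆-count {G = G} (y ∷ʳ s) h = m≤n⇒m≤o+n ⟦ y ∈ᵉ G ⟧ (⊆-count s h)
⊆-count {S = y ∷ _} (refl ∷ s) h rewrite ∈⇒∈ᵉ (h (here refl)) = s≤s (⊆-count s (λ e∈ → h (there e∈)))

-- `cubeEdges` stores an edge at its lower end, while the down degree counts it at the upper end;
-- for each direction i the sum is carried across by `flip i`.
length≤∑downDegree : {G : List (Edge n)} → G ⊆ cubeEdges n → length G ≤ ∑ (allVerts n) (downDegree (downEdge G))
length≤∑downDegree {n} {G} G⊆ = begin
  length G ≤⟨ ⊆-count G⊆ (λ h → h) ⟩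
  ∑ (cubeEdges n) (λ e → ⟦ e ∈ᵉ G ⟧) ≡⟨ ∑-cubeEdges n _ ⟩
  ∑ V (λ v → ∑F n (λ i → ⟦ not (lookup v i) ⟧ * ⟦ (v , i) ∈ᵉ G ⟧)) ≡⟨ ∑-swap V (allFin n) _ ⟩
  ∑F n (λ i → ∑ V (λ v → ⟦ not (lookup v i) ⟧ * ⟦ (v , i) ∈ᵉ G ⟧)) ≡⟨ ∑-cong (allFin n) (λ i → ∑-flip i _) ⟩
  ∑F n (λ i → ∑ V (λ v → ⟦ not (lookup (flip i v) i) ⟧ * ⟦ (flip i v , i) ∈ᵉ G ⟧))
    ≤⟨ ∑-mono (allFin n) (λ i → ∑-mono V (λ v → point i v)) ⟩
  ∑F n (λ i → ∑ V (λ v → ⟦ downEdge G v i ⟧)) ≡⟨ ∑-swap V (allFin n) _ ⟨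
  ∑ V (downDegree (downEdge G)) ∎
  where
  open ≤-Reasoning
  V = allVerts n
  point : ∀ i v → ⟦ not (lookup (flip i v) i) ⟧ * ⟦ (flip i v , i) ∈ᵉ G ⟧ ≤ ⟦ downEdge G v i ⟧
  point i v with lookup (flip i v) i in e
  ... | true = z≤n
  ... | false = ≤-reflexive (trans (*-identityˡ _) (cong ⟦_⟧ (trans (cong (_∈ᵉ G) edge≡) (sym (cong (_∧ (edgeAt v i ∈ᵉ G)) up)))))
    where
    up : lookup v i ≡ true
    up = trans (cong (λ u → lookup u i) (sym (flip-flip i v))) (trans (lookup-flip i (flip i v)) (cong not e))
    edge≡ : (flip i v , i) ≡ edgeAt v i
    edge≡ = trans (cong (_, i) (sym (down≡ _ i e))) (edgeAt-flip v i)

sq-sum : ∀ a b → (a + b) * (a + b) ≤ 2 * (a * a + b * b)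
sq-sum a b = begin
  (a + b) * (a + b)               ≡⟨ lemma a b ⟩
  a * a + b * b + 2 * (a * b)     ≤⟨ +-monoʳ-≤ (a * a + b * b) (2ab≤a²+b² a b) ⟩
  a * a + b * b + (a * a + b * b) ≡⟨ lemma₂ (a * a + b * b) ⟩
  2 * (a * a + b * b)             ∎
  where
  open ≤-Reasoning
  lemma : ∀ a b → (a + b) * (a + b) ≡ a * a + b * b + 2 * (a * b)
  lemma = solve-∀
  lemma₂ : ∀ a → a + a ≡ 2 * a
  lemma₂ = solve-∀

-- Eliminates l and h; only the power 11 = 12 - 1 of n matters.
combine : ∀ {n t h l M} → .{{NonZero n}} → l * l ≤ n * (n * n * M) → h * h ≤ n * n * (n * n * l + n * n * n) →
  t * t * t ≤ h + 3 * (n * n) → t ^ 12 ≤ n ^ 11 * (16 * M + 664)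
combine {n} {t} {h} {l} {M} l² h² t³ = begin
  t ^ 12                                     ≡⟨ t¹² t ⟩
  sq (sq (t * t * t))                        ≤⟨ sq-mono (sq-mono t³) ⟩
  sq (sq (h + 3 * (n * n)))                  ≤⟨ sq-mono (sq-sum h (3 * (n * n))) ⟩
  sq (2 * (sq h + sq (3 * (n * n))))         ≡⟨ four (sq h) (sq (3 * (n * n))) ⟩
  4 * sq (sq h + sq (3 * (n * n)))           ≤⟨ *-monoʳ-≤ 4 (sq-sum (sq h) (sq (3 * (n * n)))) ⟩
  4 * (2 * (sq (sq h) + sq (sq (3 * (n * n))))) ≤⟨ *-monoʳ-≤ 4 (*-monoʳ-≤ 2 (+-mono-≤ h⁴ n⁸)) ⟩
  -- The constants: 4 · 2 · 2 = 16 in front of M, and 16 + 8 · 81 = 664 from the rest, as (3n²)⁴ =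
  -- 81 n⁸.
  4 * (2 * (2 * (n ^ 11 * M + n ^ 11) + 81 * n ^ 11)) ≡⟨ collect (n ^ 11) M ⟩
  n ^ 11 * (16 * M + 664)                    ∎
  where
  open ≤-Reasoning
  sq : ℕ → ℕ
  sq x = x * x
  sq-mono : ∀ {a b} → a ≤ b → sq a ≤ sq b
  sq-mono p = *-mono-≤ p p
  t¹² : ∀ t → t ^ 12 ≡ (t * t * t) * (t * t * t) * ((t * t * t) * (t * t * t))
  t¹² = solve 1 (λ t → t :^ 12 := (t :* t :* t) :* (t :* t :* t) :* ((t :* t :* t) :* (t :* t :* t))) refl
  four : ∀ a b → 2 * (a + b) * (2 * (a + b)) ≡ 4 * ((a + b) * (a + b))
  four = solve-∀
  collect : ∀ x M → 4 * (2 * (2 * (x * M + x) + 81 * x)) ≡ x * (16 * M + 664)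
  collect = solve-∀
  h⁴ : sq (sq h) ≤ 2 * (n ^ 11 * M + n ^ 11)
  h⁴ = begin
    sq (sq h) ≤⟨ sq-mono h² ⟩
    sq (n * n * (n * n * l + n * n * n)) ≡⟨ cong sq (distr n l) ⟩
    sq (n ^ 4 * l + n ^ 5) ≤⟨ sq-sum (n ^ 4 * l) (n ^ 5) ⟩
    2 * (sq (n ^ 4 * l) + sq (n ^ 5)) ≡⟨ cong (2 *_) (cong₂ _+_ (p₁ n l) (p₂ n)) ⟩
    2 * (n ^ 8 * (l * l) + n ^ 10) ≤⟨ *-monoʳ-≤ 2 (+-mono-≤ (*-monoʳ-≤ (n ^ 8) l²) (^-monoʳ-≤ n (n≤1+n 10))) ⟩
    2 * (n ^ 8 * (n * (n * n * M)) + n ^ 11) ≡⟨ cong (λ x → 2 * (x + n ^ 11)) (p₃ n M) ⟩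
    2 * (n ^ 11 * M + n ^ 11) ∎
    where
    distr : ∀ n l → n * n * (n * n * l + n * n * n) ≡ n ^ 4 * l + n ^ 5
    distr = solve 2 (λ n l → n :* n :* (n :* n :* l :+ n :* n :* n) := n :^ 4 :* l :+ n :^ 5) refl
    p₁ : ∀ n l → n ^ 4 * l * (n ^ 4 * l) ≡ n ^ 8 * (l * l)
    p₁ = solve 2 (λ n l → n :^ 4 :* l :* (n :^ 4 :* l) := n :^ 8 :* (l :* l)) refl
    p₂ : ∀ n → n ^ 5 * n ^ 5 ≡ n ^ 10
    p₂ = solve 1 (λ n → n :^ 5 :* n :^ 5 := n :^ 10) refl
    p₃ : ∀ n M → n ^ 8 * (n * (n * n * M)) ≡ n ^ 11 * M
    p₃ = solve 2 (λ n M → n :^ 8 :* (n :* (n :* n :* M)) := n :^ 11 :* M) refl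
  n⁸ : sq (sq (3 * (n * n))) ≤ 81 * n ^ 11
  n⁸ = ≤-trans (≤-reflexive (lemma n)) (*-monoʳ-≤ 81 (^-monoʳ-≤ n {8} {11} (m≤m+n 8 3)))
    where
    lemma : ∀ n → 3 * (n * n) * (3 * (n * n)) * (3 * (n * n) * (3 * (n * n))) ≡ 81 * n ^ 8
    lemma = solve 1 (λ n → con 3 :* (n :* n) :* (con 3 :* (n :* n)) :* (con 3 :* (n :* n) :* (con 3 :* (n :* n))) := con 81 :* n :^ 8) refl

-- t is at most half the average degree of G, so the conclusion gives an edge density of order
-- n^(-1/12). The bounds are chained from the inside out: size of `U`, link counts, star counts, t.
turán : ∀ k → 4 ≤ k → k ≢ 5 → ∃ λ κ → ∀ n .{{_ : NonZero n}} (G : List (Edge n)) t → G ⊆ cubeEdges n →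
  N n (2 * k) G ≡ 0 → t * 2 ^ n ≤ length G → t ^ 12 ≤ n ^ 11 * κ
turán k k≥4 k≢5 with m≤n⇒∃[o]m+o≡n k≥4
... | j , refl = 16 * M + 664 , bound
  where
  M : ℕ
  -- This is k + K²: at most k vertices remain in `U`, at most K² are deleted on average.
  M = (4 + j) + (6 + j) * (6 + j)
  bound : ∀ n .{{_ : NonZero n}} (G : List (Edge n)) t → G ⊆ cubeEdges n →
    N n (2 * (4 + j)) G ≡ 0 → t * 2 ^ n ≤ length G → t ^ 12 ≤ n ^ 11 * (16 * M + 664)
  -- l and h are the integer roots of what `U-bound` and `link-bound` allow for the squares.
  bound n G t G⊆ none tG with isqrt (n * (n * n * M))
  ... | l , l² , l-max with isqrt (n * n * (n * n * l + n * n * n))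
  ... | h , h² , h-max = combine {n} {t} {h} {l} {M} l² h² (degree-bound D {t} {h} (≤-trans tG (length≤∑downDegree G⊆)) h-bound)
    where
    open CycleFree G⊆ j k≢5 none
    D = downEdge G
    l-bound : ∀ b z z' → z ≢ z' → linkCount (starAbove D b) z z' ≤ l
    l-bound b z z' z≢z' = l-max _ (subst (λ x → x * x ≤ n * (n * n * M))
      (∑-cong (allFin n) (λ x → ∑-cong (allFin n) (λ y → ⟦∧⟧ (starAbove D b x y z) (starAbove D b x y z'))))
      (U-bound (link b z z') K (U-small b z z' z≢z')))
    h-bound : ∀ b → starCount D b ≤ h
    h-bound b = h-max _ (link-bound (starAbove D b) (l-bound b))

-- Symmetries of the hypercube

-- Common form of the automorphisms of a cube and the embeddings of subcubes. `reflects` brings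
-- adjacency in the image back to the source, so that a cycle in the image can be pulled back.
record CubeMap (n n' : ℕ) : Set where
  field
    onVert    : Vert n → Vert n'
    onDir     : Fin n → Fin n'
    injective : ∀ {u v} → onVert u ≡ onVert v → u ≡ v
    onFlip    : ∀ i v → onVert (flip i v) ≡ flip (onDir i) (onVert v)
    reflects  : ∀ {a b j} → onVert b ≡ flip j (onVert a) → ∃ λ i → onDir i ≡ j × b ≡ flip i a

  -- The image of the lower end may be the upper end, hence `edgeAt`.
  onEdge : Edge n → Edge n'
  onEdge (v , i) = edgeAt (onVert v) (onDir i)

  onEdge-edgeAt : ∀ a i → onEdge (edgeAt a i) ≡ edgeAt (onVert a) (onDir i)
  onEdge-edgeAt a i with proj₂ (edgeAt-ends {u = a [ i ]≔ false} {a} {i} {i} (cong (_, i) (down≡ _ i (lookup-down a i))))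
  ... | inj₁ e = cong (λ v → edgeAt (onVert v) (onDir i)) e
  ... | inj₂ e = trans (cong (λ v → edgeAt v (onDir i)) (trans (cong onVert e) (onFlip i a))) (edgeAt-flip (onVert a) (onDir i))

  -- A preimage comes as a filtered sublist of `cubeEdges`, the form in which copies are counted.
  pull : List (Edge n') → List (Edge n)
  pull S = filterᵇ (λ e → onEdge e ∈ᵉ S) (cubeEdges n)

  ∈-pull⁺ : ∀ {S e} → e ∈ cubeEdges n → onEdge e ∈ S → e ∈ pull S
  ∈-pull⁺ h h' = ∈-filterᵇ⁺ _ h (∈⇒∈ᵉ h')

  ∈-pull⁻ : ∀ {S e} → e ∈ pull S → onEdge e ∈ S
  ∈-pull⁻ {S} h = ∈ᵉ⇒∈ S (proj₂ (∈-filterᵇ⁻ _ (cubeEdges n) h))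

  ∈-cycPairs-map⁺ : ∀ {a b} w → (a , b) ∈ cycPairs w → (onVert a , onVert b) ∈ cycPairs (map onVert w)
  ∈-cycPairs-map⁺ w h = subst (_ ∈_) (sym (cycPairs-map onVert w)) (∈-map⁺ _ h)

  ∈-cycPairs-map⁻ : ∀ {a' b'} w → (a' , b') ∈ cycPairs (map onVert w) →
    ∃[ a ] ∃[ b ] ((a , b) ∈ cycPairs w × a' ≡ onVert a × b' ≡ onVert b)
  ∈-cycPairs-map⁻ w h with ∈-map⁻ _ (subst (_ ∈_) (cycPairs-map onVert w) h)
  ... | (a , b) , ab∈ , refl = a , b , ab∈ , refl , refl

  pull-isCycle : ∀ {S w} → IsCycle S (map onVert w) → IsCycle (pull S) w
  pull-isCycle {S} {w} c = isCycle (unique-map⁻ unique) steps' covered'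
    where
    open IsCycle c
    steps' : ∀ {a b} → (a , b) ∈ cycPairs w → Step (pull S) a b
    steps' {a} h with steps (∈-cycPairs-map⁺ w h)
    ... | j , eq , e∈ with reflects eq
    ... | i , refl , eq' = i , eq' , ∈-pull⁺ (edgeAt∈cubeEdges a i) (subst (_∈ S) (sym (onEdge-edgeAt a i)) e∈)
    covered' : ∀ {e} → e ∈ pull S → ∃[ a ] ∃[ b ] ∃[ i ] ((a , b) ∈ cycPairs w × b ≡ flip i a × e ≡ edgeAt a i)
    covered' {v , i} h with covered (∈-pull⁻ h) | ∈-cubeEdges⁻ (proj₁ (∈-filterᵇ⁻ _ (cubeEdges n) h))
    ... | a' , b' , j , ab∈ , eq , eq' | canon with ∈-cycPairs-map⁻ w ab∈
    ... | a , b , ab∈' , refl , refl with edgeAt-ends eq'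
    ... | refl , ends = a , b , i , ab∈' , injective (trans eq (sym (onFlip i a))) , trans (cong (_, i) (sym (down≡ v i canon))) (same ends)
      where
      same : onVert v ≡ onVert a ⊎ onVert v ≡ flip (onDir i) (onVert a) → edgeAt v i ≡ edgeAt a i
      same (inj₁ q) = cong (λ u → edgeAt u i) (injective q)
      same (inj₂ q) = trans (cong (λ u → edgeAt u i) (injective (trans q (sym (onFlip i a))))) (edgeAt-flip a i)

  lift-edge : ∀ {S w e} → IsCycle S (map onVert w) → e ∈ S → ∃ λ e' → e' ∈ cubeEdges n × onEdge e' ≡ e
  lift-edge {S} {w} c h with IsCycle.covered c h
  ... | a' , b' , j , ab∈ , eq , refl with ∈-cycPairs-map⁻ w ab∈
  ... | a , b , _ , refl , refl with reflects eq
  ... | i , refl , _ = edgeAt a i , edgeAt∈cubeEdges a i , onEdge-edgeAt a i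

  -- Every edge of a cycle inside the image has a preimage, so nothing of the cycle is lost.
  pull-injective : ∀ {S S' w w'} → S ⊆ cubeEdges n' → S' ⊆ cubeEdges n' →
    IsCycle S (map onVert w) → IsCycle S' (map onVert w') → pull S ≡ pull S' → S ≡ S'
  pull-injective {S} {S'} s s' c c' eq = ⊆-ext (unique-cubeEdges n') s s' (transfer c eq) (transfer c' (sym eq))
    where
    transfer : ∀ {S S' w} → IsCycle S (map onVert w) → pull S ≡ pull S' → ∀ {e} → e ∈ S → e ∈ S'
    transfer {S} {S'} {w} c eq h with lift-edge {w = w} c h
    ... | e' , e'∈ , refl = ∈-pull⁻ (subst (e' ∈_) eq (∈-pull⁺ e'∈ h))

lookup-flip-xor : (i k : Fin n) (v : Vert n) → lookup (flip i v) k ≡ lookup v k xor (i ==ᶠ k)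
lookup-flip-xor i k v with i ==ᶠ k in e
... | true with ==ᶠ⇒≡ e
... | refl = trans (lookup-flip i v) (sym (xor-true (lookup v i)))
  where
  xor-true : ∀ b → b xor true ≡ not b
  xor-true true = refl
  xor-true false = refl
lookup-flip-xor i k v | false = trans (lookup-flip-≢ i k v (λ { refl → true≢false (==ᶠ-refl i) e })) (sym (xor-identityʳ _))

vec-ext : {u v : Vert n} → (∀ i → lookup u i ≡ lookup v i) → u ≡ v
vec-ext {u = u} {v} h = trans (sym (tabulate∘lookup u)) (trans (tabulate-cong h) (tabulate∘lookup v))

xor-cancel : ∀ a b → (a xor b) xor b ≡ a
xor-cancel a b = trans (xor-assoc a b b) (trans (cong (a xor_) (xor-same b)) (xor-identityʳ a))

module Automorphism {n : ℕ} (π : Permutation′ n) (u : Vert n) where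

  -- Coordinates are permuted, then translated by u. Coordinate k of the image reads coordinate π k,
  -- so direction i moves to its inverse image under π.
  act unact : Vert n → Vert n
  act v = tabulate (λ k → lookup v (π ⟨$⟩ʳ k) xor lookup u k)
  unact v = tabulate (λ k → lookup v (π ⟨$⟩ˡ k) xor lookup u (π ⟨$⟩ˡ k))

  lookup-act : ∀ v k → lookup (act v) k ≡ lookup v (π ⟨$⟩ʳ k) xor lookup u k
  lookup-act v k = lookup∘tabulate _ k

  act-unact : ∀ v → act (unact v) ≡ v
  act-unact v = vec-ext λ k → trans (lookup-act (unact v) k) (trans (cong (_xor lookup u k)
    (trans (lookup∘tabulate _ (π ⟨$⟩ʳ k)) (cong₂ (λ a b → lookup v a xor lookup u b) (inverseˡ π) (inverseˡ π))))
    (xor-cancel (lookup v k) (lookup u k)))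

  unact-act : ∀ v → unact (act v) ≡ v
  unact-act v = vec-ext λ k → trans (lookup∘tabulate _ k) (trans (cong (_xor lookup u (π ⟨$⟩ˡ k))
    (trans (lookup-act v (π ⟨$⟩ˡ k)) (cong (λ a → lookup v a xor lookup u (π ⟨$⟩ˡ k)) (inverseʳ π))))
    (xor-cancel (lookup v k) (lookup u (π ⟨$⟩ˡ k))))

  act-flip : ∀ i v → act (flip i v) ≡ flip (π ⟨$⟩ˡ i) (act v)
  act-flip i v = vec-ext λ k → begin
    lookup (act (flip i v)) k                              ≡⟨ lookup-act (flip i v) k ⟩
    lookup (flip i v) (π ⟨$⟩ʳ k) xor lookup u k            ≡⟨ cong (_xor lookup u k) (lookup-flip-xor i (π ⟨$⟩ʳ k) v) ⟩
    (lookup v (π ⟨$⟩ʳ k) xor (i ==ᶠ (π ⟨$⟩ʳ k))) xor lookup u k ≡⟨ xor-swap (lookup v (π ⟨$⟩ʳ k)) _ _ ⟩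
    (lookup v (π ⟨$⟩ʳ k) xor lookup u k) xor (i ==ᶠ (π ⟨$⟩ʳ k)) ≡⟨ cong₂ _xor_ (sym (lookup-act v k)) (same k) ⟩
    lookup (act v) k xor ((π ⟨$⟩ˡ i) ==ᶠ k)                  ≡⟨ lookup-flip-xor (π ⟨$⟩ˡ i) k (act v) ⟨
    lookup (flip (π ⟨$⟩ˡ i) (act v)) k                     ∎
    where
    open ≡-Reasoning
    xor-swap : ∀ a b c → (a xor b) xor c ≡ (a xor c) xor b
    xor-swap true true true = refl
    xor-swap true true false = refl
    xor-swap true false true = refl
    xor-swap true false false = refl
    xor-swap false true true = refl
    xor-swap false true false = refl
    xor-swap false false true = refl
    xor-swap false false false = refl
    same : ∀ k → (i ==ᶠ (π ⟨$⟩ʳ k)) ≡ ((π ⟨$⟩ˡ i) ==ᶠ k)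
    same k with i ==ᶠ (π ⟨$⟩ʳ k) in e | (π ⟨$⟩ˡ i) ==ᶠ k in e'
    ... | true | true = refl
    ... | false | false = refl
    ... | true | false = ⊥-elim (true≢false (true-of (trans (cong (π ⟨$⟩ˡ_) (==ᶠ⇒≡ e)) (inverseˡ π))) e')
      where
      true-of : (π ⟨$⟩ˡ i) ≡ k → ((π ⟨$⟩ˡ i) ==ᶠ k) ≡ true
      true-of refl = ==ᶠ-refl _
    ... | false | true = ⊥-elim (true≢false (true-of (trans (sym (inverseʳ π)) (cong (π ⟨$⟩ʳ_) (==ᶠ⇒≡ e')))) e)
      where
      true-of : i ≡ (π ⟨$⟩ʳ k) → (i ==ᶠ (π ⟨$⟩ʳ k)) ≡ true
      true-of refl = ==ᶠ-refl _

  act-injective : ∀ {v w} → act v ≡ act w → v ≡ w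
  act-injective {v} {w} e = trans (sym (unact-act v)) (trans (cong unact e) (unact-act w))

  automorphism : CubeMap n n
  automorphism = record
    { onVert = act
    ; onDir = π ⟨$⟩ˡ_
    ; injective = act-injective
    ; onFlip = act-flip
    ; reflects = λ {a} {b} {j} e → π ⟨$⟩ʳ j , inverseˡ π ,
        act-injective (trans e (sym (trans (act-flip (π ⟨$⟩ʳ j) a) (cong (λ i → flip i (act a)) (inverseˡ π)))))
    }

  map-act-unact : ∀ w → map act (map unact w) ≡ w
  map-act-unact w = trans (sym (map-∘ w)) (trans (map-cong act-unact w) (map-id w))

-- The transposition takes direction i to j; the translation is the difference that remains between
-- the permuted x and y.
transitive : (e e' : Edge n) → e' ∈ cubeEdges n →
  ∃[ π ] ∃[ u ] (CubeMap.onEdge (Automorphism.automorphism π u) e ≡ e')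
transitive (x , i) (y , j) h = π , u , trans (cong₂ edgeAt act-x (transpose-i j)) (cong (_, j) (down≡ y j (∈-cubeEdges⁻ h)))
  where
  π = transpose i j
  u = tabulate (λ k → lookup y k xor lookup x (π ⟨$⟩ʳ k))
  open Automorphism π u
  xor-cancelˡ : ∀ a b → a xor (b xor a) ≡ b
  xor-cancelˡ true true = refl
  xor-cancelˡ true false = refl
  xor-cancelˡ false b = xor-identityʳ b
  act-x : act x ≡ y
  act-x = vec-ext λ k → trans (lookup-act x k) (trans (cong (lookup x (π ⟨$⟩ʳ k) xor_) (lookup∘tabulate _ k)) (xor-cancelˡ (lookup x (π ⟨$⟩ʳ k)) (lookup y k)))
  transpose-i : ∀ j → (transpose i j ⟨$⟩ˡ i) ≡ j
  transpose-i j with i Fin.≟ j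
  ... | yes refl = refl
  ... | no _ with i Fin.≟ i
  ... | yes _ = refl
  ... | no i≢i = ⊥-elim (i≢i refl)

-- From few edges to few cycles

module _ (n m : ℕ) where

  through : Edge n → List (List (Edge n))
  through e = filterᵇ (e ∈ᵉ_) (copies n m (cubeEdges n))

  -- Pulling back along an automorphism that takes e to e' injects the cycles through e' into those
  -- through e.
  through-≤ : ∀ e e' → e ∈ cubeEdges n → e' ∈ cubeEdges n → length (through e') ≤ length (through e)
  through-≤ e e' e∈ e'∈ with transitive e e' e'∈
  ... | π , u , eq = count-≤ {R = λ S T → S ⊆ cubeEdges n × (∃ λ w → IsCycle S w) × T ≡ pull S}
      (unique-filterᵇ (e' ∈ᵉ_) Q (unique-copies n m (cubeEdges n) ⊆-refl)) image inj
    where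
    open Automorphism π u
    open CubeMap automorphism
    Q = copies n m (cubeEdges n)
    rebase : ∀ {S w} → IsCycle S w → IsCycle S (map act (map unact w))
    rebase {S} {w} c = subst (IsCycle S) (sym (map-act-unact w)) c
    image : ∀ {S} → S ∈ through e' → ∃ λ T → T ∈ through e × S ⊆ cubeEdges n × (∃ λ w → IsCycle S w) × T ≡ pull S
    image {S} h with ∈-filterᵇ⁻ _ (copies n m (cubeEdges n)) h
    ... | S∈ , e'∈S with copies⁻ {m = m} ⊆-refl S∈
    ... | S⊆ , w , len , c = pull S , ∈-filterᵇ⁺ (e ∈ᵉ_) {Q}
            (copies⁺ (filterᵇ-⊆ (λ e → onEdge e ∈ᵉ S) (cubeEdges n)) (pull-isCycle {w = map unact w} (rebase c)) (trans (length-map unact w) len))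
            (∈⇒∈ᵉ (∈-pull⁺ e∈ (subst (_∈ S) (sym eq) (∈ᵉ⇒∈ S e'∈S)))) , S⊆ , (w , c) , refl
    inj : ∀ {S S' T} → S ∈ through e' → S' ∈ through e' →
      (S ⊆ cubeEdges n × (∃ λ w → IsCycle S w) × T ≡ pull S) → (S' ⊆ cubeEdges n × (∃ λ w → IsCycle S' w) × T ≡ pull S') → S ≡ S'
    inj _ _ (s , (w , c) , refl) (s' , (w' , c') , eq') = pull-injective {w = map unact w} {map unact w'} s s' (rebase c) (rebase c') eq'

  cycle-size : ∀ {S} → S ∈ copies n m (cubeEdges n) → ∑ (cubeEdges n) (λ e → ⟦ e ∈ᵉ S ⟧) ≤ m
  cycle-size {S} h with copies⁻ {m = m} ⊆-refl h
  ... | S⊆ , w , len , c = ≤-trans (≤-reflexive (sym (length-filterᵇ (_∈ᵉ S) (cubeEdges n))))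
      (≤-trans (count-≤ {R = λ e p → ∃ λ i → proj₂ p ≡ flip i (proj₁ p) × e ≡ edgeAt (proj₁ p) i}
        (unique-filterᵇ (_∈ᵉ S) (cubeEdges n) (unique-cubeEdges n)) image inj) (≤-reflexive (trans (length-cycPairs w) len)))
    where
    image : ∀ {e} → e ∈ filterᵇ (_∈ᵉ S) (cubeEdges n) → ∃ λ p → p ∈ cycPairs w × ∃ λ i → proj₂ p ≡ flip i (proj₁ p) × e ≡ edgeAt (proj₁ p) i
    image h with IsCycle.covered c (∈ᵉ⇒∈ S (proj₂ (∈-filterᵇ⁻ (_∈ᵉ S) (cubeEdges n) h)))
    ... | a , b , i , ab∈ , q , q' = (a , b) , ab∈ , i , q , q'
    inj : ∀ {e e' p} → e ∈ filterᵇ (_∈ᵉ S) (cubeEdges n) → e' ∈ filterᵇ (_∈ᵉ S) (cubeEdges n) →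
      (∃ λ i → proj₂ p ≡ flip i (proj₁ p) × e ≡ edgeAt (proj₁ p) i) → (∃ λ i → proj₂ p ≡ flip i (proj₁ p) × e' ≡ edgeAt (proj₁ p) i) → e ≡ e'
    inj {p = a , b} _ _ (i , q , refl) (j , q' , refl) with flip-direction i j a (trans (sym q) q')
    ... | refl = refl

  copies-mono : ∀ {G S} → G ⊆ cubeEdges n → S ∈ copies n m G → S ∈ copies n m (cubeEdges n)
  copies-mono G⊆ h with copies⁻ {m = m} G⊆ h
  ... | S⊆ , w , len , c = copies⁺ (⊆-trans S⊆ G⊆) c len

  cycle-nonempty : ∀ {S} → 1 ≤ m → S ∈ copies n m (cubeEdges n) → 1 ≤ length S
  cycle-nonempty 1≤m h with copies⁻ {m = m} ⊆-refl h
  ... | S⊆ , [] , len , c = ⊥-elim (1+n≰n (≤-trans 1≤m (≤-reflexive (sym len))))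
  ... | S⊆ , x ∷ w , len , c = from-member (proj₂ (first c))
    where
    from-member : ∀ {S : List (Edge n)} {e} → e ∈ S → 1 ≤ length S
    from-member (here _) = s≤s z≤n
    from-member (there _) = s≤s z≤n
    pair∈ : ∀ w → ∃ λ p → p ∈ consec (x ∷ w) x
    pair∈ [] = _ , here refl
    pair∈ (y ∷ w) = _ , here refl
    first : ∀ {S} → IsCycle S (x ∷ w) → ∃ λ e → e ∈ S
    first c with pair∈ w
    ... | (a , b) , h with IsCycle.steps c {a} {b} (subst ((a , b) ∈_) (sym (cycPairs-consec x w)) h)
    ... | i , _ , e∈ = edgeAt a i , e∈

  -- Each copy in G contains an edge of G, and all edges of the cube lie in the same number of
  -- copies, so N(G) is at most |G| times that number. Counting incidences in the cube bounds that
  -- number times |E| by m N(Q_n).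
  averaging : 1 ≤ m → ∀ {G} → G ⊆ cubeEdges n →
    N n m G * length (cubeEdges n) ≤ length G * (m * N n m (cubeEdges n))
  averaging 1≤m {G} G⊆ = begin
    N n m G * length E                    ≡⟨ *-comm (N n m G) _ ⟩
    length E * N n m G                    ≡⟨ ∑-const E _ ⟨
    ∑ E (λ _ → N n m G)                   ≤⟨ ∑-mono-∈ E per-edge ⟩
    ∑ E (λ e → length G * length (through e)) ≡⟨ ∑-*ˡ E (length G) _ ⟩
    length G * ∑ E (λ e → length (through e)) ≡⟨ cong (length G *_) (∑-cong E (λ e → length-filterᵇ (e ∈ᵉ_) Q)) ⟩
    length G * ∑ E (λ e → ∑ Q (λ S → ⟦ e ∈ᵉ S ⟧)) ≡⟨ cong (length G *_) (∑-swap E Q _) ⟩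
    length G * ∑ Q (λ S → ∑ E (λ e → ⟦ e ∈ᵉ S ⟧)) ≤⟨ *-monoʳ-≤ (length G) (∑-mono-∈ Q cycle-size) ⟩
    length G * ∑ Q (λ S → m)              ≡⟨ cong (length G *_) (trans (∑-const Q m) (*-comm _ m)) ⟩
    length G * (m * N n m E)              ∎
    where
    open ≤-Reasoning
    E = cubeEdges n
    Q = copies n m E
    per-edge : ∀ {e} → e ∈ E → N n m G ≤ length G * length (through e)
    per-edge {e} e∈ = begin
      N n m G                                       ≡⟨ trans (∑-const (copies n m G) 1) (*-identityʳ _) ⟨
      ∑ (copies n m G) (λ _ → 1)
        ≤⟨ ∑-mono-∈ (copies n m G) (λ {S} S∈ → ≤-trans (cycle-nonempty 1≤m (copies-mono G⊆ S∈)) (⊆-count (proj₁ (copies⁻ {m = m} G⊆ S∈)) (λ h → h))) ⟩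
      ∑ (copies n m G) (λ S → ∑ G (λ f → ⟦ f ∈ᵉ S ⟧)) ≡⟨ ∑-swap (copies n m G) G _ ⟩
      ∑ G (λ f → ∑ (copies n m G) (λ S → ⟦ f ∈ᵉ S ⟧)) ≤⟨ ∑-mono-∈ G (λ f∈ → at-most _ (⊆-∈ G⊆ f∈)) ⟩
      ∑ G (λ f → length (through e))                ≡⟨ ∑-const G _ ⟩
      length G * length (through e)                 ∎
      where
      at-most : ∀ f → f ∈ E → ∑ (copies n m G) (λ S → ⟦ f ∈ᵉ S ⟧) ≤ length (through e)
      at-most f f∈ = begin
        ∑ (copies n m G) (λ S → ⟦ f ∈ᵉ S ⟧)       ≡⟨ length-filterᵇ (f ∈ᵉ_) (copies n m G) ⟨
        length (filterᵇ (f ∈ᵉ_) (copies n m G))    ≤⟨ count-≤ {R = _≡_} (unique-filterᵇ (f ∈ᵉ_) (copies n m G) (unique-copies n m G G⊆)) incl (λ { _ _ refl refl → refl }) ⟩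
        length (through f)                         ≤⟨ through-≤ e f e∈ f∈ ⟩
        length (through e)                         ∎
        where
        incl : ∀ {S} → S ∈ filterᵇ (f ∈ᵉ_) (copies n m G) → ∃ λ T → T ∈ through f × S ≡ T
        incl {S} h with ∈-filterᵇ⁻ (f ∈ᵉ_) (copies n m G) h
        ... | S∈ , q = S , ∈-filterᵇ⁺ (f ∈ᵉ_) {Q} (copies-mono G⊆ S∈) q , refl

length-cubeEdges : (n : ℕ) → 2 * length (cubeEdges n) ≡ n * 2 ^ n
length-cubeEdges n = begin
  2 * length (cubeEdges n)              ≡⟨ cong (2 *_) (trans (sym (*-identityʳ (length (cubeEdges n)))) (sym (∑-const (cubeEdges n) 1))) ⟩
  2 * ∑ (cubeEdges n) (λ _ → 1)         ≡⟨ cong (2 *_) (trans (∑-cubeEdges n (λ _ → 1)) (∑-swap V (allFin n) _)) ⟩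
  2 * ∑F n (λ i → ∑ V (λ v → ⟦ not (lookup v i) ⟧ * 1)) ≡⟨ ∑-*ˡ (allFin n) 2 _ ⟨
  ∑F n (λ i → 2 * ∑ V (λ v → ⟦ not (lookup v i) ⟧ * 1)) ≡⟨ ∑-cong (allFin n) half ⟩
  ∑F n (λ i → 2 ^ n)                    ≡⟨ ∑F-const n (2 ^ n) ⟩
  n * 2 ^ n                             ∎
  where
  open ≡-Reasoning
  V = allVerts n
  f : Fin n → Vert n → ℕ
  f i v = ⟦ not (lookup v i) ⟧ * 1
  pair : ∀ b c → c ≡ not b → ⟦ not b ⟧ * 1 + ⟦ not c ⟧ * 1 ≡ 1
  pair true false refl = refl
  pair false true refl = refl
  half : ∀ i → 2 * ∑ V (f i) ≡ 2 ^ n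
  half i = begin
    2 * ∑ V (f i) ≡⟨ cong (∑ V (f i) +_) (+-identityʳ _) ⟩
    ∑ V (f i) + ∑ V (f i) ≡⟨ cong (∑ V (f i) +_) (∑-flip i (f i)) ⟩
    ∑ V (f i) + ∑ V (λ v → f i (flip i v)) ≡⟨ ∑-+ V _ _ ⟨
    ∑ V (λ v → f i v + f i (flip i v)) ≡⟨ ∑-cong V (λ v → pair (lookup v i) _ (lookup-flip i v)) ⟩
    ∑ V (λ _ → 1) ≡⟨ trans (∑-const V 1) (trans (*-identityʳ _) (length-allVerts n)) ⟩
    2 ^ n ∎

-- Subcubes

data Sub : ℕ → ℕ → Set where
  []   : Sub 0 0
  fix  : ∀ {n j} → Bool → Sub n j → Sub (suc n) j
  free : ∀ {n j} → Sub n j → Sub (suc n) (suc j)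

embed : ∀ {n j} → Sub n j → Vert j → Vert n
embed [] v = []
embed (fix c s) v = c ∷ embed s v
embed (free s) (b ∷ v) = b ∷ embed s v

embedDir : ∀ {n j} → Sub n j → Fin j → Fin n
embedDir (fix c s) i = suc (embedDir s i)
embedDir (free s) zero = zero
embedDir (free s) (suc i) = suc (embedDir s i)

project : ∀ {n j} → Sub n j → Vert n → Vert j
project [] v = []
project (fix c s) (b ∷ v) = project s v
project (free s) (b ∷ v) = b ∷ project s v

project-embed : ∀ {n j} (s : Sub n j) v → project s (embed s v) ≡ v
project-embed [] [] = refl
project-embed (fix c s) v = project-embed s v
project-embed (free s) (b ∷ v) = cong (b ∷_) (project-embed s v)

embed-injective : ∀ {n j} (s : Sub n j) {u v} → embed s u ≡ embed s v → u ≡ v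
embed-injective s {u} {v} e = trans (sym (project-embed s u)) (trans (cong (project s) e) (project-embed s v))

subMap : ∀ {n j} → Sub n j → CubeMap j n
subMap s = record { onVert = embed s ; onDir = embedDir s ; injective = embed-injective s
                  ; onFlip = embed-flip s ; reflects = λ {a} {b} {j} → reflects s {a} {b} {j} }
  where
  embed-flip : ∀ {n j} (s : Sub n j) i v → embed s (flip i v) ≡ flip (embedDir s i) (embed s v)
  embed-flip (fix c s) i v = cong (c ∷_) (embed-flip s i v)
  embed-flip (free s) zero (b ∷ v) = refl
  embed-flip (free s) (suc i) (b ∷ v) = cong (b ∷_) (embed-flip s i v)
  reflects : ∀ {n j} (s : Sub n j) {a b k} → embed s b ≡ flip k (embed s a) → ∃ λ i → embedDir s i ≡ k × b ≡ flip i a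
  reflects (fix true s) {k = zero} ()
  reflects (fix false s) {k = zero} ()
  reflects (fix c s) {k = suc k} e with reflects s (cong tail e)
  ... | i , p , q = i , cong suc p , q
  reflects (free s) {α ∷ a} {β ∷ b} {zero} e = zero , refl , cong₂ _∷_ (cong head e) (embed-injective s (cong tail e))
  reflects (free s) {α ∷ a} {β ∷ b} {suc k} e with reflects s (cong tail e)
  ... | i , p , q = suc i , cong suc p , cong₂ _∷_ (cong head e) q

frees : (n j : ℕ) → List (Sub (suc n) j)
allSub : (n j : ℕ) → List (Sub n j)
frees n zero = []
frees n (suc j) = map free (allSub n j)
allSub zero zero = [] ∷ []
allSub zero (suc j) = []
allSub (suc n) j = map (fix false) (allSub n j) ++ map (fix true) (allSub n j) ++ frees n j

∈-allSub : ∀ {n j} (s : Sub n j) → s ∈ allSub n j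
∈-allSub [] = here refl
∈-allSub (fix false s) = ∈-++⁺ˡ (∈-map⁺ (fix false) (∈-allSub s))
∈-allSub {suc n} {j} (fix true s) = ∈-++⁺ʳ (map (fix false) (allSub n j)) (∈-++⁺ˡ (∈-map⁺ (fix true) (∈-allSub s)))
∈-allSub {suc n} {suc j} (free s) = ∈-++⁺ʳ (map (fix false) (allSub n (suc j))) (∈-++⁺ʳ (map (fix true) (allSub n (suc j))) (∈-map⁺ free (∈-allSub s)))

-- There are n C j choices of the free coordinates and 2^(n-j) of the fixed bits; the factor 2^j
-- avoids the subtraction. The recursion is Pascal's rule.
length-allSub : ∀ n j → length (allSub n j) * 2 ^ j ≡ (n C j) * 2 ^ n
length-allSub zero zero = refl
length-allSub zero (suc j) = sym (cong (_* 1) (k>n⇒nCk≡0 {0} {suc j} (s≤s z≤n)))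
length-allSub (suc n) j = begin
  length (allSub (suc n) j) * 2 ^ j ≡⟨ cong (_* 2 ^ j) count ⟩
  (a + (a + length (frees n j))) * 2 ^ j ≡⟨ lemma a (length (frees n j)) (2 ^ j) ⟩
  2 * (a * 2 ^ j) + length (frees n j) * 2 ^ j ≡⟨ cong (λ x → 2 * x + length (frees n j) * 2 ^ j) (length-allSub n j) ⟩
  2 * ((n C j) * 2 ^ n) + length (frees n j) * 2 ^ j ≡⟨ pascal j ⟩
  (suc n C j) * 2 ^ suc n ∎
  where
  open ≡-Reasoning
  a = length (allSub n j)
  lemma : ∀ a f p → (a + (a + f)) * p ≡ 2 * (a * p) + f * p
  lemma = solve-∀
  count : length (allSub (suc n) j) ≡ a + (a + length (frees n j))
  count = trans (length-++ (map (fix false) (allSub n j))) (cong₂ _+_ (length-map (fix false) (allSub n j))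
    (trans (length-++ (map (fix true) (allSub n j))) (cong (_+ length (frees n j)) (length-map (fix true) (allSub n j)))))
  pascal : ∀ j → 2 * ((n C j) * 2 ^ n) + length (frees n j) * 2 ^ j ≡ (suc n C j) * 2 ^ suc n
  pascal zero = lemma₂ (2 ^ n)
    where
    lemma₂ : ∀ p → 2 * (1 * p) + 0 ≡ 1 * (2 * p)
    lemma₂ = solve-∀
  pascal (suc j) = begin
    2 * ((n C suc j) * 2 ^ n) + length (map free (allSub n j)) * (2 * 2 ^ j) ≡⟨ cong (λ x → 2 * ((n C suc j) * 2 ^ n) + x * (2 * 2 ^ j)) (length-map free (allSub n j)) ⟩
    2 * ((n C suc j) * 2 ^ n) + length (allSub n j) * (2 * 2 ^ j) ≡⟨ lemma₃ (n C suc j) (2 ^ n) (length (allSub n j)) (2 ^ j) ⟩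
    2 * ((n C suc j) * 2 ^ n + length (allSub n j) * 2 ^ j) ≡⟨ cong (λ x → 2 * ((n C suc j) * 2 ^ n + x)) (length-allSub n j) ⟩
    2 * ((n C suc j) * 2 ^ n + (n C j) * 2 ^ n) ≡⟨ lemma₄ (n C suc j) (n C j) (2 ^ n) ⟩
    ((n C j) + (n C suc j)) * (2 * 2 ^ n) ≡⟨ cong (_* (2 * 2 ^ n)) (nCk+nC[k+1]≡[n+1]C[k+1] n j) ⟩
    (suc n C suc j) * 2 ^ suc n ∎
    where
    lemma₃ : ∀ c p a q → 2 * (c * p) + a * (2 * q) ≡ 2 * (c * p + a * q)
    lemma₃ = solve-∀
    lemma₄ : ∀ c d p → 2 * (c * p + d * p) ≡ (d + c) * (2 * p)
    lemma₄ = solve-∀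

_lies-in_ : ∀ {n j} → Vert n → Sub n j → Set
v lies-in s = embed s (project s v) ≡ v

enlarge₁ : ∀ {n j} (s : Sub n j) → j < n → ∃ λ (s' : Sub n (suc j)) → ∀ v → v lies-in s → v lies-in s'
enlarge₁ (fix c s) lt = free s , λ { (b ∷ v) e → cong (b ∷_) (cong tail e) }
enlarge₁ (free s) (s≤s lt) with enlarge₁ s lt
... | s' , f = free s' , λ { (b ∷ v) e → cong (b ∷_) (f v (cong tail e)) }

-- Pads the subcube spanned by a cycle to a prescribed dimension, so that all cycles spanning fewer
-- than ℓ dimensions are counted in one family.
enlarge : ∀ {n j} (s : Sub n j) k → j + k ≤ n → ∃ λ (s' : Sub n (j + k)) → ∀ v → v lies-in s → v lies-in s'
enlarge {n} {j} s zero h = subst (λ x → ∃ λ (s' : Sub n x) → ∀ v → v lies-in s → v lies-in s') (sym (+-identityʳ j)) (s , λ _ e → e)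
enlarge {n} {j} s (suc k) h with enlarge₁ s (≤-trans (s≤s (m≤m+n j k)) (≤-trans (≤-reflexive (sym (+-suc j k))) h))
... | s₁ , f₁ with enlarge s₁ k (≤-trans (≤-reflexive (sym (+-suc j k))) h)
... | s₂ , f₂ = subst (λ x → ∃ λ (s' : Sub n x) → ∀ v → v lies-in s → v lies-in s') (sym (+-suc j k)) (s₂ , λ v e → f₂ v (f₁ v e))

-- The smallest subcube around w: a coordinate is free exactly if w takes both values there. The
-- last component keeps these two witnesses, which force a cycle to flip every free direction.
hull : (w : List (Vert n)) → ∃[ j ] ∃ λ (s : Sub n j) → (∀ {v} → v ∈ w → v lies-in s) ×
  (∀ i β → ∃ λ v → v ∈ w × lookup (project s v) i ≡ β)
hull {zero} w = 0 , [] , (λ { {[]} _ → refl }) , λ ()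
hull {suc n} w with hull (map tail w)
... | j , s , inside , varies = choose (any (λ v → isEq true (head v)) w) refl (any (λ v → isEq false (head v)) w) refl
  where
  isEq : Bool → Bool → Bool
  isEq true b = b
  isEq false b = not b
  isEq⇒ : ∀ β b → isEq β b ≡ true → b ≡ β
  isEq⇒ true b e = e
  isEq⇒ false b e = not-true e
  lift : ∀ i β → ∃ λ v → v ∈ w × lookup (project s (tail v)) i ≡ β
  lift i β with varies i β
  ... | u , u∈ , e with ∈-map⁻ tail u∈
  ... | v , v∈ , refl = v , v∈ , e
  Result : Set
  Result = ∃[ j ] ∃ λ (s : Sub (suc n) j) → (∀ {v} → v ∈ w → v lies-in s) ×
    (∀ i β → ∃ λ v → v ∈ w × lookup (project s v) i ≡ β)
  constant : ∀ β → (∀ {v} → v ∈ w → head v ≡ β) → Result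
  constant β h = j , fix β s , (λ { {b ∷ v} v∈ → cong₂ _∷_ (sym (h v∈)) (inside (∈-map⁺ tail v∈)) }) , varies'
    where
    varies' : ∀ i β' → ∃ λ v → v ∈ w × lookup (project (fix β s) v) i ≡ β'
    varies' i β' with lift i β'
    ... | (b ∷ v) , v∈ , e = (b ∷ v) , v∈ , e
  head≢ : ∀ β {v} → any (λ v → isEq β (head v)) w ≡ false → v ∈ w → head v ≡ not β
  head≢ true {true ∷ v} e v∈ = ⊥-elim (true≢false (true-any _ v∈ refl) e)
  head≢ true {false ∷ v} e v∈ = refl
  head≢ false {true ∷ v} e v∈ = refl
  head≢ false {false ∷ v} e v∈ = ⊥-elim (true≢false (true-any _ v∈ refl) e)
  choose : ∀ t → any (λ v → isEq true (head v)) w ≡ t → ∀ f → any (λ v → isEq false (head v)) w ≡ f → Result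
  choose false et f ef = constant false (head≢ true et)
  choose true et false ef = constant true (head≢ false ef)
  choose true et true ef = suc j , free s , (λ { {b ∷ v} v∈ → cong (b ∷_) (inside (∈-map⁺ tail v∈)) }) , varies'
    where
    varies' : ∀ i β → ∃ λ v → v ∈ w × lookup (project (free s) v) i ≡ β
    varies' zero true with any-true _ w et
    ... | (b ∷ v) , v∈ , e = (b ∷ v) , v∈ , isEq⇒ true b e
    varies' zero false with any-true _ w ef
    ... | (b ∷ v) , v∈ , e = (b ∷ v) , v∈ , isEq⇒ false b e
    varies' (suc i) β with lift i β
    ... | (b ∷ v) , v∈ , e = (b ∷ v) , v∈ , e

module _ (X : A → Set) where

  consec-end : ∀ l {x u} → (∀ {a b} → (a , b) ∈ consec l x → X a → X b) → u ∈ l → X u → X x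
  consec-end (a ∷ []) c (here refl) h = c (here refl) h
  consec-end (a ∷ b ∷ r) c (here refl) h = consec-end (b ∷ r) (λ q → c (there q)) (here refl) (c (here refl) h)
  consec-end (a ∷ b ∷ r) c (there u∈) h = consec-end (b ∷ r) (λ q → c (there q)) u∈ h

  consec-start : ∀ a r {x v} → (∀ {u u'} → (u , u') ∈ consec (a ∷ r) x → X u → X u') → X a → v ∈ a ∷ r → X v
  consec-start a r c h (here e) = subst X (sym e) h
  consec-start a (b ∷ r) {x} c h (there v∈) = consec-start b r {x} (λ q → c (there q)) (c (here refl) h) v∈

  -- Induction around a cycle: from u forward to the end of the list, hence to its head, and from
  -- the head to every entry.
  cyclic-closed : ∀ w {u v} → (∀ {a b} → (a , b) ∈ cycPairs w → X a → X b) → u ∈ w → X u → v ∈ w → X v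
  cyclic-closed (x ∷ w) {u} {v} c u∈ h v∈ = consec-start x w {x} c' (consec-end (x ∷ w) {x} c' u∈ h) v∈
    where
    c' : ∀ {a b} → (a , b) ∈ consec (x ∷ w) x → X a → X b
    c' {a} {b} q = c (subst ((a , b) ∈_) (sym (cycPairs-consec x w)) q)

-- If no step left the value β, it would spread around the whole cycle, against the occurrence of
-- the other value.
cyclic-change : (P : A → Bool) (w : List A) (β : Bool) → (∀ γ → ∃ λ v → v ∈ w × P v ≡ γ) →
  ∃[ a ] ∃[ b ] ((a , b) ∈ cycPairs w × P a ≡ β × P b ≢ β)
cyclic-change P w β both with any (λ p → not (P (proj₁ p) xor β) ∧ (P (proj₂ p) xor β)) (cycPairs w) in e
... | true with any-true _ (cycPairs w) e
... | (a , b) , ab∈ , q with ∧-true {not (P a xor β)} q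
... | q₁ , q₂ = a , b , ab∈ , same (P a) β q₁ , differ (P b) β q₂
  where
  same : ∀ x y → not (x xor y) ≡ true → x ≡ y
  same true true _ = refl
  same false false _ = refl
  differ : ∀ x y → x xor y ≡ true → x ≢ y
  differ true true ()
  differ false false ()
  differ true false _ ()
  differ false true _ ()
cyclic-change P w β both | false with both β | both (not β)
... | u , u∈ , hu | v , v∈ , hv = ⊥-elim (not-≢ β (trans (sym (cyclic-closed (λ a → P a ≡ β) w closed u∈ hu v∈)) hv))
  where
  test : ∀ x y z → x ≡ z → not (x xor z) ∧ (y xor z) ≡ false → y ≡ z
  test true true true _ _ = refl
  test false false false _ _ = refl
  test true false .true refl ()
  test false true .false refl ()
  closed : ∀ {a b} → (a , b) ∈ cycPairs w → P a ≡ β → P b ≡ β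
  closed {a} {b} ab∈ h = test (P a) (P b) β h (≢true⇒false λ t → true≢false (true-any (λ p → not (P (proj₁ p) xor β) ∧ (P (proj₂ p) xor β)) ab∈ t) e)

length-cartesianProduct : (xs : List A) (ys : List B) → length (cartesianProduct xs ys) ≡ length xs * length ys
length-cartesianProduct [] ys = refl
length-cartesianProduct (x ∷ xs) ys = trans (length-++ (map (x ,_) ys)) (cong₂ _+_ (length-map (x ,_) ys) (length-cartesianProduct xs ys))

cycle-flips : ∀ {j} {S : List (Edge j)} {w} → IsCycle S w → (∀ i β → ∃ λ v → v ∈ w × lookup v i ≡ β) →
  ∀ i β → ∃[ a ] ((a , flip i a) ∈ cycPairs w × lookup a i ≡ β × edgeAt a i ∈ S)
cycle-flips {S = S} {w} c varies i β with cyclic-change (λ v → lookup v i) w β (varies i)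
... | a , b , ab∈ , ha , hb with IsCycle.steps c ab∈
... | k , refl , e∈ with i Fin.≟ k
... | yes refl = a , ab∈ , ha , e∈
... | no i≢k = ⊥-elim (hb (trans (lookup-flip-≢ k i a i≢k) ha))

-- A closed walk that varies in direction i flips it both ways, so the 2j pairs of a direction and a
-- starting value belong to different steps.
cycle-dimension : ∀ {j} {S : List (Edge j)} {w} → IsCycle S w → (∀ i β → ∃ λ v → v ∈ w × lookup v i ≡ β) → 2 * j ≤ length w
cycle-dimension {j} {S} {w} c varies = ≤-trans (≤-reflexive (trans (*-comm 2 j) (sym size)))
  (≤-trans (count-≤ {R = λ x p → proj₂ p ≡ flip (proj₁ x) (proj₁ p) × lookup (proj₁ p) (proj₁ x) ≡ proj₂ x} unique-xs image inj) (≤-reflexive (length-cycPairs w)))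
  where
  bools : List Bool
  bools = true ∷ false ∷ []
  xs = cartesianProduct (allFin j) bools
  size : length xs ≡ j * 2
  size = trans (length-cartesianProduct (allFin j) bools) (cong (_* 2) (length-allFin j))
  unique-xs : Unique xs
  unique-xs = Uniqueₚ.cartesianProduct⁺ (Uniqueₚ.allFin⁺ j) (((λ ()) ∷ []) ∷ [] ∷ [])
  image : ∀ {x} → x ∈ xs → ∃ λ p → p ∈ cycPairs w × proj₂ p ≡ flip (proj₁ x) (proj₁ p) × lookup (proj₁ p) (proj₁ x) ≡ proj₂ x
  image {i , β} _ with cycle-flips c varies i β
  ... | a , p∈ , e , _ = (a , flip i a) , p∈ , refl , e
  inj : ∀ {x x' p} → x ∈ xs → x' ∈ xs → proj₂ p ≡ flip (proj₁ x) (proj₁ p) × lookup (proj₁ p) (proj₁ x) ≡ proj₂ x →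
    proj₂ p ≡ flip (proj₁ x') (proj₁ p) × lookup (proj₁ p) (proj₁ x') ≡ proj₂ x' → x ≡ x'
  inj {i , β} {i' , β'} {a , b} _ _ (p , q) (p' , q') with flip-direction i i' a (trans (sym p) p')
  ... | refl = cong (i ,_) (trans (sym q) q')

-- A cycle is coded by a subcube and its preimage there. If it spans l + 1 dimensions it uses every
-- direction of that subcube, as `z` demands; if it spans fewer, the subcube is padded to dimension
-- l. More is excluded by `cycle-dimension`.
cycle-count : ∀ l → l ≤ n → N n (2 * suc l) (cubeEdges n) ≤
  length (allSub n (suc l)) * z (suc l) (suc l) + length (allSub n l) * N l (2 * suc l) (cubeEdges l)
cycle-count {n} l l≤n = ≤-trans (count-≤ {R = R} (unique-copies n m (cubeEdges n) ⊆-refl) image (λ {_} {_} {y} → inj {y = y})) (≤-reflexive size)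
  where
  m = 2 * suc l
  full : List (List (Edge (suc l)))
  full = filterᵇ (λ S → all (λ i → any (λ e → proj₂ e ==ᶠ i) S) (allFin (suc l))) (copies (suc l) m (cubeEdges (suc l)))
  small : List (List (Edge l))
  small = copies l m (cubeEdges l)
  Y₁ = cartesianProduct (allSub n (suc l)) full
  Y₂ = cartesianProduct (allSub n l) small
  Code : Set
  Code = (Sub n (suc l) × List (Edge (suc l))) ⊎ (Sub n l × List (Edge l))
  ys : List Code
  ys = map inj₁ Y₁ ++ map inj₂ Y₂
  size : length ys ≡ length (allSub n (suc l)) * z (suc l) (suc l) + length (allSub n l) * N l m (cubeEdges l)
  size = trans (length-++ (map inj₁ Y₁)) (cong₂ _+_ (trans (length-map inj₁ Y₁) (length-cartesianProduct (allSub n (suc l)) full))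
    (trans (length-map inj₂ Y₂) (length-cartesianProduct (allSub n l) small)))
  -- The middle condition places S inside the subcube, so that its preimage determines it.
  Encodes : ∀ {j} → List (Edge n) → Sub n j → List (Edge j) → Set
  Encodes S s T = S ⊆ cubeEdges n × (∃ λ w → IsCycle S (map (embed s) w)) × T ≡ CubeMap.pull (subMap s) S
  R : List (Edge n) → Code → Set
  R S (inj₁ (s , T)) = Encodes S s T
  R S (inj₂ (s , T)) = Encodes S s T
  encodes-inj : ∀ {j S S' T} {s : Sub n j} → Encodes S s T → Encodes S' s T → S ≡ S'
  encodes-inj {s = s} (p , (w , c) , refl) (p' , (w' , c') , e) = CubeMap.pull-injective (subMap s) {w = w} {w'} p p' c c' e
  inj : ∀ {S S' y} → S ∈ copies n m (cubeEdges n) → S' ∈ copies n m (cubeEdges n) → R S y → R S' y → S ≡ S'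
  inj {y = inj₁ (s , T)} _ _ r r' = encodes-inj {s = s} r r'
  inj {y = inj₂ (s , T)} _ _ r r' = encodes-inj {s = s} r r'
  image : ∀ {S} → S ∈ copies n m (cubeEdges n) → ∃ λ y → y ∈ ys × R S y
  image {S} h with copies⁻ {m = m} ⊆-refl h
  ... | S⊆ , w , len , c with hull w
  ... | j , s , inside , varies = classify (m≤n⇒m<n∨m≡n j≤)
    where
    rebase : ∀ {k} (s : Sub n k) → (∀ {v} → v ∈ w → v lies-in s) → IsCycle S (map (embed s) (map (project s) w))
    rebase s ins = subst (IsCycle S) (sym (fixed w ins)) c
      where
      fixed : ∀ u → (∀ {v} → v ∈ u → v lies-in s) → map (embed s) (map (project s) u) ≡ u
      fixed [] h = refl
      fixed (v ∷ u) h = cong₂ _∷_ (h (here refl)) (fixed u (λ q → h (there q)))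
    pulled : ∀ {k} (s : Sub n k) → (∀ {v} → v ∈ w → v lies-in s) → IsCycle (CubeMap.pull (subMap s) S) (map (project s) w)
    pulled s ins = CubeMap.pull-isCycle (subMap s) {w = map (project s) w} (rebase s ins)
    isCopy : ∀ {k} (s : Sub n k) → (∀ {v} → v ∈ w → v lies-in s) → CubeMap.pull (subMap s) S ∈ copies k m (cubeEdges k)
    isCopy {k} s ins = copies⁺ (filterᵇ-⊆ (λ e → CubeMap.onEdge (subMap s) e ∈ᵉ S) (cubeEdges k)) (pulled s ins) (trans (length-map (project s) w) len)
    varies' : ∀ i β → ∃ λ v → v ∈ map (project s) w × lookup v i ≡ β
    varies' i β with varies i β
    ... | v , v∈ , e = project s v , ∈-map⁺ (project s) v∈ , e
    j≤ : j ≤ suc l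
    j≤ = *-cancelˡ-≤ 2 (≤-trans (cycle-dimension (pulled s inside) varies') (≤-reflexive (trans (length-map (project s) w) len)))
    classify : j < suc l ⊎ j ≡ suc l → ∃ λ y → y ∈ ys × R S y
    classify (inj₂ refl) = inj₁ (s , CubeMap.pull (subMap s) S) ,
      ∈-++⁺ˡ (∈-map⁺ inj₁ (∈-cartesianProduct⁺ (∈-allSub s) (∈-filterᵇ⁺ _ (isCopy s inside) (true-all _ (allFin (suc l)) (λ {i} _ → uses i))))) ,
      S⊆ , (map (project s) w , rebase s inside) , refl
      where
      uses : ∀ i → any (λ e → proj₂ e ==ᶠ i) (CubeMap.pull (subMap s) S) ≡ true
      uses i with cycle-flips (pulled s inside) varies' i true
      ... | a , _ , _ , e∈ = true-any (λ e → proj₂ e ==ᶠ i) e∈ (==ᶠ-refl i)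
    classify (inj₁ (s≤s j≤l)) with m≤n⇒∃[o]m+o≡n j≤l
    ... | k , refl with enlarge s k l≤n
    ... | s' , bigger = inj₂ (s' , CubeMap.pull (subMap s') S) ,
      ∈-++⁺ʳ (map inj₁ Y₁) (∈-map⁺ inj₂ (∈-cartesianProduct⁺ (∈-allSub s') (isCopy s' inside'))) ,
      S⊆ , (map (project s') w , rebase s' inside') , refl
      where
      inside' : ∀ {v} → v ∈ w → v lies-in s'
      inside' v∈ = bigger _ (inside v∈)

-- Disjoint cycles

consec-fst : ∀ {a b : A} l x → (a , b) ∈ consec l x → a ∈ l
consec-fst (a ∷ []) x (here refl) = here refl
consec-fst (a ∷ b ∷ r) x (here refl) = here refl
consec-fst (a ∷ b ∷ r) x (there h) = there (consec-fst (b ∷ r) x h)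

consec-snd : ∀ {a b c : A} r x → (a , b) ∈ consec (c ∷ r) x → b ≡ x ⊎ b ∈ r
consec-snd [] x (here refl) = inj₁ refl
consec-snd (b ∷ r) x (here refl) = inj₂ (here refl)
consec-snd (b ∷ r) x (there h) with consec-snd r x h
... | inj₁ e = inj₁ e
... | inj₂ e = inj₂ (there e)

consec-functional : ∀ {a b b' : A} l x → Unique l → (a , b) ∈ consec l x → (a , b') ∈ consec l x → b ≡ b'
consec-functional (a ∷ []) x u (here refl) (here refl) = refl
consec-functional (a ∷ b ∷ r) x u (here refl) (here refl) = refl
consec-functional (a ∷ b ∷ r) x u (here refl) (there h) = ⊥-elim (unique-head u (consec-fst (b ∷ r) x h))
consec-functional (a ∷ b ∷ r) x u (there h) (here refl) = ⊥-elim (unique-head u (consec-fst (b ∷ r) x h))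
consec-functional (a ∷ b ∷ r) x u (there h) (there h') = consec-functional (b ∷ r) x (unique-tail u) h h'

-- The successors occurring here are the entries of r and then x, so they are pairwise distinct.
consec-injective : ∀ {a a' b c : A} r x → Unique r → x ∉ r → (a , b) ∈ consec (c ∷ r) x → (a' , b) ∈ consec (c ∷ r) x → a ≡ a'
consec-injective [] x u n (here refl) (here refl) = refl
consec-injective (b ∷ r) x u n (here refl) (here refl) = refl
consec-injective (b ∷ r) x u n (here refl) (there h) with consec-snd r x h
... | inj₁ refl = ⊥-elim (n (here refl))
... | inj₂ h' = ⊥-elim (unique-head u h')
consec-injective (b ∷ r) x u n (there h) (here refl) with consec-snd r x h
... | inj₁ refl = ⊥-elim (n (here refl))
... | inj₂ h' = ⊥-elim (unique-head u h')
consec-injective (b ∷ r) x u n (there h) (there h') = consec-injective r x (unique-tail u) (λ q → n (there q)) h h'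

consec-next : ∀ {a : A} l x → a ∈ l → ∃ λ b → (a , b) ∈ consec l x
consec-next (a ∷ []) x (here refl) = x , here refl
consec-next (a ∷ b ∷ r) x (here refl) = b , here refl
consec-next (a ∷ b ∷ r) x (there h) with consec-next (b ∷ r) x h
... | c , q = c , there q

consec-last : ∀ (c : A) r x → ∃ λ a → (a , x) ∈ consec (c ∷ r) x
consec-last c [] x = c , here refl
consec-last c (b ∷ r) x with consec-last b r x
... | a , q = a , there q

consec-prev : ∀ {b : A} c r x → b ∈ r → ∃ λ a → (a , b) ∈ consec (c ∷ r) x
consec-prev c (b ∷ r) x (here refl) = c , here refl
consec-prev c (b ∷ r) x (there h) with consec-prev b r x h
... | a , q = a , there q

to-consec : {p : A × A} {x : A} {l : List A} → p ∈ cycPairs (x ∷ l) → p ∈ consec (x ∷ l) x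
to-consec {x = x} {l} = subst (_ ∈_) (cycPairs-consec x l)

from-consec : {p : A × A} {x : A} {l : List A} → p ∈ consec (x ∷ l) x → p ∈ cycPairs (x ∷ l)
from-consec {x = x} {l} = subst (_ ∈_) (sym (cycPairs-consec x l))

cycPairs-fst : ∀ {w} {a b : A} → (a , b) ∈ cycPairs w → a ∈ w
cycPairs-fst {w = x ∷ w} h = consec-fst (x ∷ w) x (to-consec h)

cycPairs-snd : ∀ {w} {a b : A} → (a , b) ∈ cycPairs w → b ∈ w
cycPairs-snd {w = x ∷ w} h with consec-snd w x (to-consec h)
... | inj₁ refl = here refl
... | inj₂ q = there q

cycPairs-functional : ∀ {w} {a b b' : A} → Unique w → (a , b) ∈ cycPairs w → (a , b') ∈ cycPairs w → b ≡ b'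
cycPairs-functional {w = x ∷ w} u h h' = consec-functional (x ∷ w) x u (to-consec h) (to-consec h')

cycPairs-injective : ∀ {w} {a a' b : A} → Unique w → (a , b) ∈ cycPairs w → (a' , b) ∈ cycPairs w → a ≡ a'
cycPairs-injective {w = x ∷ w} u h h' = consec-injective w x (unique-tail u) (unique-head u) (to-consec h) (to-consec h')

cycPairs-next : ∀ {w} {a : A} → a ∈ w → ∃ λ b → (a , b) ∈ cycPairs w
cycPairs-next {w = x ∷ w} h with consec-next (x ∷ w) x h
... | b , q = b , from-consec q

cycPairs-prev : ∀ {w} {b : A} → b ∈ w → ∃ λ a → (a , b) ∈ cycPairs w
cycPairs-prev {w = x ∷ w} (here refl) with consec-last x w x
... | a , q = a , from-consec q
cycPairs-prev {w = x ∷ w} (there h) with consec-prev x w x h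
... | a , q = a , from-consec q

-- A vertex whose successor is also its predecessor would close up a cycle of length two.
two-neighbours : ∀ {w} {u : A} → Unique w → 3 ≤ length w → u ∈ w →
  ∃[ v ] ∃[ v' ] ((u , v) ∈ cycPairs w × (v' , u) ∈ cycPairs w × v ≢ v')
two-neighbours {w = w} {u} uw lw u∈ with cycPairs-next {w = w} u∈ | cycPairs-prev {w = w} u∈
... | v , uv | v' , v'u = v , v' , uv , v'u , λ { refl → <⇒≱ lw (count-≤ {R = _≡_} uw (in-pair v'u) (λ { _ _ refl refl → refl })) }
  where
  in-pair : (v , u) ∈ cycPairs w → ∀ {y} → y ∈ w → ∃ λ y' → y' ∈ u ∷ v ∷ [] × y ≡ y'
  in-pair vu {y} y∈ = y , cyclic-closed (_∈ u ∷ v ∷ []) w closed u∈ (here refl) y∈ , refl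
    where
    closed : ∀ {a b} → (a , b) ∈ cycPairs w → a ∈ u ∷ v ∷ [] → b ∈ u ∷ v ∷ []
    closed h (here refl) = there (here (cycPairs-functional uw h uv))
    closed h (there (here refl)) = here (cycPairs-functional uw h vu)

Adjacent : Vert n → Vert n → Set
Adjacent u v = ∃ λ i → v ≡ flip i u

Adjacent-sym : {u v : Vert n} → Adjacent u v → Adjacent v u
Adjacent-sym {u = u} (i , refl) = i , sym (flip-flip i u)

Path : (A → A → Set) → List A → Set
Path R [] = ⊤
Path R (a ∷ []) = ⊤
Path R (a ∷ b ∷ r) = R a b × Path R (b ∷ r)

Chain⇒Path : {R : A → A → Set} (l : List A) {x : A} → Chain R l x → Path R l
Chain⇒Path [] c = tt
Chain⇒Path (a ∷ []) c = tt
Chain⇒Path (a ∷ b ∷ l) (r , c) = r , Chain⇒Path (b ∷ l) c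

Path-++ˡ : {R : A → A → Set} (l : List A) {t : List A} → Path R (l ++ t) → Path R l
Path-++ˡ [] p = tt
Path-++ˡ (a ∷ []) p = tt
Path-++ˡ (a ∷ b ∷ l) (r , p) = r , Path-++ˡ (b ∷ l) p

-- Up along 0 × P and back down along 1 × P.
ladder : List (Vert n) → List (Vert (suc n)) → List (Vert (suc n))
ladder [] acc = acc
ladder (x ∷ xs) acc = (false ∷ x) ∷ ladder xs ((true ∷ x) ∷ acc)

ladder-chain : (x : Vert n) (xs : List (Vert n)) (acc : List (Vert (suc n))) {t : Vert (suc n)} →
  Path Adjacent (x ∷ xs) → Chain Adjacent ((true ∷ x) ∷ acc) t → Chain Adjacent (ladder (x ∷ xs) acc) t
ladder-chain x [] acc p c = (zero , refl) , c
ladder-chain x (y ∷ ys) acc ((i , e) , p) c = (suc i , cong (false ∷_) e) ,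
  ladder-chain y ys ((true ∷ x) ∷ acc) p (Adjacent-sym (suc i , cong (true ∷_) e) , c)

∈-ladder : (xs : List (Vert n)) (acc : List (Vert (suc n))) {v : Vert (suc n)} → v ∈ ladder xs acc → v ∈ acc ⊎ tail v ∈ xs
∈-ladder [] acc h = inj₁ h
∈-ladder (x ∷ xs) acc (here refl) = inj₂ (here refl)
∈-ladder (x ∷ xs) acc (there h) with ∈-ladder xs ((true ∷ x) ∷ acc) h
... | inj₁ (here refl) = inj₂ (here refl)
... | inj₁ (there h') = inj₁ h'
... | inj₂ h' = inj₂ (there h')

unique-ladder : (xs : List (Vert n)) (acc : List (Vert (suc n))) → Unique xs → Unique acc → (∀ {v} → v ∈ acc → tail v ∉ xs) → Unique (ladder xs acc)
unique-ladder [] acc u ua d = ua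
unique-ladder (x ∷ xs) acc u ua d = ∷-unique fresh (unique-ladder xs ((true ∷ x) ∷ acc) (unique-tail u)
    (∷-unique (λ h → d h (here refl)) ua) λ { (here refl) h → unique-head u h ; (there h) h' → d h (there h') })
  where
  fresh : (false ∷ x) ∉ ladder xs ((true ∷ x) ∷ acc)
  fresh h with ∈-ladder xs ((true ∷ x) ∷ acc) h
  ... | inj₁ (there h') = d h' (here refl)
  ... | inj₂ h' = unique-head u h'

length-ladder : (xs : List (Vert n)) (acc : List (Vert (suc n))) → length (ladder xs acc) ≡ 2 * length xs + length acc
length-ladder [] acc = refl
length-ladder (x ∷ xs) acc = trans (cong suc (length-ladder xs ((true ∷ x) ∷ acc))) (lemma (length xs) (length acc))
  where
  lemma : ∀ a b → suc (2 * a + suc b) ≡ 2 * suc a + b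
  lemma = solve-∀

-- The reflected Gray code, a Hamiltonian path of the cube whose initial segments are paths on any
-- number of vertices up to 2^n.
gray : (n : ℕ) → List (Vert n)
gray zero = [] ∷ []
gray (suc n) = ladder (gray n) []

length-gray : ∀ n → length (gray n) ≡ 2 ^ n
length-gray zero = refl
length-gray (suc n) = trans (length-ladder (gray n) []) (trans (+-identityʳ _) (cong (2 *_) (length-gray n)))

unique-gray : ∀ n → Unique (gray n)
unique-gray zero = [] ∷ []
unique-gray (suc n) = unique-ladder (gray n) [] (unique-gray n) [] λ ()

gray-path : ∀ n → Path Adjacent (gray n)
gray-path zero = tt
gray-path (suc n) = step (gray n) (gray-path n)
  where
  step : ∀ xs → Path Adjacent xs → Path Adjacent (ladder xs [])
  step [] p = tt
  step (x ∷ xs) p = Chain⇒Path (ladder (x ∷ xs) []) {false ∷ x} (ladder-chain x xs [] p (zero , refl))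

-- The first l + 1 vertices of the Gray path are doubled across one new coordinate; the boundary of
-- this ladder passes through all its vertices.
short-cycle : ∀ l μ → suc l ≤ 2 ^ μ → ∃ λ (c₀ : Vert (suc μ)) → ∃ λ c → Unique (c₀ ∷ c) × Chain Adjacent (c₀ ∷ c) c₀ × length (c₀ ∷ c) ≡ 2 * suc l
short-cycle l μ le with split-at (suc l) (gray μ) (≤-trans le (≤-reflexive (sym (length-gray μ))))
... | x ∷ xs , ys , eq , len = (false ∷ x) , ladder xs ((true ∷ x) ∷ []) ,
      unique-ladder (x ∷ xs) [] (unique-++ˡ (x ∷ xs) (subst Unique eq (unique-gray μ))) [] (λ ()) ,
      ladder-chain x xs [] (Path-++ˡ (x ∷ xs) (subst (Path Adjacent) eq (gray-path μ))) (zero , refl) ,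
      trans (length-ladder (x ∷ xs) []) (trans (+-identityʳ _) (cong (2 *_) len))

flip-++ : ∀ {m r} (i : Fin m) (c : Vert m) (a : Vert r) → flip (i ↑ˡ r) (c Vec.++ a) ≡ flip i c Vec.++ a
flip-++ zero (b ∷ c) a = refl
flip-++ (suc i) (b ∷ c) a = cong (b ∷_) (flip-++ i c a)

module DisjointCycles {m : ℕ} (c₀ : Vert m) (cs : List (Vert m)) (unique-c : Unique (c₀ ∷ cs))
  (chain-c : Chain Adjacent (c₀ ∷ cs) c₀) (r : ℕ) where

  cyc : List (Vert m)
  cyc = c₀ ∷ cs

  place : Vert r → Vert m → Vert (m + r)
  place a c = c Vec.++ a

  place-injective : ∀ {a a' c c'} → place a c ≡ place a' c' → c ≡ c' × a ≡ a'
  place-injective {c = c} {c'} e = ++-injective c c' e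

  place² : Vert r → Vert m × Vert m → Vert (m + r) × Vert (m + r)
  place² a (c , c') = place a c , place a c'

  pairs : List (Vert (m + r) × Vert (m + r))
  pairs = concatMap (λ a → map (place² a) (cycPairs cyc)) (allVerts r)

  G : List (Edge (m + r))
  G = filterᵇ (λ e → any (joins e) pairs) (cubeEdges (m + r))

  G⊆ : G ⊆ cubeEdges (m + r)
  G⊆ = filterᵇ-⊆ (λ e → any (joins e) pairs) (cubeEdges (m + r))

  -- Orients the placed cycles. Successors and predecessors are unique, which is how the degree
  -- bound of two for G is expressed.
  Next : Vert (m + r) → Vert (m + r) → Set
  Next u v = ∃[ a ] ∃[ c ] ∃[ c' ] ((c , c') ∈ cycPairs cyc × u ≡ place a c × v ≡ place a c')

  ∈-pairs⁻ : ∀ {u v} → (u , v) ∈ pairs → Next u v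
  ∈-pairs⁻ h with ∈-concatMap⁻ (λ a → map (place² a) (cycPairs cyc)) (allVerts r) h
  ... | a , _ , h' with ∈-map⁻ (place² a) h'
  ... | (c , c') , q , refl = a , c , c' , q , refl , refl

  Next⇒Step : ∀ {u v} → Next u v → Step G u v
  Next⇒Step (a , c , c' , q , refl , refl) with Chain⇒cycPairs c₀ cs chain-c q
  ... | i , refl = i ↑ˡ r , sym (flip-++ i c a) , ∈-filterᵇ⁺ _ (edgeAt∈cubeEdges (place a c) (i ↑ˡ r))
    (true-any (joins (edgeAt (place a c) (i ↑ˡ r))) (∈-concatMap⁺ (λ a → map (place² a) (cycPairs cyc)) (∈-allVerts a) (∈-map⁺ (place² a) q))
      (subst (λ v → joins (edgeAt (place a c) (i ↑ˡ r)) (place a c , v) ≡ true) (flip-++ i c a) (joins-edgeAt (place a c) (i ↑ˡ r))))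

  Step⇒Next : ∀ {u v} → Step G u v → Next u v ⊎ Next v u
  Step⇒Next {u} {v} (i , refl , e∈) with ∈-filterᵇ⁻ (λ e → any (joins e) pairs) (cubeEdges (m + r)) e∈
  ... | e∈' , q with any-true (joins (edgeAt u i)) pairs q
  ... | (p , p') , pp∈ , j with joins⇒ {v = proj₁ (edgeAt u i)} {p} {p'} {i} (∈-cubeEdges⁻ e∈') j
  ... | eq , eq' with edgeAt-ends {u = u} {p} {i} {i} eq'
  ... | _ , inj₁ refl = inj₁ (subst (Next u) eq (∈-pairs⁻ pp∈))
  ... | _ , inj₂ refl = inj₂ (subst₂ Next (sym (flip-flip i p)) eq (∈-pairs⁻ pp∈))

  Next-functional : ∀ {u v v'} → Next u v → Next u v' → v ≡ v'
  Next-functional (a , c , c' , q , refl , refl) (b , e , e' , q' , eq , refl) with place-injective {a} {b} {c} {e} eq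
  ... | refl , refl = cong (place a) (cycPairs-functional {w = cyc} unique-c q q')

  Next-injective : ∀ {u u' v} → Next u v → Next u' v → u ≡ u'
  Next-injective (a , c , c' , q , refl , refl) (b , e , e' , q' , refl , eq) with place-injective {a} {b} {c'} {e'} eq
  ... | refl , refl = cong (place a) (cycPairs-injective {w = cyc} unique-c q q')

  -- A cycle of G visits with each vertex both of its neighbours in G, so it is one of the placed cycles.
  cycle-in-G : ∀ {S w} → S ⊆ G → IsCycle S w → 3 ≤ length w → length w ≡ length cyc
  cycle-in-G {S} {[]} S⊆ c ()
  cycle-in-G {S} {u₀ ∷ w'} S⊆ c lw = ≤-antisym
      (count-≤ {R = λ v c → v ≡ place a₀ c} unique (λ v∈ → spread v∈) (λ { _ _ refl refl → refl }))
      (count-≤ {R = λ c v → v ≡ place a₀ c} unique-c (λ {c} c∈ → place a₀ c , visit c∈ , refl)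
        (λ {c} {c'} _ _ e e' → proj₁ (place-injective {a₀} {a₀} {c} {c'} (trans (sym e) e'))))
    where
    open IsCycle c
    w = u₀ ∷ w'
    related : ∀ {u v} → (u , v) ∈ cycPairs w → Next u v ⊎ Next v u
    related h with steps h
    ... | i , e , e∈ = Step⇒Next (i , e , ⊆-∈ S⊆ e∈)
    -- The two neighbours of u on the cycle are distinct, so they are not both its predecessor under
    -- `Next`; one of them is its successor.
    next∈ : ∀ {u v} → u ∈ w → Next u v → v ∈ w
    next∈ {u} {v} u∈ nx with two-neighbours unique lw u∈
    ... | v₁ , v₂ , uv₁ , v₂u , v₁≢v₂ with related uv₁ | related v₂u
    ... | inj₁ h | _ = subst (_∈ w) (Next-functional h nx) (cycPairs-snd {w = w} uv₁)
    ... | inj₂ _ | inj₂ h = subst (_∈ w) (Next-functional h nx) (cycPairs-fst {w = w} v₂u)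
    ... | inj₂ h | inj₁ h' = ⊥-elim (v₁≢v₂ (Next-injective h h'))
    start : ∃[ a ] ∃[ c ] (c ∈ cyc × u₀ ≡ place a c)
    start with cycPairs-next {w = w} (here refl)
    ... | v , uv with related uv
    ... | inj₁ (a , c , c' , q , e , _) = a , c , cycPairs-fst {w = cyc} q , e
    ... | inj₂ (a , c , c' , q , _ , e) = a , c' , cycPairs-snd {w = cyc} q , e
    a₀ = proj₁ start
    visit : ∀ {c} → c ∈ cyc → place a₀ c ∈ w
    visit = cyclic-closed (λ c → place a₀ c ∈ w) cyc (λ {c} {c'} q h → next∈ h (a₀ , c , c' , q , refl , refl))
      (proj₁ (proj₂ (proj₂ start))) (subst (_∈ w) (proj₂ (proj₂ (proj₂ start))) (here refl))
    spread : ∀ {v} → v ∈ w → ∃ λ c → c ∈ cyc × v ≡ place a₀ c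
    spread = cyclic-closed (λ v → ∃ λ c → c ∈ cyc × v ≡ place a₀ c) w closed (here refl) (proj₂ start)
      where
      closed : ∀ {u v} → (u , v) ∈ cycPairs w → (∃ λ c → c ∈ cyc × u ≡ place a₀ c) → ∃ λ c → c ∈ cyc × v ≡ place a₀ c
      closed uv (c , c∈ , refl) with related uv
      ... | inj₁ (a , d , d' , q , e , refl) with place-injective {a₀} {a} {c} {d} e
      ... | refl , refl = d' , cycPairs-snd {w = cyc} q , refl
      closed uv (c , c∈ , refl) | inj₂ (a , d , d' , q , refl , e) with place-injective {a₀} {a} {c} {d'} e
      ... | refl , refl = d , cycPairs-fst {w = cyc} q , refl

  free-of : ∀ h → 3 ≤ h → h ≢ length cyc → N (m + r) h G ≡ 0
  free-of h h≥3 h≢ = empty (copies (m + r) h G) λ S∈ → absurd S∈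
    where
    empty : ∀ {X : Set} (xs : List X) → (∀ {x} → x ∈ xs → ⊥) → length xs ≡ 0
    empty [] f = refl
    empty (x ∷ xs) f = ⊥-elim (f (here refl))
    absurd : ∀ {S} → S ∈ copies (m + r) h G → ⊥
    absurd S∈ with copies⁻ {m = h} G⊆ S∈
    ... | S⊆ , w , len , c = h≢ (trans (sym len) (cycle-in-G S⊆ c (≤-trans h≥3 (≤-reflexive (sym len)))))

  -- An edge of a placed cycle shows in which subcube it lies, so different a give different copies.
  many-copies : 2 ^ r ≤ N (m + r) (length cyc) G
  many-copies = ≤-trans (≤-reflexive (sym (length-allVerts r)))
    (count-≤ {R = λ a S → S ≡ cycleEdges (placed a) G} (unique-allVerts r) (λ {a} _ → _ , copy a , refl) (λ { {a} {a'} _ _ e e' → same a a' (trans (sym e) e') }))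
    where
    placed : Vert r → List (Vert (m + r))
    placed a = map (place a) cyc
    placed⁻ : ∀ a {u v} → (u , v) ∈ cycPairs (placed a) → ∃[ c ] ∃[ c' ] ((c , c') ∈ cycPairs cyc × u ≡ place a c × v ≡ place a c')
    placed⁻ a h with ∈-map⁻ (place² a) (subst (_ ∈_) (cycPairs-map (place a) cyc) h)
    ... | (c , c') , q , refl = c , c' , q , refl , refl
    isC : ∀ a → IsCycle (cycleEdges (placed a) G) (placed a)
    isC a = cycleEdges-isCycle G⊆ (unique-map (λ {c} {c'} e → proj₁ (place-injective {a} {a} {c} {c'} e)) unique-c) st
      where
      st : ∀ {u v} → (u , v) ∈ cycPairs (placed a) → Step G u v
      st h with placed⁻ a h
      ... | c , c' , q , e , e' = Next⇒Step (a , c , c' , q , e , e')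
    copy : ∀ a → cycleEdges (placed a) G ∈ copies (m + r) (length cyc) G
    copy a = copies⁺ (filterᵇ-⊆ (λ e → any (joins e) (cycPairs (placed a))) G) (isC a) (length-map (place a) cyc)
    some-edge : ∀ a → ∃ λ e → e ∈ cycleEdges (placed a) G
    some-edge a with cycPairs-next {w = placed a} (here refl)
    ... | v , q with IsCycle.steps (isC a) q
    ... | i , _ , e∈ = _ , e∈
    same : ∀ a a' → cycleEdges (placed a) G ≡ cycleEdges (placed a') G → a ≡ a'
    same a a' eq with some-edge a
    ... | e , e∈ with IsCycle.covered (isC a) e∈ | IsCycle.covered (isC a') (subst (e ∈_) eq e∈)
    ... | u , v , i , uv∈ , _ , refl | u' , v' , i' , uv∈' , ev' , ee with placed⁻ a uv∈ | placed⁻ a' uv∈' | edgeAt-ends {u = u} {u'} ee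
    ... | c , _ , _ , refl , _ | d , _ , _ , refl , _ | _ , inj₁ q = proj₂ (place-injective {a} {a'} {c} {d} q)
    ... | c , _ , _ , refl , _ | _ , d' , _ , _ , refl | refl , inj₂ q = proj₂ (place-injective {a} {a'} {c} {d'} (trans q (sym ev')))

-- The extremal number

maxList-≥ : ∀ {x} xs → x ∈ xs → x ≤ maxList xs
maxList-≥ (x ∷ xs) (here refl) = m≤m⊔n x (maxList xs)
maxList-≥ (y ∷ xs) (there h) = ≤-trans (maxList-≥ xs h) (m≤n⊔m y (maxList xs))

maxList-∈ : ∀ xs → maxList xs ≡ 0 ⊎ maxList xs ∈ xs
maxList-∈ [] = inj₁ refl
maxList-∈ (x ∷ xs) with ⊔-sel x (maxList xs)
... | inj₁ e = inj₂ (here e)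
... | inj₂ e with maxList-∈ xs
... | inj₁ q = inj₁ (trans e q)
... | inj₂ q = inj₂ (there (subst (_∈ xs) (sym e) q))

ex-≥ : ∀ {h m} {G : List (Edge n)} → G ⊆ cubeEdges n → N n h G ≡ 0 → N n m G ≤ ex n m h
ex-≥ {n} {h} {m} {G} G⊆ none = maxList-≥ _ (∈-map⁺ (N n m) (∈-filterᵇ⁺ (FreeB n h) (∈-subsets⁺ G⊆) (cong (_≡ᵇ 0) none)))

ex-attained : ∀ n m h → ex n m h ≡ 0 ⊎ ∃ λ G → G ⊆ cubeEdges n × N n h G ≡ 0 × ex n m h ≡ N n m G
ex-attained n m h with maxList-∈ (map (N n m) (filterᵇ (FreeB n h) (subsets (cubeEdges n))))
... | inj₁ e = inj₁ e
... | inj₂ h' with ∈-map⁻ (N n m) h'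
... | G , G∈ , e with ∈-filterᵇ⁻ (FreeB n h) (subsets (cubeEdges n)) G∈
... | G∈' , none = inj₂ (G , ∈-subsets⁻ (cubeEdges n) G∈' , ≡ᵇ0 (N n h G) none , e)
  where
  ≡ᵇ0 : ∀ x → (x ≡ᵇ 0) ≡ true → x ≡ 0
  ≡ᵇ0 zero _ = refl

≤2^⌈log₂⌉ : ∀ k n → ⌈log₂ n ⌉ ≤ k → n ≤ 2 ^ k
≤2^⌈log₂⌉ zero zero h = z≤n
≤2^⌈log₂⌉ zero (suc zero) h = s≤s z≤n
≤2^⌈log₂⌉ zero (suc (suc n)) h = ⊥-elim (1+n≰n (≤-trans (≤-trans (≤-reflexive (sym (⌈log₂2^n⌉≡n 1))) (⌈log₂⌉-mono-≤ {2} {2 + n} (s≤s (s≤s z≤n)))) h))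
≤2^⌈log₂⌉ (suc k) n h = begin
  n                    ≡⟨ ⌊n/2⌋+⌈n/2⌉≡n n ⟨
  ⌊ n /2⌋ + ⌈ n /2⌉    ≤⟨ +-monoˡ-≤ ⌈ n /2⌉ (⌊n/2⌋≤⌈n/2⌉ n) ⟩
  ⌈ n /2⌉ + ⌈ n /2⌉    ≤⟨ +-mono-≤ half half ⟩
  2 ^ k + 2 ^ k        ≡⟨ cong (2 ^ k +_) (+-identityʳ (2 ^ k)) ⟨
  2 ^ suc k            ∎
  where
  open ≤-Reasoning
  half : ⌈ n /2⌉ ≤ 2 ^ k
  half = ≤2^⌈log₂⌉ k ⌈ n /2⌉ (≤-trans (≤-reflexive (⌈log₂⌈n/2⌉⌉≡⌈log₂n⌉∸1 n)) (∸-monoˡ-≤ 1 h))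

-- ⌈log₂ 2ℓ⌉ is 1 + ⌈log₂ ℓ⌉, and a Gray path on ℓ vertices fits into ⌈log₂ ℓ⌉ coordinates, the
-- ladder adding one. The other r coordinates index the subcubes.
ex-lower : ∀ l k r → 2 ≤ k → suc l ≢ k →
  2 ^ r ≤ ex (⌈log₂ (2 * suc l) ⌉ + r) (2 * suc l) (2 * k)
ex-lower l k r k≥2 l≢k = subst (λ x → 2 ^ r ≤ ex (x + r) (2 * suc l) (2 * k)) (sym (⌈log₂2*n⌉≡1+⌈log₂n⌉ (suc l))) core
  where
  μ = ⌈log₂ suc l ⌉
  core : 2 ^ r ≤ ex (suc μ + r) (2 * suc l) (2 * k)
  core with short-cycle l μ (≤2^⌈log₂⌉ μ (suc l) ≤-refl)
  ... | c₀ , cs , u , ch , len = ≤-trans (subst (λ x → 2 ^ r ≤ N (suc μ + r) x G) len many-copies)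
      (ex-≥ {h = 2 * k} {2 * suc l} G⊆ (free-of (2 * k) (≤-trans (n≤1+n 3) (*-monoʳ-≤ 2 k≥2)) (λ e → l≢k (sym (*-cancelˡ-≡ k (suc l) 2 (trans e len))))))
    where open DisjointCycles c₀ cs u ch r

open import Data.Integer as ℤ using (+_)

-- Fractions

frac-≤ : ∀ {a b c e} → 0 < b → 0 < e → a * e ≤ c * b → frac a b ≤ℚ frac c e
frac-≤ {a} {suc b} {c} {suc e} _ _ h = ℚ.toℚᵘ-cancel-≤ (begin
  toℚᵘ (frac a (suc b)) ≃⟨ ℚ.toℚᵘ-fromℚᵘ (mkℚᵘ (+ a) b) ⟩
  mkℚᵘ (+ a) b          ≤⟨ *≤* (subst₂ ℤ._≤_ (ℤ.pos-* a (suc e)) (ℤ.pos-* c (suc b)) (ℤ.+≤+ h)) ⟩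
  mkℚᵘ (+ c) e          ≃⟨ ℚ.toℚᵘ-fromℚᵘ (mkℚᵘ (+ c) e) ⟨
  toℚᵘ (frac c (suc e)) ∎)
  where open ℚᵘ.≤-Reasoning

frac-* : ∀ {a b c e} → 0 < b → 0 < e → frac a b *ℚ frac c e ≡ frac (a * c) (b * e)
frac-* {a} {suc b} {c} {suc e} _ _ = ℚ.toℚᵘ-injective (begin-equality
  toℚᵘ (frac a (suc b) *ℚ frac c (suc e))               ≃⟨ ℚ.toℚᵘ-homo-* (frac a (suc b)) (frac c (suc e)) ⟩
  toℚᵘ (frac a (suc b)) ℚᵘ.* toℚᵘ (frac c (suc e))      ≃⟨ ℚᵘ.*-cong (ℚ.toℚᵘ-fromℚᵘ (mkℚᵘ (+ a) b)) (ℚ.toℚᵘ-fromℚᵘ (mkℚᵘ (+ c) e)) ⟩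
  mkℚᵘ (+ a) b ℚᵘ.* mkℚᵘ (+ c) e                        ≡⟨ cong (λ x → mkℚᵘ x (e + b * suc e)) (sym (ℤ.pos-* a c)) ⟩
  mkℚᵘ (+ (a * c)) (e + b * suc e)                      ≃⟨ ℚ.toℚᵘ-fromℚᵘ _ ⟨
  toℚᵘ (frac (a * c) (suc b * suc e))                   ∎)
  where open ℚᵘ.≤-Reasoning

^-positive : ∀ {b} m → 0 < b → 0 < b ^ m
^-positive {suc b} m _ = m^n>0 (suc b) m

powℚ-frac : ∀ {a b} m → 0 < b → powℚ (frac a b) m ≡ frac (a ^ m) (b ^ m)
powℚ-frac zero h = refl
powℚ-frac {a} {b} (suc m) h = trans (cong (frac a b *ℚ_) (powℚ-frac m h)) (frac-* h (^-positive m h))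

frac-nonNeg : ∀ a b → 0ℚ ≤ℚ frac a b
frac-nonNeg a zero = ℚ.≤-refl
frac-nonNeg a (suc b) = frac-≤ {0} {1} {a} {suc b} (s≤s z≤n) (s≤s z≤n) z≤n

-- ε is at least the reciprocal of its denominator 1 + j.
1-ε≤ : ∀ ε → 0ℚ <ℚ ε → ∃ λ j → 1ℚ - ε ≤ℚ frac j (suc j)
1-ε≤ (mkℚ (+ zero) j c) (ℚ.*<* (ℤ.+<+ ()))
1-ε≤ ε@(mkℚ (+ suc e) j c) _ = j , ℚ.toℚᵘ-cancel-≤ (begin
  toℚᵘ (1ℚ - ε)                        ≃⟨ ℚᵘ.≃-trans (ℚ.toℚᵘ-homo-+ 1ℚ (ℚ.- ε)) (ℚᵘ.+-congʳ (toℚᵘ 1ℚ) (ℚ.toℚᵘ-homo‿- ε)) ⟩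
  mkℚᵘ (+ 1) 0 ℚᵘ.- mkℚᵘ (+ suc e) j
    ≤⟨ *≤* (subst₂ ℤ._≤_ (cong (ℤ._* + suc j) (sym num)) (cong (λ x → + j ℤ.* + suc x) (sym (+-identityʳ j))) (ℤ.*-monoʳ-≤-nonNeg (+ suc j) (ℤ.m⊖n≤m j e))) ⟩
  mkℚᵘ (+ j) j                         ≃⟨ ℚ.toℚᵘ-fromℚᵘ (mkℚᵘ (+ j) j) ⟨
  toℚᵘ (frac j (suc j))                ∎)
  where
  open ℚᵘ.≤-Reasoning
  num : + 1 ℤ.* + suc j ℤ.+ (ℤ.- (+ suc e)) ℤ.* + 1 ≡ j ℤ.⊖ e
  num = trans (cong₂ ℤ._+_ (ℤ.*-identityˡ (+ suc j)) (ℤ.*-identityʳ (ℤ.- (+ suc e)))) (ℤ.[1+m]⊖[1+n]≡m⊖n j e)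

powℚ-1 : ∀ m → powℚ 1ℚ m ≡ frac 1 1
powℚ-1 zero = refl
powℚ-1 (suc m) = trans (cong (1ℚ *ℚ_) (powℚ-1 m)) (ℚ.*-identityˡ 1ℚ)

frac-upper : ∀ a b n m → 0 < m → a ^ m * n ≤ b ^ m → powℚ (frac a b) m *ℚ ((+ n) /ℚ 1) ≤ℚ powℚ 1ℚ m
-- A zero denominator gives the value 0, the same as `frac 0 1`; as m is positive, 0 ^ m vanishes.
frac-upper a zero n m@(suc _) m>0 h = frac-upper 0 1 n m m>0 z≤n
frac-upper a b@(suc _) n m m>0 h = positive-case b (s≤s z≤n) h
  where
  positive-case : ∀ b → 0 < b → a ^ m * n ≤ b ^ m → powℚ (frac a b) m *ℚ ((+ n) /ℚ 1) ≤ℚ powℚ 1ℚ m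
  positive-case b b>0 h = subst₂ _≤ℚ_ (sym eq) (sym (powℚ-1 m))
    (frac-≤ {a ^ m * n} {b ^ m * 1} {1} {1} (subst (0 <_) (sym (*-identityʳ _)) (^-positive {b} m b>0)) (s≤s z≤n)
      (subst₂ _≤_ (sym (*-identityʳ _)) (sym (trans (*-identityˡ _) (*-identityʳ _))) h))
    where
    eq : powℚ (frac a b) m *ℚ frac n 1 ≡ frac (a ^ m * n) (b ^ m * 1)
    eq = trans (cong (_*ℚ frac n 1) (powℚ-frac m b>0)) (frac-* {a ^ m} {b ^ m} {n} {1} (^-positive m b>0) (s≤s z≤n))

frac-lower : ∀ {p q a b j ε} → 1ℚ - ε ≤ℚ frac j (suc j) → (0 < q → 0 < b × p * j * b ≤ a * (q * suc j)) →
  frac p q *ℚ (1ℚ - ε) ≤ℚ frac a b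
-- Here the left side is 0 by the convention for `frac`.
frac-lower {p} {zero} {a} {b} {ε = ε} h f = subst (_≤ℚ frac a b) (sym (ℚ.*-zeroˡ (1ℚ - ε))) (frac-nonNeg a b)
frac-lower {p} {q@(suc _)} {a} {b} {j} {ε} h f with f (s≤s z≤n)
... | b>0 , le = ℚ.≤-trans (ℚ.*-monoˡ-≤-nonNeg (frac p q) {{ℚ.nonNegative (frac-nonNeg p q)}} h)
    (subst (_≤ℚ frac a b) (sym (frac-* {p} {q} {j} {suc j} (s≤s z≤n) (s≤s z≤n))) (frac-≤ {p * j} {q * suc j} {a} {b} (s≤s z≤n) b>0 le))

length-allSub-suc : ∀ n j → length (allSub (suc n) (suc j)) ≡ 2 * length (allSub n (suc j)) + length (allSub n j)
length-allSub-suc n j = trans (length-++ (map (fix false) S)) (trans (cong₂ _+_ (length-map (fix false) S)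
  (trans (length-++ (map (fix true) S)) (cong₂ _+_ (length-map (fix true) S) (length-map free (allSub n j)))))
  (lemma (length S) (length (allSub n j))))
  where
  S = allSub n (suc j)
  lemma : ∀ a b → a + (a + b) ≡ 2 * a + b
  lemma = solve-∀

length-allSub-zero : ∀ n → length (allSub (suc n) 0) ≡ 2 * length (allSub n 0)
length-allSub-zero n = trans (length-++ (map (fix false) S)) (cong₂ _+_ (length-map (fix false) S)
  (trans (length-++ (map (fix true) S)) (cong (_+ 0) (length-map (fix true) S))))
  where
  S = allSub n 0

-- Both sides count the pairs of a (j+1)-dimensional subcube and one of its facets.
facets : ∀ n j → 2 * suc j * length (allSub n (suc j)) + j * length (allSub n j) ≡ n * length (allSub n j)
facets zero zero = refl
facets zero (suc j) = trans (cong₂ _+_ (*-zeroʳ (2 * suc (suc j))) (*-zeroʳ (suc j))) refl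
facets (suc n) zero rewrite length-allSub-suc n 0 | length-allSub-zero n = trans (lemma s₁ s₀) (trans (cong (λ x → 2 * x + 2 * s₀) (facets n 0)) (lemma₂ n s₀))
  where
  s₁ = length (allSub n 1)
  s₀ = length (allSub n 0)
  lemma : ∀ a b → 2 * 1 * (2 * a + b) + 0 * (2 * b) ≡ 2 * (2 * 1 * a + 0 * b) + 2 * b
  lemma = solve-∀
  lemma₂ : ∀ n b → 2 * (n * b) + 2 * b ≡ suc n * (2 * b)
  lemma₂ = solve-∀
facets (suc n) (suc i) rewrite length-allSub-suc n (suc i) | length-allSub-suc n i =
  trans (lemma i s₁ s₀ D) (trans (cong₂ (λ x y → 2 * x + y + (2 * s₀ + D)) (facets n (suc i)) (facets n i)) (lemma₂ n s₀ D))
  where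
  s₁ = length (allSub n (suc (suc i)))
  s₀ = length (allSub n (suc i))
  D = length (allSub n i)
  lemma : ∀ i a b c → 2 * suc (suc i) * (2 * a + b) + suc i * (2 * b + c) ≡
    2 * (2 * suc (suc i) * a + suc i * b) + (2 * suc i * b + i * c) + (2 * b + c)
  lemma = solve-∀
  lemma₂ : ∀ n b c → 2 * (n * b) + n * c + (2 * b + c) ≡ suc n * (2 * b + c)
  lemma₂ = solve-∀

-- By `facets` the subcubes of dimension l + 1 outnumber those of dimension l by the factor (n - l)
-- / (2(l + 1)), which the hypothesis makes at least XY.
small-dominated : ∀ n l X Y → l + 2 * suc l * (X * Y) ≤ n → X * (length (allSub n l) * Y) ≤ length (allSub n (suc l))
small-dominated n l X Y h = *-cancelˡ-≤ (2 * suc l) (+-cancelʳ-≤ (l * s₀) _ _ (begin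
  2 * suc l * (X * (s₀ * Y)) + l * s₀ ≡⟨ lemma (2 * suc l) X Y s₀ l ⟩
  (l + 2 * suc l * (X * Y)) * s₀     ≤⟨ *-monoˡ-≤ s₀ h ⟩
  n * s₀                             ≡⟨ facets n l ⟨
  2 * suc l * s₁ + l * s₀             ∎))
  where
  open ≤-Reasoning
  s₁ = length (allSub n (suc l))
  s₀ = length (allSub n l)
  lemma : ∀ s x y b l → s * (x * (b * y)) + l * b ≡ (l + s * (x * y)) * b
  lemma = solve-∀

-- Yields ⌈log₂ 2ℓ⌉ ≤ ℓ for ℓ ≥ 2, so the truncated subtraction in `lowerTerm` is a true one.
double≤2^ : ∀ l → 1 ≤ l → 2 * suc l ≤ 2 ^ suc l
double≤2^ (suc zero) _ = ≤-refl
double≤2^ (suc (suc l)) _ = begin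
  2 * suc (suc (suc l))             ≤⟨ subst (2 * suc (suc (suc l)) ≤_) (lemma l) (m≤m+n _ (2 + 2 * l)) ⟩
  2 * (2 * suc (suc l))             ≤⟨ *-monoʳ-≤ 2 (double≤2^ (suc l) (s≤s z≤n)) ⟩
  2 ^ suc (suc (suc l))             ∎
  where
  open ≤-Reasoning
  lemma : ∀ l → 2 * suc (suc (suc l)) + (2 + 2 * l) ≡ 2 * (2 * suc (suc l))
  lemma = solve-∀

N-mono : ∀ {m} {G : List (Edge n)} → G ⊆ cubeEdges n → N n m G ≤ N n m (cubeEdges n)
N-mono {n} {m} {G} G⊆ = count-≤ {R = _≡_} (unique-copies n m G G⊆) (λ {S} S∈ → S , copies-mono n m G⊆ S∈ , refl) (λ { _ _ refl refl → refl })

-- With s₁ subcubes of dimension ℓ and s₀ of dimension ℓ - 1, the cube has at most s₁ Z + s₀ Y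
-- cycles. For large n, j s₀ Y ≤ s₁ Z, so j times the count is at most (j + 1) s₁ Z, and j / (j + 1)
-- is at least 1 - ε.
lower : ∀ l k → 1 ≤ l → 2 ≤ k → suc l ≢ k → (ε : ℚ) → 0ℚ <ℚ ε →
  ∃[ N₀ ] (∀ n → N₀ ≤ n → lowerTerm n (suc l) *ℚ (1ℚ - ε) ≤ℚ d n (2 * suc l) (2 * k))
lower l k l≥1 k≥2 l≢k ε ε>0 with 1-ε≤ ε ε>0
... | j , ε≤ = N₀ , λ n n≥ → frac-lower {2 ^ (suc l ∸ m)} {(n C suc l) * z (suc l) (suc l)} {ex n (2 * suc l) (2 * k)} {N n (2 * suc l) (cubeEdges n)} {j} {ε}
    ε≤ (λ q>0 → bound n n≥ q>0)
  where
  m = ⌈log₂ (2 * suc l) ⌉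
  Z = z (suc l) (suc l)
  Y = N l (2 * suc l) (cubeEdges l)
  N₀ : ℕ
  -- Makes s₁ / s₀ at least jY and ensures n ≥ ℓ ≥ m.
  N₀ = suc l + 2 * suc l * (j * Y)
  m≤ : m ≤ suc l
  m≤ = ≤-trans (⌈log₂⌉-mono-≤ (double≤2^ l l≥1)) (≤-reflexive (⌈log₂2^n⌉≡n (suc l)))
  p = 2 ^ (suc l ∸ m)
  bound : ∀ n → N₀ ≤ n → 0 < (n C suc l) * Z →
    0 < N n (2 * suc l) (cubeEdges n) × p * j * N n (2 * suc l) (cubeEdges n) ≤ ex n (2 * suc l) (2 * k) * ((n C suc l) * Z * suc j)
  bound n n≥ q>0 with m≤n⇒∃[o]m+o≡n (≤-trans m≤ (≤-trans (m≤m+n (suc l) _) n≥))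
  ... | r , refl = nonzero , main
    where
    open ≤-Reasoning
    a = ex (m + r) (2 * suc l) (2 * k)
    b = N (m + r) (2 * suc l) (cubeEdges (m + r))
    s₁ = length (allSub (m + r) (suc l))
    s₀ = length (allSub (m + r) l)
    binom = (m + r) C suc l
    a≥ : 2 ^ r ≤ a
    a≥ = ex-lower l k r k≥2 l≢k
    nonzero : 0 < b
    nonzero with ex-attained (m + r) (2 * suc l) (2 * k)
    ... | inj₁ e = ⊥-elim (<⇒≱ (m^n>0 2 r) (≤-trans a≥ (≤-reflexive e)))
    ... | inj₂ (G , G⊆ , _ , e) = ≤-trans (m^n>0 2 r) (≤-trans a≥ (≤-trans (≤-reflexive e) (N-mono {m = 2 * suc l} G⊆)))
    Z≥1 : 1 ≤ Z
    Z≥1 = positive-right binom Z q>0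
      where
      positive-right : ∀ x y → 0 < x * y → 1 ≤ y
      positive-right x zero h = ⊥-elim (<⇒≱ h (≤-reflexive (*-zeroʳ x)))
      positive-right x (suc y) h = s≤s z≤n
    count : b ≤ s₁ * Z + s₀ * Y
    count = cycle-count l (≤-trans (n≤1+n l) (≤-trans (m≤m+n (suc l) _) n≥))
    dominated : j * (s₀ * Y) ≤ s₁ * Z
    dominated = ≤-trans (small-dominated (m + r) l j Y (≤-trans (+-monoˡ-≤ _ (n≤1+n l)) n≥))
      (≤-trans (≤-reflexive (sym (*-identityʳ s₁))) (*-monoʳ-≤ s₁ Z≥1))
    -- Both sides are 2^(n-m) (n C ℓ); the extra factor 2^m lets the truncated exponents recombine.
    p*s₁ : p * s₁ ≡ 2 ^ r * binom
    p*s₁ = *-cancelʳ-≡ (p * s₁) (2 ^ r * binom) (2 ^ m) {{m^n≢0 2 m}} (begin-equality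
      p * s₁ * 2 ^ m       ≡⟨ lemma₁ p s₁ (2 ^ m) ⟩
      s₁ * (p * 2 ^ m)     ≡⟨ cong (s₁ *_) (trans (sym (^-distribˡ-+-* 2 (suc l ∸ m) m)) (cong (2 ^_) (m∸n+n≡m m≤))) ⟩
      s₁ * 2 ^ suc l       ≡⟨ length-allSub (m + r) (suc l) ⟩
      binom * 2 ^ (m + r) ≡⟨ cong (binom *_) (^-distribˡ-+-* 2 m r) ⟩
      binom * (2 ^ m * 2 ^ r) ≡⟨ lemma₂ binom (2 ^ m) (2 ^ r) ⟩
      2 ^ r * binom * 2 ^ m ∎)
      where
      lemma₁ : ∀ x y w → x * y * w ≡ y * (x * w)
      lemma₁ = solve-∀
      lemma₂ : ∀ x y w → x * (y * w) ≡ w * x * y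
      lemma₂ = solve-∀
    main : p * j * b ≤ a * (binom * Z * suc j)
    main = begin
      p * j * b                       ≤⟨ *-monoʳ-≤ (p * j) count ⟩
      p * j * (s₁ * Z + s₀ * Y)         ≡⟨ lemma₁ p j (s₁ * Z) (s₀ * Y) ⟩
      p * (j * (s₁ * Z) + j * (s₀ * Y)) ≤⟨ *-monoʳ-≤ p (+-monoʳ-≤ (j * (s₁ * Z)) dominated) ⟩
      p * (j * (s₁ * Z) + s₁ * Z)       ≡⟨ lemma₂ p j s₁ Z ⟩
      p * s₁ * (Z * suc j)             ≡⟨ cong (_* (Z * suc j)) p*s₁ ⟩
      2 ^ r * binom * (Z * suc j)     ≤⟨ *-monoˡ-≤ (Z * suc j) (*-monoˡ-≤ binom a≥) ⟩
      a * binom * (Z * suc j)         ≡⟨ lemma₃ a binom Z (suc j) ⟩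
      a * (binom * Z * suc j)         ∎
      where
      lemma₁ : ∀ p j x y → p * j * (x + y) ≡ p * (j * x + j * y)
      lemma₁ = solve-∀
      lemma₂ : ∀ p j a z → p * (j * (a * z) + a * z) ≡ p * a * (z * suc j)
      lemma₂ = solve-∀
      lemma₃ : ∀ a b z j → a * b * (z * j) ≡ a * (b * z * j)
      lemma₃ = solve-∀

-- Exponents and the upper bound

cube-cancel : ∀ {x y} → x ^ 3 ≤ y ^ 3 → x ≤ y
cube-cancel h = ≮⇒≥ λ lt → <⇒≱ (^-monoˡ-< 3 lt) h

^-distribʳ-* : ∀ e x y → (x * y) ^ e ≡ x ^ e * y ^ e
^-distribʳ-* zero x y = refl
^-distribʳ-* (suc e) x y = trans (cong (x * y *_) (^-distribʳ-* e x y)) (lemma x y (x ^ e) (y ^ e))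
  where
  lemma : ∀ x y a b → x * y * (a * b) ≡ x * a * (y * b)
  lemma = solve-∀

-- The hypothesis is raised to the power g, with t + 1 for t to make up for rounding. The number 1 ⊔
-- t satisfies it with κ + 1, also when t = 0, and t + 1 is at most twice that number.
amplify : ∀ e f g {n t κ L} .{{_ : NonZero n}} → t ^ e ≤ n ^ f * κ →
  (L * suc t) ^ (e * g) ≤ (L * 2) ^ (e * g) * suc κ ^ g * n ^ (f * g)
amplify e f g {n} {t} {κ} {L} te = begin
  (L * suc t) ^ (e * g)                       ≤⟨ ^-monoˡ-≤ (e * g) (*-monoʳ-≤ L (double t)) ⟩
  (L * (2 * s)) ^ (e * g)                     ≡⟨ trans (cong (_^ (e * g)) (sym (*-assoc L 2 s))) (^-distribʳ-* (e * g) (L * 2) s) ⟩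
  (L * 2) ^ (e * g) * s ^ (e * g)             ≡⟨ cong ((L * 2) ^ (e * g) *_) (^-*-assoc s e g) ⟨
  (L * 2) ^ (e * g) * (s ^ e) ^ g             ≤⟨ *-monoʳ-≤ ((L * 2) ^ (e * g)) (^-monoˡ-≤ g (se t te)) ⟩
  (L * 2) ^ (e * g) * (n ^ f * suc κ) ^ g     ≡⟨ cong ((L * 2) ^ (e * g) *_) (trans (^-distribʳ-* g (n ^ f) (suc κ)) (cong (_* suc κ ^ g) (^-*-assoc n f g))) ⟩
  (L * 2) ^ (e * g) * (n ^ (f * g) * suc κ ^ g) ≡⟨ lemma ((L * 2) ^ (e * g)) (n ^ (f * g)) (suc κ ^ g) ⟩
  (L * 2) ^ (e * g) * suc κ ^ g * n ^ (f * g) ∎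
  where
  open ≤-Reasoning
  s = 1 ⊔ t
  double : ∀ t → suc t ≤ 2 * (1 ⊔ t)
  double zero = s≤s z≤n
  double (suc t) = ≤-trans (s≤s (≤-trans (s≤s ≤-refl) (m≤n+m (suc t) t))) (≤-reflexive (lemma t))
    where
    lemma : ∀ t → suc (t + suc t) ≡ 2 * suc t
    lemma = solve-∀
  se : ∀ t → t ^ e ≤ n ^ f * κ → (1 ⊔ t) ^ e ≤ n ^ f * suc κ
  se zero h = ≤-trans (≤-reflexive (^-zeroˡ e)) (*-mono-≤ (m^n>0 n f) (s≤s z≤n))
  se (suc t) h = ≤-trans h (*-monoʳ-≤ (n ^ f) (n≤1+n κ))
  lemma : ∀ x y w → x * (y * w) ≡ x * w * y
  lemma = solve-∀

-- A bound t = O(n^(11/12)) beats n^(15/16) by the factor n^(1/48).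
absorb : ∀ κ L → ∃ λ W → ∀ n t .{{_ : NonZero n}} → W ≤ n → t ^ 12 ≤ n ^ 11 * κ → (L * suc t) ^ 16 ≤ n ^ 15
absorb κ L = W , λ n t n≥ t¹² → cube-cancel (begin
  ((L * suc t) ^ 16) ^ 3   ≡⟨ ^-*-assoc (L * suc t) 16 3 ⟩
  -- 48 is the common multiple of 16 and 12. The fourth power of the hypothesis has n^44 against
  -- n^45 in the goal, and the spare factor n outweighs W.
  (L * suc t) ^ (12 * 4)   ≤⟨ amplify 12 11 4 {n} {t} {κ} {L} t¹² ⟩
  W * n ^ (11 * 4)         ≤⟨ *-monoˡ-≤ (n ^ (11 * 4)) n≥ ⟩
  n ^ (15 * 3)             ≡⟨ ^-*-assoc n 15 3 ⟨
  (n ^ 15) ^ 3             ∎)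
  where
  open ≤-Reasoning
  W = (L * 2) ^ (12 * 4) * suc κ ^ 4

-- The ratio a / b is at most x / n by the first inequality, and x / n is at most n^(-1/f) by the
-- second.
^-cancel-linear : ∀ e f → f ≡ suc e → ∀ {a b x n} .{{_ : NonZero n}} → a * n ≤ x * b → x ^ f ≤ n ^ e → a ^ f * n ≤ b ^ f
^-cancel-linear e _ refl {a} {b} {x} {n} h₁ h₂ = *-cancelʳ-≤ (a ^ suc e * n) (b ^ suc e) (n ^ e) {{m^n≢0 n e}} (begin
  a ^ suc e * n * n ^ e     ≡⟨ *-assoc (a ^ suc e) n (n ^ e) ⟩
  a ^ suc e * n ^ suc e     ≡⟨ ^-distribʳ-* (suc e) a n ⟨
  (a * n) ^ suc e           ≤⟨ ^-monoˡ-≤ (suc e) h₁ ⟩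
  (x * b) ^ suc e           ≡⟨ ^-distribʳ-* (suc e) x b ⟩
  x ^ suc e * b ^ suc e     ≤⟨ *-monoˡ-≤ (b ^ suc e) h₂ ⟩
  n ^ e * b ^ suc e         ≡⟨ *-comm (n ^ e) (b ^ suc e) ⟩
  b ^ suc e * n ^ e         ∎)
  where open ≤-Reasoning

module _ (n m : ℕ) (m≥1 : 1 ≤ m) {G : List (Edge n)} (G⊆ : G ⊆ cubeEdges n) where

  private
    instance
      2^n≢0 : NonZero (2 ^ n)
      2^n≢0 = m^n≢0 2 n

  -- |G| / 2^n is half the average degree of G. Rounded down it is an admissible t for `turán`, and
  -- its successor bounds |G| from above.
  halfDegree : ℕ
  halfDegree = length G / 2 ^ n

  halfDegree-≤ : halfDegree * 2 ^ n ≤ length G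
  halfDegree-≤ = ≤-trans (m≤n+m (halfDegree * 2 ^ n) (length G % 2 ^ n)) (≤-reflexive (sym (m≡m%n+[m/n]*n (length G) (2 ^ n))))

  ≤-halfDegree : length G ≤ suc halfDegree * 2 ^ n
  ≤-halfDegree = ≤-trans (≤-reflexive (m≡m%n+[m/n]*n (length G) (2 ^ n))) (+-monoˡ-≤ (halfDegree * 2 ^ n) (<⇒≤ (m%n<n (length G) (2 ^ n))))

  -- Of the factor 2m, the m comes from `averaging` and the 2 from the n 2^(n-1) edges of the cube.
  copies-halfDegree : N n m G * n ≤ 2 * m * suc halfDegree * N n m (cubeEdges n)
  copies-halfDegree = *-cancelʳ-≤ (N n m G * n) (2 * m * suc halfDegree * N n m (cubeEdges n)) (2 ^ n) (begin
    a * n * P                      ≡⟨ *-assoc a n P ⟩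
    a * (n * P)                    ≡⟨ cong (a *_) (length-cubeEdges n) ⟨
    a * (2 * length (cubeEdges n)) ≡⟨ lemma₁ a (length (cubeEdges n)) ⟩
    2 * (a * length (cubeEdges n)) ≤⟨ *-monoʳ-≤ 2 (averaging n m m≥1 G⊆) ⟩
    2 * (length G * (m * b))       ≤⟨ *-monoʳ-≤ 2 (*-monoˡ-≤ (m * b) ≤-halfDegree) ⟩
    2 * (suc halfDegree * P * (m * b)) ≡⟨ lemma₂ (suc halfDegree) P m b ⟩
    2 * m * suc halfDegree * b * P ∎)
    where
    open ≤-Reasoning
    a = N n m G
    b = N n m (cubeEdges n)
    P = 2 ^ n
    lemma₁ : ∀ a e → a * (2 * e) ≡ 2 * (a * e)
    lemma₁ = solve-∀
    lemma₂ : ∀ t p m b → 2 * (t * p * (m * b)) ≡ 2 * m * t * b * p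
    lemma₂ = solve-∀

d-upper : (κ : ℕ → ℕ) (W m e f g : ℕ) → 0 < f → f ≡ suc g → (∀ n t .{{_ : NonZero n}} → W ≤ n → t ^ e ≤ κ n → (2 * m * suc t) ^ f ≤ n ^ g) →
  ∀ h n → suc W ≤ n → 1 ≤ m → (∀ G t → G ⊆ cubeEdges n → N n h G ≡ 0 → t * 2 ^ n ≤ length G → t ^ e ≤ κ n) →
  powℚ (d n m h) f *ℚ ((+ n) /ℚ 1) ≤ℚ powℚ 1ℚ f
d-upper κ W m e f g f>0 f≡ absorbed h n n≥ m≥1 turán-bound = frac-upper (ex n m h) b n f f>0 bound
  where
  b = N n m (cubeEdges n)
  bound : ex n m h ^ f * n ≤ b ^ f
  bound with ex-attained n m h
  ... | inj₁ q = subst (λ x → x ^ f * n ≤ b ^ f) (sym q) (≤-trans (≤-reflexive (cong (λ f → 0 ^ f * n) f≡)) z≤n)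
  ... | inj₂ (G , G⊆ , none , q) = subst (λ x → x ^ f * n ≤ b ^ f) (sym q)
      (^-cancel-linear g f f≡ {N n m G} {b} {2 * m * suc t} {n} (copies-halfDegree n m m≥1 G⊆)
        (absorbed n t (≤-trans (n≤1+n W) n≥) (turán-bound G t G⊆ none (halfDegree-≤ n m m≥1 G⊆))))
    where
    t = halfDegree n m m≥1 G⊆
    instance
      n≢0 : NonZero n
      n≢0 = >-nonZero (≤-trans (s≤s z≤n) n≥)

-- m affects only the threshold: `absorb` with L = 2m trades both the loss 2m and κ for the demand
-- that n be large, which leaves the constant 1.
upper : ∀ k → 4 ≤ k → k ≢ 5 → ∀ m → 1 ≤ m → ∃[ N₀ ] (∀ n → N₀ ≤ n →
  powℚ (d n m (2 * k)) 16 *ℚ ((+ n) /ℚ 1) ≤ℚ powℚ 1ℚ 16)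
upper k k≥4 k≢5 m m≥1 =
  let κ , turán-bound = turán k k≥4 k≢5
      W , absorbed = absorb κ (2 * m)
  in suc W , λ n n≥ →
  d-upper (λ n → n ^ 11 * κ) W m 12 16 15 (s≤s z≤n) refl absorbed (2 * k) n n≥ m≥1
    (turán-bound n {{>-nonZero (≤-trans (s≤s z≤n) n≥)}})

eventually : ∀ {P : ℕ → Set} {Q R : ℕ → Set} → ∃[ N₀ ] (∀ n → N₀ ≤ n → P n) → ∃[ N₀ ] (∀ n → N₀ ≤ n → Q n → R n → P n)
eventually (N₀ , h) = N₀ , λ n n≥ _ _ → h n n≥

theorem7 : (k : ℕ) → 4 ≤ k → k ≢ 5 →
    ∃[ c ] (0ℚ <ℚ c ×
    ((ℓ : ℕ) → 2 ≤ ℓ → ℓ ≢ k →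
    (∃[ N₀ ] ((n : ℕ) → N₀ ≤ n → k ≤ 2 ^ n → ℓ ≤ 2 ^ n →
    powℚ (d n (2 * ℓ) (2 * k)) 16 *ℚ ((+ n) /ℚ 1) ≤ℚ powℚ c 16))
    ×
    ((ε : ℚ) → 0ℚ <ℚ ε → ∃[ N₀ ] ((n : ℕ) → N₀ ≤ n → k ≤ 2 ^ n → ℓ ≤ 2 ^ n →
    lowerTerm n ℓ *ℚ (1ℚ - ε) ≤ℚ d n (2 * ℓ) (2 * k)))))
theorem7 k k≥4 k≢5 = 1ℚ , ℚ.positive⁻¹ 1ℚ , bounds
  where
  bounds : (ℓ : ℕ) → 2 ≤ ℓ → ℓ ≢ k →
    (∃[ N₀ ] ((n : ℕ) → N₀ ≤ n → k ≤ 2 ^ n → ℓ ≤ 2 ^ n →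
    powℚ (d n (2 * ℓ) (2 * k)) 16 *ℚ ((+ n) /ℚ 1) ≤ℚ powℚ 1ℚ 16))
    ×
    ((ε : ℚ) → 0ℚ <ℚ ε → ∃[ N₀ ] ((n : ℕ) → N₀ ≤ n → k ≤ 2 ^ n → ℓ ≤ 2 ^ n →
    lowerTerm n ℓ *ℚ (1ℚ - ε) ≤ℚ d n (2 * ℓ) (2 * k)))
  bounds (suc l) (s≤s l≥1) ℓ≢k =
    eventually (upper k k≥4 k≢5 (2 * suc l) (s≤s z≤n)) ,
    λ ε ε>0 → eventually (lower l k l≥1 (≤-trans (s≤s (s≤s z≤n)) k≥4) ℓ≢k ε ε>0)
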